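{- Let $\mathcal{Q}_p[\bigcirc,\Diamond_r]$ be the class of path-shaped queries built with $\bigcirc$ (next) and $\Diamond_r$ (now or later), let $\mathcal{Q}_p[\bigcirc,\Diamond]$ be the class of path-shaped queries built with $\bigcirc$ and strict $\Diamond$, and let "safe" be as defined in the context. Then: (i) A query $q\in\mathcal{Q}_p[\bigcirc,\Diamond_r]$ is uniquely characterisable within $\mathcal{Q}_p[\bigcirc,\Diamond_r]$ if and only if $q$ is safe. (ii) Those queries that are uniquely characterisable within $\mathcal{Q}_p[\bigcirc,\Diamond_r]$ are actually polynomially characterisable within $\mathcal{Q}_p[\bigcirc,\Diamond_r]$: there is a polynomial $f$ such that every $q\in\mathcal{Q}_p[\bigcirc,\Diamond_r]$ that is uniquely characterisable within $\mathcal{Q}_p[\bigcirc,\Diamond_r]$ is uniquely characterised within $\mathcal{Q}_p[\bigcirc,\Diamond_r]$ by some example set $E$ with $|E|\le f(|q|)$. (iii) The class $\mathcal{Q}_p[\bigcirc,\Diamond_r]$ is polynomially characterisable for bounded query size. (iv) The class $\mathcal{Q}_p[\bigcirc,\Diamond]$ is polynomially characterisable (within itself).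
   Context: **Data.** Atomic concepts (atoms) $A,B,\dots$ are taken from a countably infinite supply. A data instance is a finite sequence $\mathcal D=(\delta_0,\dots,\delta_n)$ of finite sets of atoms; it is identified with its extensions $(\delta_0,\dots,\delta_n,\emptyset,\dots,\emptyset)$, so $\delta_\ell=\emptyset$ for $\ell>n$. Its size is $|\mathcal D|=\sum_i|\delta_i|$. **Semantics.** For $\ell\in\mathbb N$: $\mathcal D,\ell\models A$ iff $A\in\delta_\ell$; $\mathcal D,\ell\models\top$ always; conjunction as usual; $\mathcal D,\ell\models\bigcirc q$ iff $\mathcal D,\ell+1\models q$; $\mathcal D,\ell\models\Diamond q$ iff $\mathcal D,m\models q$ for some $m>\ell$; $\mathcal D,\ell\models\Diamond_r q$ iff $\mathcal D,m\models q$ for some $m\ge\ell$. Write $q\models q'$ if $\mathcal D,\ell\models q$ implies $\mathcal D,\ell\models q'$ for all $\mathcal D,\ell$; $q\equiv q'$ if $q\models q'$ and $q'\models q$. $|q|$ is the number of symbols in $q$. **Path queries.** For $\Phi\subseteq\{\bigcirc,\Diamond,\Diamond_r\}$, $\mathcal Q_p[\Phi]$ is the set of queries $\rho_0\wedge o_1(\rho_1\wedge o_2(\rho_2\wedge\dots\wedge o_n\rho_n))$ with $n\ge 0$, $o_i\in\Phi$, and each $\rho_i$ a (possibly empty) conjunction of atoms, identified with a finite set of atoms (the empty conjunction is $\top$). Since $\Diamond q\equiv\bigcirc\Diamond_r q$, every query in $\mathcal Q_p[\bigcirc,\Diamond,\Diamond_r]$ is equivalent to one in $\mathcal Q_p[\bigcirc,\Diamond_r]$.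 **Characterisability.** An example set is a pair $E=(E^+,E^-)$ of finite sets of data instances; $|E|=\sum_{\mathcal D\in E^+\cup E^- }|\mathcal D|$. A query $q$ fits $E$ if $\mathcal D,0\models q$ for all $\mathcal D\in E^+$ and $\mathcal D,0\not\models q$ for all $\mathcal D\in E^-$. $E$ uniquely characterises $q$ within a class $\mathcal Q$ if $q$ fits $E$ and $q\equiv q'$ for every $q'\in\mathcal Q$ fitting $E$; $q$ is uniquely characterisable within $\mathcal Q$ if some $E$ does this. $\mathcal Q$ is polynomially characterisable within $\mathcal Q'\supseteq\mathcal Q$ if there is a polynomial $f$ such that every $q\in\mathcal Q$ is uniquely characterised within $\mathcal Q'$ by some $E$ with $|E|\le f(|q|)$; "polynomially characterisable" without qualification means $\mathcal Q'=\mathcal Q$. $\mathcal Q$ is polynomially characterisable for bounded query size if there is a polynomial $f$ such that for all $n$, every $q\in\mathcal Q^n$ is uniquely characterised within $\mathcal Q^n$ by some $E$ with $|E|\le f(n)$, where $\mathcal Q^n$ is the set of queries in $\mathcal Q$ of size at most $n$. **Normal form, lone conjuncts, safe queries.** A query in $\mathcal Q_p[\bigcirc,\Diamond,\Diamond_r]$ is represented as a sequence $\rho_0(t_0),R_1(t_0,t_1),\rho_1(t_1),\dots,R_n(t_{n-1},t_n),\rho_n(t_n)$ with $R_i\in\{\mathit{suc},<,\le\}$ according to $o_i=\bigcirc,\Diamond,\Diamond_r$. Divide it as $q=q_0\mathcal R_1q_1\dots\mathcal R_nq_n$, where each block $q_i$ is a maximal $\mathit{suc}$-chain $\rho^i_0,\rho^i_1,\dots,\rho^i_{k_i}$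 (consecutive elements related by $\mathit{suc}$, $k_i\ge0$), and each $\mathcal R_i$ is a nonempty sequence of relations from $\{<,\le\}$ leading from the last point of $q_{i-1}$ to the first point of $q_i$, whose intermediate points carry no atoms. A block $q_i$ is primitive if $k_i=0$. A lone conjunct is a primitive block $q_i=\rho^i_0$ with $i>0$ and $|\rho^i_0|\ge2$. The query is in normal form if: (n1) $\rho^i_0\ne\emptyset$ if $i>0$, and $\rho^i_{k_i}\neq\emptyset$ if $i>0$ or $k_i>0$; (n2) each $\mathcal R_i$ is either a single $\le$ or a sequence of $<$; (n3) $\rho^i_{k_i}\not\supseteq\rho^{i+1}_0$ if $q_{i+1}$ is primitive and $\mathcal R_{i+1}$ is $\le$; (n4) $\rho^i_{k_i}\not\subseteq\rho^{i+1}_0$ if $i>0$, $q_i$ is primitive and $\mathcal R_{i+1}$ is $\le$. A query in $\mathcal Q_p[\bigcirc,\Diamond_r]$ is safe if it is equivalent to a query in $\mathcal Q_p[\bigcirc,\Diamond,\Diamond_r]$ in normal form containing no lone conjuncts. -}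

module Defs where

open import Data.Fin using (Fin; zero; suc; toℕ; inject₁)
open import Data.List using (List; []; _∷_; _++_; length; map; deduplicate)
open import Data.List.Membership.Propositional using (_∈_)
open import Data.List.NonEmpty using (List⁺; _∷_; head; tail; last; toList)
open import Data.List.Relation.Binary.Subset.Propositional using (_⊆_)
open import Data.List.Relation.Unary.All using (All)
open import Data.Nat using (ℕ; zero; suc; _+_; _*_; _≤_; _<_; _≟_)
open import Data.Nat.ListAction using (sum)
open import Data.Product using (_×_; _,_; ∃-syntax)
open import Data.Sum using (_⊎_)
open import Data.Unit using (⊤)
open import Data.Vec using (Vec; []; _∷_; lookup)
import Data.Vec as Vec
open import Level using (0ℓ)
open import Relation.Binary.PropositionalEquality using (_≡_; _≢_)
open import Relation.Nullary using (¬_)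
open import Relation.Unary using (Pred)

Atom : Set
Atom = ℕ

-- A finite set of atoms is a list in which order and repetition carry no
-- meaning: it is used only through _∈_, _⊆_, emptiness, and its
-- repetition-free listing `elements`.
Atoms : Set
Atoms = List Atom

elements : Atoms → List Atom
elements = deduplicate _≟_

card : Atoms → ℕ
card ρ = length (elements ρ)

Instance : Set
Instance = List Atoms

-- Positions past the end carry ∅, so that an instance has the same slices as
-- its extensions by empty sets (and [] stands for the instance (∅)).
slice : Instance → ℕ → Atoms
slice []      _       = []
slice (δ ∷ _) zero    = δ
slice (_ ∷ 𝓓) (suc ℓ) = slice 𝓓 ℓ

instanceSize : Instance → ℕ
instanceSize 𝓓 = sum (map card 𝓓)

data Op : Set where
  ○ ◇ ◇ᵣ : Op

infixr 6 _∧_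

data Query : Set where
  top  : Query
  atom : Atom → Query
  _∧_  : Query → Query → Query
  ⟨_⟩_ : Op → Query → Query

infix 4 _at_⊨_

_at_⊨_ : Instance → ℕ → Query → Set
𝓓 at ℓ ⊨ top      = ⊤
𝓓 at ℓ ⊨ atom A   = A ∈ slice 𝓓 ℓ
𝓓 at ℓ ⊨ (q ∧ q′) = (𝓓 at ℓ ⊨ q) × (𝓓 at ℓ ⊨ q′)
𝓓 at ℓ ⊨ ⟨ ○ ⟩ q  = 𝓓 at suc ℓ ⊨ q
𝓓 at ℓ ⊨ ⟨ ◇ ⟩ q  = ∃[ m ] (ℓ < m × 𝓓 at m ⊨ q)
𝓓 at ℓ ⊨ ⟨ ◇ᵣ ⟩ q = ∃[ m ] (ℓ ≤ m × 𝓓 at m ⊨ q)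

-- Parentheses are not counted as symbols.
symbols : Query → ℕ
symbols top       = 1
symbols (atom _)  = 1
symbols (q ∧ q′)  = symbols q + suc (symbols q′)
symbols (⟨ _ ⟩ q) = suc (symbols q)

-- ρ₀ ▸ (o₁ , ρ₁) ∷ … ∷ (oₙ , ρₙ) ∷ [] is ρ₀ ∧ o₁ (ρ₁ ∧ o₂ (… ∧ oₙ ρₙ)).
infix 4.5 _▸_

record PathQuery : Set where
  constructor _▸_
  field
    start : Atoms
    steps : List (Op × Atoms)

open PathQuery public

conj : List Atom → Query
conj []           = top
conj (A ∷ [])     = atom A
conj (A ∷ B ∷ As) = atom A ∧ conj (B ∷ As)

path : Atoms → List (Op × Atoms) → Query
path ρ []               = conj (elements ρ)
path ρ ((o , ρ′) ∷ oρs) = conj (elements ρ) ∧ ⟨ o ⟩ path ρ′ oρs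

query : PathQuery → Query
query (ρ ▸ oρs) = path ρ oρs

∣_∣ : PathQuery → ℕ
∣ q ∣ = symbols (query q)

infix 4 _⊨_ _≃_

_⊨_ : PathQuery → PathQuery → Set
q ⊨ q′ = ∀ 𝓓 ℓ → 𝓓 at ℓ ⊨ query q → 𝓓 at ℓ ⊨ query q′

_≃_ : PathQuery → PathQuery → Set
q ≃ q′ = q ⊨ q′ × q′ ⊨ q

Class : Set₁
Class = Pred PathQuery 0ℓ

𝓠ₚ[_] : Pred Op 0ℓ → Class
𝓠ₚ[ Φ ] q = All (λ (o , _) → Φ o) (steps q)

record ExampleSet : Set where
  field
    positive : List Instance
    negative : List Instance

open ExampleSet public

-- If an instance is listed twice it is counted twice. Only upper bounds on
-- the size of some suitable E are ever claimed, and deleting repetitions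
-- affects neither fitting nor such bounds.
exampleSize : ExampleSet → ℕ
exampleSize E = sum (map instanceSize (positive E ++ negative E))

Fits : ExampleSet → PathQuery → Set
Fits E q = (∀ 𝓓 → 𝓓 ∈ positive E → 𝓓 at 0 ⊨ query q)
         × (∀ 𝓓 → 𝓓 ∈ negative E → ¬ (𝓓 at 0 ⊨ query q))

UniquelyCharacterises : ExampleSet → PathQuery → Class → Set
UniquelyCharacterises E q 𝓠 = Fits E q × (∀ q′ → 𝓠 q′ → Fits E q′ → q ≃ q′)

UniquelyCharacterisable : PathQuery → Class → Set
UniquelyCharacterisable q 𝓠 = ∃[ E ] UniquelyCharacterises E q 𝓠

-- Coefficients, constant term first. Natural-number coefficients suffice for
-- upper bounds: replace each coefficient by an upper bound of its modulus.
Polynomial : Set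
Polynomial = List ℕ

eval : Polynomial → ℕ → ℕ
eval []      x = 0
eval (a ∷ f) x = a + x * eval f x

PolynomiallyCharacterisableWithin : Class → Class → Set
PolynomiallyCharacterisableWithin 𝓠 𝓠′ =
  ∃[ f ] (∀ q → 𝓠 q →
    ∃[ E ] (UniquelyCharacterises E q 𝓠′ × exampleSize E ≤ eval f ∣ q ∣))

PolynomiallyCharacterisable : Class → Set
PolynomiallyCharacterisable 𝓠 = PolynomiallyCharacterisableWithin 𝓠 𝓠

_^≤_ : Class → ℕ → Class
(𝓠 ^≤ n) q = 𝓠 q × ∣ q ∣ ≤ n

PolynomiallyCharacterisableForBoundedSize : Class → Set
PolynomiallyCharacterisableForBoundedSize 𝓠 =
  ∃[ f ] (∀ n q → (𝓠 ^≤ n) q →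
    ∃[ E ] (UniquelyCharacterises E q (𝓠 ^≤ n) × exampleSize E ≤ eval f n))

Block : Set
Block = List⁺ Atoms

data Rel : Set where
  lt le : Rel

relOp : Rel → Op
relOp lt = ◇
relOp le = ◇ᵣ

-- q₀ 𝓡₁ q₁ … 𝓡ₙ qₙ. No 𝓡ᵢ is empty or contains suc, so every block is a
-- maximal suc-chain.
record Division : Set where
  field
    {n}    : ℕ
    blocks : Vec Block (suc n)
    rels   : Vec (List⁺ Rel) n

  -- block i is qᵢ, whereas rel i is 𝓡ᵢ₊₁, leading from
  -- block (inject₁ i) to block (suc i).
  block : Fin (suc n) → Block
  block = lookup blocks

  rel : Fin n → List⁺ Rel
  rel = lookup rels

open Division public

link : Rel → List Rel → Atoms → List (Op × Atoms)
link r []       ρ = (relOp r , ρ) ∷ []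
link r (s ∷ rs) ρ = (relOp r , []) ∷ link s rs ρ

chain : List Atoms → List (Op × Atoms)
chain = map (○ ,_)

continue : ∀ {n} → Vec (List⁺ Rel) n → Vec Block n → List (Op × Atoms)
continue []             []       = []
continue ((r ∷ rs) ∷ 𝓡) (b ∷ bs) =
  link r rs (head b) ++ chain (tail b) ++ continue 𝓡 bs

pathQuery : Division → PathQuery
pathQuery d =
  head q₀ ▸ chain (tail q₀) ++ continue (rels d) (Vec.tail (blocks d))
  where q₀ = Vec.head (blocks d)

lastIndex : Block → ℕ
lastIndex b = length (tail b)

Primitive : Block → Set
Primitive b = lastIndex b ≡ 0

LoneConjunct : (d : Division) → Fin (suc (n d)) → Set
LoneConjunct d i =
  Primitive (block d i) × 0 < toℕ i × 2 ≤ card (head (block d i))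

record NormalForm (d : Division) : Set where
  field
    n1-first : ∀ i → 0 < toℕ i → head (block d i) ≢ []
    n1-last  : ∀ i → 0 < toℕ i ⊎ 0 < lastIndex (block d i) →
               last (block d i) ≢ []
    n2 : ∀ i → rel d i ≡ le ∷ [] ⊎ All (_≡ lt) (toList (rel d i))
    n3 : ∀ i → Primitive (block d (suc i)) → rel d i ≡ le ∷ [] →
         ¬ (head (block d (suc i)) ⊆ last (block d (inject₁ i)))
    n4 : ∀ i → 0 < toℕ i → Primitive (block d (inject₁ i)) →
         rel d i ≡ le ∷ [] →
         ¬ (last (block d (inject₁ i)) ⊆ head (block d (suc i)))

Safe : PathQuery → Set
Safe q =
  ∃[ d ] (NormalForm d × (∀ i → ¬ LoneConjunct d i) × q ≃ pathQuery d)

{-# OPTIONS --safe #-}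
module Submission where

-- Absorbing the points without atoms, a path query becomes a sequence of sets
-- joined by links "exactly k + 1 steps" or "at least k steps", and (n3) and
-- (n4) become conditions on neighbouring sets. Stretch every "at least" link
-- of a normal query to a long gap of empty points, which adds nothing to the
-- size of the instance: no point of the query can then be matched after its
-- intended place, even when some of the sets are shrunk. The positive examples
-- are such stretched instances, and those in which one "at least" link is
-- tight; each negative example weakens one point or shortens one link. A
-- normal query that fits them is matched onto the stretched instance point by
-- point, so it is the given one.
--
-- Only a point ρ between two "at least" links needs care, since a competing
-- query may replace it by a chain of proper subsets such as ρ ∖ A, A, ρ ∖ A, …
-- The negative example for ρ is a sequence of copies of all the ρ ∖ A, and it
-- refutes chains up to its own length. This suffices if ρ is a singleton
-- (safe queries), if the size of the competing query is bounded, or if there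
-- is no reflexive ◇ᵣ. Otherwise no finite set of examples suffices, because a
-- chain longer than a given instance is matched with two consecutive members
-- at the same point, where all of ρ then holds.

-- (n3) and (n4) are used on both sides. For the given query, (n4) keeps a point from drifting past
-- its place and (n3) keeps its successor from falling back onto it, so the negative examples reject
-- it. For a competitor, (n3) forces it to move off a point that it has matched completely, and (n4)
-- makes every further point matched at the same position lack an atom of the one before.
--
-- The obstacle is that a competitor may put several loosely linked points where the given query has
-- one. How such a run can be refuted depends on the links at its two ends: an `exact` link ties its
-- end of the run to a fixed neighbour, whereas a loose link lets that end move away over a gap.
-- Hence the four shapes of negative examples for a point. They settle the sets and bound the
-- `atLeast` links of the competitor from below only; the tight positive examples supply the upper
-- bounds.

open import Defs
open import Data.Empty using (⊥; ⊥-elim)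
open import Data.Fin using (toℕ; inject₁; zero; suc)
open import Data.List using (List; []; _∷_; _++_; length; map; filter; concat; replicate)
import Data.List as List
open import Data.List.Membership.Propositional using (_∈_; _∉_)
open import Data.List.Membership.Propositional.Properties
open import Data.List.NonEmpty using (List⁺; _∷_; head; tail; last; toList)
open import Data.List.Properties
  using (map-++; length-++; length-map; length-filter; length-deduplicate)
open import Data.List.Relation.Unary.All using (All; []; _∷_)
import Data.List.Relation.Unary.All as All
open import Data.List.Relation.Unary.AllPairs using (_∷_)
open import Data.List.Relation.Unary.Any using (here; there)
open import Data.Nat
open import Data.Nat.ListAction using (sum)
open import Data.Nat.ListAction.Properties using (sum-++)
open import Data.Nat.Properties
open import Data.Nat.Tactic.RingSolver using (solve-∀)
open import Data.List.Membership.DecPropositional _≟_ using (_∈?_)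
open import Data.List.Relation.Binary.Subset.DecPropositional _≟_ using (_⊆_; _⊆?_)
open import Data.List.Relation.Unary.Unique.DecPropositional.Properties _≟_ using (deduplicate-!)
open import Data.Product using (_×_; _,_; ∃-syntax; proj₁; proj₂)
open import Data.Sum using (_⊎_; inj₁; inj₂)
open import Data.Unit using (⊤; tt)
open import Data.Vec using (Vec; []; _∷_; lookup)
open import Function using (_∘_; id)
open import Function.Bundles using (_⇔_; mk⇔)
open import Relation.Binary.PropositionalEquality
open import Relation.Nullary using (¬_; yes; no; contradiction; ¬?)
open import Relation.Unary using (｛_｝; _∪_)

-- Queries as sets joined by links

-- `exact k` leads to the point suc k steps later, `atLeast k` to any point at
-- least k steps later. Points without atoms are absorbed into the links.
data Link : Set where
  exact atLeast : ℕ → Link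

Steps : Set
Steps = List (Link × Atoms)

Model : Set
Model = ℕ → Atoms

Reach : Link → ℕ → ℕ → Set
Reach (exact k)   p p′ = p′ ≡ suc k + p
Reach (atLeast k) p p′ = k + p ≤ p′

Sem : Model → ℕ → Steps → Set
Sem f p []            = ⊤
Sem f p ((l , ρ) ∷ s) = ∃[ p′ ] (Reach l p p′ × ρ ⊆ f p′ × Sem f p′ s)

data Kind : Set where
  tight loose : Kind

kind : Link → Kind
kind (exact _)   = tight
kind (atLeast _) = loose

-- The end of a query behaves like an outgoing `atLeast`.
outKind : Steps → Kind
outKind []            = loose
outKind ((l , _) ∷ _) = kind l

-- The first argument is the kind of the incoming link, with `tight` for the
-- start of the query, which (n4) exempts.
Normal : Kind → Atoms → Steps → Set
Normal i ρ []             = ⊤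
Normal i ρ ((l , ρ₁) ∷ s) =
  ρ₁ ≢ []
  × (l ≡ atLeast 0 → outKind s ≡ loose → ¬ (ρ₁ ⊆ ρ))
  × (l ≡ atLeast 0 → i ≡ loose → ¬ (ρ ⊆ ρ₁))
  × Normal (kind l) ρ₁ s

-- The far side of a gap of `b` empty points is `suc b` steps away. An `exact` link so bounded
-- always ends before it, an `atLeast` link can always reach it.
LinkBounded : ℕ → Link → Set
LinkBounded b (exact k)   = k < b
LinkBounded b (atLeast k) = k ≤ b

Bounded : ℕ → Steps → Set
Bounded b = All λ (l , _) → LinkBounded b l

gapLength : ℕ → Link → ℕ
gapLength b (exact k)   = k
gapLength b (atLeast _) = b

-- The sets are bounded only from above and the slice at `w` is left free, so that one notion covers
-- stretched, weakened and padded instances alike.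
Layout : ℕ → Steps → Model → ℕ → Set
Layout b []            f w = ∀ p → w < p → f p ≡ []
Layout b ((l , ρ) ∷ s) f w =
  (∀ p → w < p → p < suc (gapLength b l) + w → f p ≡ [])
  × f (suc (gapLength b l) + w) ⊆ ρ
  × Layout b s f (suc (gapLength b l) + w)

-- A point with set ρ matched after its intended place w has to be
-- accounted for by its incoming link.
data Reached (b : ℕ) (ρ : Atoms) (f : Model) (w p : ℕ) : Kind → Set where
  early   : ∀ {i} → p ≤ w → Reached b ρ f w p i
  loosely : ρ ≢ [] → Reached b ρ f w p loose
  tightly : ∀ k p₀ → k < b → p ≡ suc k + p₀ → f p₀ ≢ [] → ρ ≢ [] → Reached b ρ f w p tight

nonempty-⊆ : ∀ {ρ σ : Atoms} → ρ ⊆ σ → ρ ≢ [] → σ ≢ []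
nonempty-⊆ {[]}    _   ρ≢[] _    = ρ≢[] refl
nonempty-⊆ {_ ∷ _} ρ⊆σ _    refl with () ← ρ⊆σ (here refl)

absent : ∀ {ρ σ : Atoms} → ρ ≢ [] → ρ ⊆ σ → σ ≡ [] → ⊥
absent ρ≢[] ρ⊆σ = nonempty-⊆ ρ⊆σ ρ≢[]

late-nonempty : ∀ {b ρ f w p i} → Reached b ρ f w p i → w < p → ρ ≢ []
late-nonempty (early p≤w) w<p           = contradiction p≤w (<⇒≱ w<p)
late-nonempty (loosely ρ≢[]) _          = ρ≢[]
late-nonempty (tightly _ _ _ _ _ ρ≢[]) _ = ρ≢[]

gap-predecessor : ∀ {b w p k p₀} → k < b → p ≡ suc k + p₀ → p ≡ suc b + w → w < p₀ × p₀ < suc b + w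
gap-predecessor {b} {w} {p} {k} {p₀} k<b refl eq = w<p₀ , p₀<
  where
  p₀< : p₀ < suc b + w
  p₀< = subst (p₀ <_) eq (s≤s (m≤n+m p₀ k))
  w<p₀ : w < p₀
  w<p₀ with w <? p₀
  ... | yes h = h
  ... | no h = contradiction (≤-reflexive (sym eq)) (<⇒≱ (s≤s (+-mono-<-≤ k<b (≮⇒≥ h))))

-- Induction from the end of the query. Before an `atLeast` link, the next point is not late, so a
-- late `ρ` lies either in the gap after `w`, which has no atoms, or exactly at the next place. In
-- the latter case (n4) excludes a loose incoming link, and a tight one would start at a point with
-- atoms inside the gap.
never-later : ∀ {b i ρ f w p} s → Normal i ρ s → Bounded b s → Layout b s f w →
              Reached b ρ f w p i → ρ ⊆ f p → Sem f p s → p ≤ w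
never-later {w = w} {p} [] _ _ lay rch ρ⊆ _ with p ≤? w
... | yes p≤w = p≤w
... | no  p≰w = ⊥-elim (absent (late-nonempty rch (≰⇒> p≰w)) ρ⊆ (lay p (≰⇒> p≰w)))
never-later {b} {ρ = ρ} {f} {w} {p} ((exact k , ρ₁) ∷ s) (ρ₁≢[] , _ , _ , nf) (k<b ∷ bd)
    (_ , _ , lay) rch ρ⊆ (p₁ , refl , ρ₁⊆ , sem)
  = +-cancelˡ-≤ (suc k) p w (never-later s nf bd lay rch₁ ρ₁⊆ sem)
  where
  rch₁ : Reached b ρ₁ f (suc k + w) (suc k + p) tight
  rch₁ with p ≤? w
  ... | yes p≤w = early (+-monoʳ-≤ (suc k) p≤w)
  ... | no  p≰w = tightly k p k<b refl (nonempty-⊆ ρ⊆ (late-nonempty rch (≰⇒> p≰w))) ρ₁≢[]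
never-later {b} {i} {ρ} {f} {w} {p} ((atLeast k , ρ₁) ∷ s) (ρ₁≢[] , _ , n4 , nf) (_ ∷ bd)
    (gap , fw₁⊆ρ₁ , lay) rch ρ⊆ (p₁ , k+p≤p₁ , ρ₁⊆ , sem)
  with p ≤? w
... | yes p≤w = p≤w
... | no  p≰w = ⊥-elim (absurd (m≤n⇒m<n∨m≡n p≤w₁))
  where
  p₁≤w₁ : p₁ ≤ suc b + w
  p₁≤w₁ = never-later s nf bd lay (loosely ρ₁≢[]) ρ₁⊆ sem
  p≤w₁ : p ≤ suc b + w
  p≤w₁ = ≤-trans (≤-trans (m≤n+m p k) k+p≤p₁) p₁≤w₁
  w<p = ≰⇒> p≰w
  ρ≢[] = late-nonempty rch w<p
  absurd : p < suc b + w ⊎ p ≡ suc b + w → ⊥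
  absurd (inj₁ p<w₁) = absent ρ≢[] ρ⊆ (gap p w<p p<w₁)
  absurd (inj₂ p≡w₁) = case-in rch
    where
    k≡0 : k ≡ 0
    k≡0 = n≤0⇒n≡0 (+-cancelʳ-≤ p k 0 (≤-trans k+p≤p₁ (≤-trans p₁≤w₁ (≤-reflexive (sym p≡w₁)))))
    ρ⊆ρ₁ : ρ ⊆ ρ₁
    ρ⊆ρ₁ = fw₁⊆ρ₁ ∘ subst (λ q → _ ∈ f q) p≡w₁ ∘ ρ⊆
    case-in : Reached b ρ f w p i → ⊥
    case-in (early p≤w)  = p≰w p≤w
    case-in (loosely _)  = n4 (cong atLeast k≡0) refl ρ⊆ρ₁
    case-in (tightly k₀ p₀ k₀<b p≡ fp₀≢[] _) with gap-predecessor k₀<b p≡ p≡w₁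
    ... | w<p₀ , p₀<w₁ = fp₀≢[] (gap p₀ w<p₀ p₀<w₁)

-- Translating matches

Offset : ℕ → Model → Model → Set
Offset w f g = ∀ p → f (w + p) ≡ g p

shift : ∀ w k p → w + (k + p) ≡ k + (w + p)
shift w k p = trans (sym (+-assoc w k p)) (trans (cong (_+ p) (+-comm w k)) (+-assoc k w p))

reach-+ : ∀ w l {p p′} → Reach l p p′ → Reach l (w + p) (w + p′)
reach-+ w (exact k)   {p} refl = shift w (suc k) p
reach-+ w (atLeast k) {p} h    = ≤-trans (≤-reflexive (sym (shift w k p))) (+-monoʳ-≤ w h)

reach-≥ : ∀ l {p p′} → Reach l p p′ → p ≤ p′
reach-≥ (exact k)   {p} refl = m≤n+m p (suc k)
reach-≥ (atLeast k) {p} h    = ≤-trans (m≤n+m p k) h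

-- Links never lead backwards, so the two models are compared only from `p` on; earlier slices may
-- be altered freely.
push : ∀ {f g} w s {p} → (∀ r → p ≤ r → f r ⊆ g (w + r)) → Sem f p s → Sem g (w + p) s
push w []            h _                       = tt
push w ((l , ρ) ∷ s) h (p′ , rch , ρ⊆ , sem) =
  w + p′ , reach-+ w l rch , (h p′ (reach-≥ l rch) ∘ ρ⊆)
  , push w s (λ r p′≤r → h r (≤-trans (reach-≥ l rch) p′≤r)) sem

reach-∸ : ∀ w l {p p′} → Reach l (w + p) p′ → ∃[ q ] (p′ ≡ w + q × Reach l p q)
reach-∸ w l {p} {p′} rch = p′ ∸ w , sym eq , go l rch
  where
  eq : w + (p′ ∸ w) ≡ p′
  eq = m+[n∸m]≡n (≤-trans (m≤m+n w p) (reach-≥ l rch))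
  go : ∀ l → Reach l (w + p) p′ → Reach l p (p′ ∸ w)
  go (exact k) h = +-cancelˡ-≡ w _ _ (trans eq (trans h (sym (shift w (suc k) p))))
  go (atLeast k) h = +-cancelˡ-≤ w _ _
      (≤-trans (≤-reflexive (shift w k p)) (≤-trans h (≤-reflexive (sym eq))))

pull : ∀ {f g} w s {p} → (∀ r → p ≤ r → g (w + r) ⊆ f r) → Sem g (w + p) s → Sem f p s
pull w []            h _ = tt
pull w ((l , ρ) ∷ s) h (p′ , rch , ρ⊆ , sem) with reach-∸ w l rch
... | q , refl , rch′ = q , rch′ , (h q (reach-≥ l rch′) ∘ ρ⊆)
    , pull w s (λ r q≤r → h r (≤-trans (reach-≥ l rch′) q≤r)) sem

≡⇒⊆ : {ρ σ : Atoms} → ρ ≡ σ → ρ ⊆ σ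
≡⇒⊆ refl = id

layout-+ : ∀ {b f g w} s {v} → Offset w f g → Layout b s g v → Layout b s f (w + v)
layout-+ {f = f} {g} {w} [] {v} off lay p h = trans (cong f (sym eq)) (trans (off _) (lay _ v<))
  where
  eq : w + (p ∸ w) ≡ p
  eq = m+[n∸m]≡n (≤-trans (m≤m+n w v) (<⇒≤ h))
  v< : v < p ∸ w
  v< = +-cancelˡ-< w _ _ (subst (w + v <_) (sym eq) h)
layout-+ {b} {f} {g} {w} ((l , ρ) ∷ s) {v} off (gap , ⊆ρ , lay) =
    gap′ , (⊆ρ ∘ ≡⇒⊆ (trans (cong f eq₁) (off _)))
        , subst (Layout b s f) (sym eq₁) (layout-+ s off lay)
  where
  L = gapLength b l
  eq₁ : suc L + (w + v) ≡ w + (suc L + v)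
  eq₁ = shift (suc L) w v
  gap′ : ∀ p → w + v < p → p < suc L + (w + v) → f p ≡ []
  gap′ p lo hi = trans (cong f (sym eq))
      (trans (off _) (gap (p ∸ w) (+-cancelˡ-< w _ _ (subst (w + v <_) (sym eq) lo))
          (+-cancelˡ-< w _ _ (subst₂ _<_ (sym eq) eq₁ hi))))
    where
    eq : w + (p ∸ w) ≡ p
    eq = m+[n∸m]≡n (≤-trans (m≤m+n w v) (<⇒≤ lo))

-- (n3) and the length of the gaps keep the point after the gap from moving
-- back to the point before it.
step-forward : ∀ {b i ρ f g l ρ₁ p} s →
  Normal i ρ ((l , ρ₁) ∷ s) → Bounded b ((l , ρ₁) ∷ s) →
  (∀ p → 0 < p → p < suc (gapLength b l) → f p ≡ []) →
  f 0 ⊆ ρ → Offset (suc (gapLength b l)) f g →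
  Reached b ρ f 0 p i → ρ ⊆ f p → Sem f p ((l , ρ₁) ∷ s) →
  ∃[ p′ ] (Reached b ρ₁ g 0 p′ (kind l) × ρ₁ ⊆ g p′ × Sem g p′ s)
step-forward {b} {ρ = ρ} {f} {g} {exact k} {ρ₁} {p} s (ρ₁≢[] , _) (k<b ∷ _) gap f0⊆ off rch ρ⊆
    (_ , refl , ρ₁⊆ , sem)
  = p , rch₁ p refl , (≡⇒⊆ (off p) ∘ ρ₁⊆) , pull (suc k) s (λ r _ → ≡⇒⊆ (off r)) sem
  where
  rch₁ : ∀ q → q ≡ p → Reached b ρ₁ g 0 q tight
  rch₁ zero    _    = early z≤n
  rch₁ (suc q) refl with p <? suc k
  ... | yes h = ⊥-elim (absent (late-nonempty rch (s≤s z≤n)) ρ⊆ (gap p (s≤s z≤n) h))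
  ... | no h  = tightly k (p ∸ suc k) k<b (sym eq)
      (λ e → nonempty-⊆ ρ⊆ (late-nonempty rch (s≤s z≤n))
          (trans (cong f (sym eq)) (trans (off _) e))) ρ₁≢[]
    where
    eq : suc k + (p ∸ suc k) ≡ p
    eq = m+[n∸m]≡n (≮⇒≥ h)
step-forward {b} {ρ = ρ} {f} {g} {atLeast k} {ρ₁} {p} s (ρ₁≢[] , n3 , _ , nf) (_ ∷ bd) gap f0⊆ off
    rch ρ⊆ (p₁ , k+p≤ , ρ₁⊆ , sem)
  with p₁ <? suc b
... | no h = p₁ ∸ suc b , loosely ρ₁≢[] , (≡⇒⊆ (trans (cong f (sym eq)) (off _)) ∘ ρ₁⊆)
    , pull (suc b) s (λ r _ → ≡⇒⊆ (off r)) (subst (λ q → Sem f q s) (sym eq) sem)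
  where
  eq : suc b + (p₁ ∸ suc b) ≡ p₁
  eq = m+[n∸m]≡n (≮⇒≥ h)
... | yes h = ⊥-elim (absurd p₁ refl)
  where
  absurd : ∀ q → q ≡ p₁ → ⊥
  absurd (suc q) refl = absent ρ₁≢[] ρ₁⊆ (gap p₁ (s≤s z≤n) h)
  -- At position 0 a loose continuation violates (n3), and an `exact` one ends in the gap.
  absurd zero    refl = dead s n3 nf bd sem
    where
    k≡0 : k ≡ 0
    k≡0 = n≤0⇒n≡0 (≤-trans (m≤m+n k p) k+p≤)
    dead : ∀ s → (atLeast k ≡ atLeast 0 → outKind s ≡ loose → ¬ (ρ₁ ⊆ ρ)) → Normal loose ρ₁ s →
        Bounded b s → Sem f 0 s → ⊥
    dead [] n3 _ _ _ = n3 (cong atLeast k≡0) refl (f0⊆ ∘ ρ₁⊆)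
    dead ((atLeast _ , _) ∷ _) n3 _ _ _ = n3 (cong atLeast k≡0) refl (f0⊆ ∘ ρ₁⊆)
    dead ((exact j , ρ₂) ∷ _) _ (ρ₂≢[] , _) (j<b ∷ _) (p₂ , refl , ρ₂⊆ , _) =
      absent ρ₂≢[] ρ₂⊆ (gap p₂ (s≤s z≤n) (s≤s (subst (_< b) (sym (+-identityʳ j)) j<b)))

-- Examples

gap : ℕ → Instance → Instance
gap zero    𝓓 = 𝓓
gap (suc k) 𝓓 = [] ∷ gap k 𝓓

rest : ℕ → Steps → Instance
rest b []            = []
rest b ((l , ρ) ∷ s) = gap (gapLength b l) (ρ ∷ rest b s)

infixl 6 _∖_

_∖_ : Atoms → Atom → Atoms
ρ ∖ A = filter (λ B → ¬? (B ≟ A)) ρ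

copies : ℕ → List Atoms → List Atoms
copies N τs = concat (replicate N τs)

pad : ℕ → List Atoms → Instance → Instance
pad b []       𝓓 = 𝓓
pad b (τ ∷ τs) 𝓓 = τ ∷ gap b (pad b τs 𝓓)

-- At distance 0 the two points coincide.
at-distance : ℕ → Atoms → Atoms → Instance → Instance
at-distance zero    ρ ρ₁ 𝓓 = (ρ ++ ρ₁) ∷ 𝓓
at-distance (suc k) ρ ρ₁ 𝓓 = ρ ∷ gap k (ρ₁ ∷ 𝓓)

-- If just one side is loose, a full copy of `ρ` is added on that side across a gap: it takes the
-- points of a competitor's run that are not tied to the weakened copy. With two tight sides, the
-- two full copies refute any run that is not a single point. With two loose sides, the `[]` before
-- `R` occupies the place of `ρ` itself, so that later points keep their distance.
weakened : ℕ → ℕ → Kind → Kind → Atoms → Instance → List Instance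
weakened b N tight tight ρ R = (ρ ∷ gap b (ρ ∷ R)) ∷ map (λ A → (ρ ∖ A) ∷ R) ρ
weakened b N tight loose ρ R = map (λ A → (ρ ∖ A) ∷ gap b (ρ ∷ R)) ρ
weakened b N loose tight ρ R = map (λ A → ρ ∷ gap b ((ρ ∖ A) ∷ R)) ρ
weakened b N loose loose ρ R = pad b (copies N (map (ρ ∖_) ρ)) ([] ∷ R) ∷ []

shortened : ℕ → Link → Atoms → Atoms → Steps → List Instance
shortened b (atLeast (suc k)) ρ ρ₁ s = at-distance k ρ ρ₁ (rest b s) ∷ []
shortened b (atLeast zero)    ρ ρ₁ s = []
shortened b (exact _)         ρ ρ₁ s = []

negatives : ℕ → ℕ → Kind → Atoms → Steps → List Instance
negatives b N i ρ []             = weakened b N i loose ρ []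
negatives b N i ρ ((l , ρ₁) ∷ s) =
  weakened b N i (kind l) ρ (gap (gapLength b l) (ρ₁ ∷ rest b s))
  ++ shortened b l ρ ρ₁ s
  ++ map (λ 𝓓 → ρ ∷ gap (gapLength b l) 𝓓) (negatives b N (kind l) ρ₁ s)

tightest : ℕ → Link → Atoms → Atoms → Steps → List Instance
tightest b (atLeast k) ρ ρ₁ s = at-distance k ρ ρ₁ (rest b s) ∷ []
tightest b (exact _)   ρ ρ₁ s = []

tights : ℕ → Atoms → Steps → List Instance
tights b ρ []             = []
tights b ρ ((l , ρ₁) ∷ s) =
  tightest b l ρ ρ₁ s ++ map (λ 𝓓 → ρ ∷ gap (gapLength b l) 𝓓) (tights b ρ₁ s)

-- The given query fits its examples

Sat : Instance → ℕ → Atoms → Steps → Set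
Sat 𝓓 p ρ s = ρ ⊆ slice 𝓓 p × Sem (slice 𝓓) p s

slice-gap : ∀ k {𝓓} p → slice (gap k 𝓓) (k + p) ≡ slice 𝓓 p
slice-gap zero    p = refl
slice-gap (suc k) p = slice-gap k p

slice-gap-< : ∀ k {𝓓 p} → p < k → slice (gap k 𝓓) p ≡ []
slice-gap-< (suc k) {p = zero}  _       = refl
slice-gap-< (suc k) {p = suc p} (s≤s h) = slice-gap-< k h

slice-gap-in : ∀ k τ {𝓓 p} → 0 < p → p < suc k → slice (τ ∷ gap k 𝓓) p ≡ []
slice-gap-in k τ {p = suc p} _ (s≤s h) = slice-gap-< k h

layout-rest : ∀ b s τ → Layout b s (slice (τ ∷ rest b s)) 0
layout-rest b [] τ (suc p) _ = refl
layout-rest b ((l , ρ) ∷ s) τ =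
  (λ p lo hi → slice-gap-in L τ lo (subst (p <_) (+-identityʳ (suc L)) hi))
  , ≡⇒⊆ (slice-gap L 0)
  , layout-+ s {v = 0} (slice-gap L) (layout-rest b s ρ)
  where L = gapLength b l

∖-∌ : ∀ ρ {A} → A ∉ ρ ∖ A
∖-∌ ρ {A} A∈ = proj₂ (∈-filter⁻ (λ B → ¬? (B ≟ A)) {xs = ρ} A∈) refl

∖-⊆ : ∀ {ρ A} → ρ ∖ A ⊆ ρ
∖-⊆ {ρ} {A} = proj₁ ∘ ∈-filter⁻ (λ B → ¬? (B ≟ A)) {xs = ρ}

⊆-∖ : ∀ {ρ σ A} → σ ⊆ ρ → A ∉ σ → σ ⊆ ρ ∖ A
⊆-∖ {A = A} σ⊆ρ A∉σ B∈σ = ∈-filter⁺ (λ B → ¬? (B ≟ A)) (σ⊆ρ B∈σ) λ { refl → A∉σ B∈σ }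

⊈⇒∉ : ∀ {ρ σ : Atoms} → ¬ (ρ ⊆ σ) → ∃[ A ] (A ∈ ρ × A ∉ σ)
⊈⇒∉ {[]}    ρ⊈σ = contradiction (λ ()) ρ⊈σ
⊈⇒∉ {A ∷ ρ} {σ} ρ⊈σ with A ∈? σ
... | no A∉σ  = A , here refl , A∉σ
... | yes A∈σ with ⊈⇒∉ {ρ} {σ} (λ ρ⊆σ → ρ⊈σ λ { (here refl) → A∈σ ; (there B∈) → ρ⊆σ B∈ })
...   | B , B∈ρ , B∉σ = B , there B∈ρ , B∉σ

offset-gap : ∀ k {τ 𝓓} → Offset (suc k) (slice (τ ∷ gap k 𝓓)) (slice 𝓓)
offset-gap k = slice-gap k

pred-in-gap : ∀ {b τ X p} {ρ : Atoms} → p ≡ suc b → Reached b ρ (slice (τ ∷ gap b X)) 0 p tight → ⊥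
pred-in-gap refl (early ())
pred-in-gap {b} {τ} refl (tightly k p₀ k<b p≡ ne _)
    with gap-predecessor k<b p≡ (sym (+-identityʳ (suc b)))
... | lo , hi = ne (slice-gap-in b τ lo (subst (p₀ <_) (+-identityʳ (suc b)) hi))

later : ∀ {b ρ f p i w} → Reached b ρ f 0 p i → Reached b ρ f w p i
later (early p≤0)              = early (≤-trans p≤0 z≤n)
later (loosely ρ≢[])           = loosely ρ≢[]
later (tightly k p₀ k<b e n m) = tightly k p₀ k<b e n m

slice-gap′ : ∀ k {𝓓} → slice (gap k 𝓓) k ≡ slice 𝓓 0
slice-gap′ k {𝓓} = trans (cong (slice (gap k 𝓓)) (sym (+-identityʳ k))) (slice-gap k 0)

padLength : ℕ → List Atoms → ℕ
padLength b []       = 0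
padLength b (_ ∷ τs) = suc b + padLength b τs

offset-pad : ∀ {b 𝓓} τs → Offset (padLength b τs) (slice (pad b τs 𝓓)) (slice 𝓓)
offset-pad             []       p = refl
offset-pad {b} {𝓓} (τ ∷ τs) p =
  trans (cong (slice (gap b (pad b τs 𝓓))) (+-assoc b (padLength b τs) p))
  (trans (slice-gap b _) (offset-pad τs p))

slice-pad : ∀ {b 𝓓} τs {p} → p < padLength b τs →
            slice (pad b τs 𝓓) p ≡ [] ⊎ slice (pad b τs 𝓓) p ∈ τs
slice-pad (τ ∷ τs) {zero}  _ = inj₂ (here refl)
slice-pad {b} {𝓓} (τ ∷ τs) {suc p} (s≤s h) with p <? b
... | yes p<b = inj₁ (slice-gap-< b p<b)
... | no  p≮b rewrite sym (m+[n∸m]≡n (≮⇒≥ p≮b)) | slice-gap b {pad b τs 𝓓} (p ∸ b)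
  with slice-pad {b} {𝓓} τs (+-cancelˡ-< b _ _ h)
...   | inj₁ e = inj₁ e
...   | inj₂ e = inj₂ (there e)

∈-copies : ∀ N {τs : List Atoms} {τ} → τ ∈ copies N τs → τ ∈ τs
∈-copies (suc N) {τs} τ∈ with ∈-++⁻ τs τ∈
... | inj₁ h = h
... | inj₂ h = ∈-copies N h

module _ {b : ℕ} {ρ : Atoms} {s : Steps} (bd : Bounded b s) where

  layout-gap : ∀ τ τ′ → Layout b s (slice (τ ∷ gap b (τ′ ∷ rest b s))) (suc b)
  layout-gap τ τ′ = subst (Layout b s _) (+-identityʳ (suc b))
      (layout-+ s (offset-gap b {τ}) (layout-rest b s τ′))


  two-copies : ∀ {i τ τ′ p} → Normal i ρ s →
    Reached b ρ (slice (τ ∷ gap b (τ′ ∷ rest b s))) 0 p i →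
    Sat (τ ∷ gap b (τ′ ∷ rest b s)) p ρ s → p ≡ 0 ⊎ p ≡ suc b
  two-copies {τ = τ} {τ′} {p} nf rch (ρ⊆ , sem)
    with never-later s nf bd (layout-gap τ τ′) (later rch) ρ⊆ sem
  ... | p≤ with m≤n⇒m<n∨m≡n p≤
  ...   | inj₂ p≡ = inj₂ p≡
  ...   | inj₁ p< = inj₁ (go p refl)
    where
    go : ∀ q → q ≡ p → p ≡ 0
    go zero    refl = refl
    go (suc q) refl = ⊥-elim
        (absent (late-nonempty rch (s≤s z≤n)) ρ⊆ (slice-gap-in b τ (s≤s z≤n) p<))

  exact-dead : ∀ {i τ X} → Normal i ρ s → outKind s ≡ tight → ¬ Sem (slice (τ ∷ gap b X)) 0 s
  exact-dead {τ = τ} = go s bd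
    where
    go : ∀ {i} {X} s → Bounded b s → Normal i ρ s → outKind s ≡ tight →
        ¬ Sem (slice (τ ∷ gap b X)) 0 s
    go ((exact k , ρ₁) ∷ s) (k<b ∷ _) (ρ₁≢[] , _) _ (_ , refl , ρ₁⊆ , _) =
      absent ρ₁≢[] ρ₁⊆ (slice-gap-in b τ (s≤s z≤n) (s≤s (subst (_< b) (sym (+-identityʳ k)) k<b)))

  -- The intended place of `ρ` is empty here and `never-later` excludes every later one, so only the
  -- inserted points remain.
  pad-⊭ : ∀ τs {p} → Normal loose ρ s → ρ ≢ [] →
    Reached b ρ (slice (pad b τs ([] ∷ rest b s))) 0 p loose →
    Sat (pad b τs ([] ∷ rest b s)) p ρ s → ∃[ τ ] (τ ∈ τs × ρ ⊆ τ)
  pad-⊭ τs {p} nf ρ≢[] rch (ρ⊆ , sem) with m≤n⇒m<n∨m≡n (never-later s nf bd lay (later rch) ρ⊆ sem)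
    where
    lay : Layout b s (slice (pad b τs ([] ∷ rest b s))) (padLength b τs)
    lay = subst (Layout b s _) (+-identityʳ _) (layout-+ s (offset-pad τs) (layout-rest b s []))
  ... | inj₂ refl = ⊥-elim
      (absent ρ≢[] ρ⊆ (trans (cong (slice (pad b τs ([] ∷ rest b s))) (sym (+-identityʳ _)))
          (offset-pad τs 0)))
  ... | inj₁ p< with slice-pad {b} {[] ∷ rest b s} τs p<
  ...   | inj₁ e  = ⊥-elim (absent ρ≢[] ρ⊆ e)
  ...   | inj₂ τ∈ = slice (pad b τs ([] ∷ rest b s)) p , τ∈ , ρ⊆

  -- Every place left for `ρ` fails: either an atom is missing there, or an `exact` link of `ρ` at
  -- that place would have its other end in a gap.
  weakened-⊭ : ∀ N i {p 𝓓} → Normal i ρ s → (i ≡ loose → ρ ≢ []) →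
      𝓓 ∈ weakened b N i (outKind s) ρ (rest b s) →
             Reached b ρ (slice 𝓓) 0 p i → ¬ Sat 𝓓 p ρ s
  weakened-⊭ N i nf _ 𝓓∈ rch sat with outKind s in out
  weakened-⊭ N tight nf _ (here refl) rch sat | tight with two-copies nf rch sat
  ... | inj₁ refl = exact-dead nf out (proj₂ sat)
  ... | inj₂ p≡   = pred-in-gap p≡ rch
  weakened-⊭ N tight nf _ (there 𝓓∈) rch sat | tight with ∈-map⁻ (λ A → (ρ ∖ A) ∷ rest b s) 𝓓∈
  ... | A , A∈ρ , refl with n≤0⇒n≡0
      (never-later s nf bd (layout-rest b s (ρ ∖ A)) rch (proj₁ sat) (proj₂ sat))
  ...   | refl = ∖-∌ ρ (proj₁ sat A∈ρ)
  weakened-⊭ N tight nf _ 𝓓∈ rch sat | loose with ∈-map⁻ (λ A → (ρ ∖ A) ∷ gap b (ρ ∷ rest b s)) 𝓓∈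
  ... | A , A∈ρ , refl with two-copies nf rch sat
  ...   | inj₁ refl = ∖-∌ ρ (proj₁ sat A∈ρ)
  ...   | inj₂ p≡   = pred-in-gap p≡ rch
  weakened-⊭ N loose nf _ 𝓓∈ rch sat | tight with ∈-map⁻ (λ A → ρ ∷ gap b ((ρ ∖ A) ∷ rest b s)) 𝓓∈
  ... | A , A∈ρ , refl with two-copies nf rch sat
  ...   | inj₁ refl = exact-dead nf out (proj₂ sat)
  ...   | inj₂ refl = ∖-∌ ρ (≡⇒⊆ (slice-gap′ b) (proj₁ sat A∈ρ))
  weakened-⊭ N loose {p} nf ρ≢[] (here refl) rch sat | loose
      with pad-⊭ (copies N (map (ρ ∖_) ρ)) nf (ρ≢[] refl) rch sat
  ... | τ , τ∈ , ρ⊆τ with ∈-map⁻ (ρ ∖_) (∈-copies N τ∈)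
  ...   | A , A∈ρ , refl = ∖-∌ ρ (ρ⊆τ A∈ρ)

shortened-⊭ : ∀ {b i ρ′ j k ρ₁′} s′ {f p} →
  Normal i ρ′ ((atLeast k , ρ₁′) ∷ s′) → Bounded b s′ → Layout b s′ f j → j < k →
  ¬ Sem f p ((atLeast k , ρ₁′) ∷ s′)
shortened-⊭ {k = k} s′ {p = p} (ρ₁≢[] , _ , _ , nf) bd lay j<k (p₁ , k+p≤p₁ , ρ₁⊆ , sem) =
  <⇒≱ j<k (≤-trans (m≤m+n k p) (≤-trans k+p≤p₁ (never-later s′ nf bd lay (loosely ρ₁≢[]) ρ₁⊆ sem)))

layout-at-distance : ∀ b k ρ ρ₁ s → Layout b s (slice (at-distance k ρ ρ₁ (rest b s))) k
layout-at-distance b zero    ρ ρ₁ s = layout-rest b s (ρ ++ ρ₁)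
layout-at-distance b (suc k) ρ ρ₁ s =
  subst (Layout b s _) (+-identityʳ (suc k)) (layout-+ s (offset-gap k {ρ}) (layout-rest b s ρ₁))

negatives-⊭ : ∀ {b} N i {ρ} s {p 𝓓} → Normal i ρ s → Bounded b s → (i ≡ loose → ρ ≢ []) →
  𝓓 ∈ negatives b N i ρ s → Reached b ρ (slice 𝓓) 0 p i → ¬ Sat 𝓓 p ρ s
negatives-⊭ N i [] nf bd ρ≢[] 𝓓∈ rch sat = weakened-⊭ bd N i nf ρ≢[] 𝓓∈ rch sat
negatives-⊭ {b} N i {ρ} ((l , ρ₁) ∷ s) nf bd ρ≢[] 𝓓∈ rch sat
  with ∈-++⁻ (weakened b N i (kind l) ρ (gap (gapLength b l) (ρ₁ ∷ rest b s))) 𝓓∈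
... | inj₁ 𝓓∈ = weakened-⊭ bd N i nf ρ≢[] 𝓓∈ rch sat
... | inj₂ 𝓓∈ with ∈-++⁻ (shortened b l ρ ρ₁ s) 𝓓∈
negatives-⊭ {b} N i {ρ} ((atLeast (suc k) , ρ₁) ∷ s) nf (_ ∷ bd) ρ≢[] _ rch sat | inj₂ _ | inj₁
    (here refl) =
  shortened-⊭ s nf bd (layout-at-distance b k ρ ρ₁ s) ≤-refl (proj₂ sat)
... | inj₂ 𝓓∈ with ∈-map⁻ (λ 𝓓 → ρ ∷ gap (gapLength b l) 𝓓) 𝓓∈
...   | 𝓓₁ , 𝓓₁∈ , refl
  with step-forward s nf bd (λ p lo hi → slice-gap-in (gapLength b l) ρ lo hi) id
      (offset-gap (gapLength b l) {ρ}) rch (proj₁ sat) (proj₂ sat)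
...     | p′ , rch′ , sat′ = negatives-⊭ N (kind l) s (proj₂ (proj₂ (proj₂ nf))) (All.tail bd)
    (λ _ → proj₁ nf) 𝓓₁∈ rch′ sat′

embed : ∀ k τ {𝓓} s {p} → Sem (slice 𝓓) p s → Sem (slice (τ ∷ gap k 𝓓)) (suc k + p) s
embed k τ s = push (suc k) s (λ r _ → ≡⇒⊆ (sym (offset-gap k {τ} r)))

gap-reach : ∀ {b} l {ρ s} → Bounded b ((l , ρ) ∷ s) → Reach l 0 (suc (gapLength b l) + 0)
gap-reach (exact k)   _         = refl
gap-reach (atLeast k) (k≤b ∷ _) = +-monoˡ-≤ 0 (m≤n⇒m≤1+n k≤b)

sat-layout : ∀ {b ρ} s → Bounded b s → Sem (slice (ρ ∷ rest b s)) 0 s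
sat-layout [] _ = tt
sat-layout {b} {ρ} ((l , ρ₁) ∷ s) (h ∷ bd) =
  suc L + 0 , gap-reach l {ρ₁} (h ∷ bd) , ≡⇒⊆ (sym (offset-gap L {ρ} 0))
      , embed L ρ s (sat-layout s bd)
  where L = gapLength b l

at-distance-⊇ : ∀ k {ρ ρ₁ 𝓓} r → slice (ρ₁ ∷ 𝓓) r ⊆ slice (at-distance k ρ ρ₁ 𝓓) (k + r)
at-distance-⊇ zero {ρ} zero    = ∈-++⁺ʳ ρ
at-distance-⊇ zero     (suc r) = id
at-distance-⊇ (suc k) {ρ} r   = ≡⇒⊆ (sym (offset-gap k {ρ} r))

at-distance-0 : ∀ k {ρ ρ₁ 𝓓} → ρ ⊆ slice (at-distance k ρ ρ₁ 𝓓) 0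
at-distance-0 zero    = ∈-++⁺ˡ
at-distance-0 (suc k) = id

sat-tights : ∀ {b ρ 𝓓} s → Bounded b s → 𝓓 ∈ tights b ρ s → Sat 𝓓 0 ρ s
sat-tights {b} {ρ} ((l , ρ₁) ∷ s) bd 𝓓∈ with ∈-++⁻ (tightest b l ρ ρ₁ s) 𝓓∈
sat-tights {b} {ρ} ((atLeast k , ρ₁) ∷ s) (_ ∷ bd) _ | inj₁ (here refl) =
  at-distance-0 k , k + 0 , ≤-refl , at-distance-⊇ k {ρ} 0
      , push k s (λ r _ → at-distance-⊇ k {ρ} r) (sat-layout s bd)
sat-tights {b} {ρ} ((l , ρ₁) ∷ s) (h ∷ bd) _ | inj₂ 𝓓∈
    with ∈-map⁻ (λ 𝓓 → ρ ∷ gap (gapLength b l) 𝓓) 𝓓∈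
... | 𝓓₁ , 𝓓₁∈ , refl with sat-tights s bd 𝓓₁∈
...   | ρ₁⊆ , sem = id , suc L + 0 , gap-reach l {ρ₁} (h ∷ bd)
    , (≡⇒⊆ (sym (offset-gap L {ρ} 0)) ∘ ρ₁⊆) , embed L ρ s sem
  where L = gapLength b l

-- Comparing queries link by link

infix 4 _≼_

-- One-sided in the `atLeast` links, because negative examples bound those of a competitor only from
-- below. The converse is obtained separately in `tights-≽`.
data _≼_ : Steps → Steps → Set where
  []      : [] ≼ []
  exact   : ∀ {k ρ ρ′ s s′} → ρ ⊆ ρ′ → ρ′ ⊆ ρ → s ≼ s′ →
            (exact k , ρ) ∷ s ≼ (exact k , ρ′) ∷ s′
  atLeast : ∀ {k k′ ρ ρ′ s s′} → k ≤ k′ → ρ ⊆ ρ′ → ρ′ ⊆ ρ → s ≼ s′ →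
            (atLeast k , ρ) ∷ s ≼ (atLeast k′ , ρ′) ∷ s′

≼-sem : ∀ {f s s′ p} → s ≼ s′ → Sem f p s′ → Sem f p s
≼-sem [] _ = tt
≼-sem (exact ρ⊆ _ h) (p′ , rch , ⊆f , sem) = p′ , rch , (⊆f ∘ ρ⊆) , ≼-sem h sem
≼-sem {p = p} (atLeast k≤k′ ρ⊆ _ h) (p′ , rch , ⊆f , sem) =
  p′ , ≤-trans (+-monoˡ-≤ p k≤k′) rch , (⊆f ∘ ρ⊆) , ≼-sem h sem

layout-≼ : ∀ {b s s′ f w} → s ≼ s′ → Layout b s f w → Layout b s′ f w
layout-≼ [] lay = lay
layout-≼ (exact ρ⊆ _ h) (g , ⊆ρ , lay)     = g , (ρ⊆ ∘ ⊆ρ) , layout-≼ h lay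
layout-≼ (atLeast _ ρ⊆ _ h) (g , ⊆ρ , lay) = g , (ρ⊆ ∘ ⊆ρ) , layout-≼ h lay

-- An instance that realises an `atLeast k` link by `k` steps leaves no room for a longer one:
-- `step-forward` places the points before that link, `never-later` those after it.
tights-≽ : ∀ {b i ρ ρ′ s s′} → s ≼ s′ → ρ ⊆ ρ′ → Normal i ρ′ s′ → Bounded b s′ →
  (∀ 𝓓 → 𝓓 ∈ tights b ρ s → ∃[ p ] (Reached b ρ′ (slice 𝓓) 0 p i × Sat 𝓓 p ρ′ s′)) → s′ ≼ s
tights-≽ [] _ _ _ _ = []
tights-≽ {b} {ρ = ρ} (exact {k} {s′ = s′} ρ₁⊆ ρ₁⊇ h) ρ⊆ nf bd@(_ ∷ bd₁) sat =
  exact ρ₁⊇ ρ₁⊆ (tights-≽ h ρ₁⊆ (proj₂ (proj₂ (proj₂ nf))) bd₁ λ 𝓓 𝓓∈ →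
    let p , rch , ⊆f , sem = sat _ (∈-map⁺ (λ 𝓓 → ρ ∷ gap k 𝓓) 𝓓∈)
    in step-forward s′ nf bd (λ p lo hi → slice-gap-in k ρ lo hi) ρ⊆ (offset-gap k {ρ}) rch ⊆f sem)
tights-≽ {b} {ρ = ρ} (atLeast {k} {k′} {ρ₁} {s = s} {s′ = s′} k≤k′ ρ₁⊆ ρ₁⊇ h) ρ⊆ nf bd@(_ ∷ bd₁)
    sat =
  atLeast k′≤k ρ₁⊇ ρ₁⊆ (tights-≽ h ρ₁⊆ (proj₂ (proj₂ (proj₂ nf))) bd₁ λ 𝓓 𝓓∈ →
    let p , rch , ⊆f , sem = sat _ (there (∈-map⁺ (λ 𝓓 → ρ ∷ gap b 𝓓) 𝓓∈))
    in step-forward s′ nf bd (λ p lo hi → slice-gap-in b ρ lo hi) ρ⊆ (offset-gap b {ρ}) rch ⊆f sem)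
  where
  k′≤k : k′ ≤ k
  k′≤k with k′ ≤? k
  ... | yes h = h
  ... | no k′≰k = ⊥-elim
      (shortened-⊭ s′ nf bd₁ (layout-≼ h (layout-at-distance b k ρ ρ₁ s)) (≰⇒> k′≰k)
                    (proj₂ (proj₂ (proj₂ (sat _ (here refl))))))

-- Recovering a query from its examples

Singleton : Atoms → Set
Singleton ρ = ∀ {A B} → A ∈ ρ → B ∈ ρ → A ≡ B

NoLone : Kind → Atoms → Steps → Set
NoLone i ρ []             = i ≡ loose → Singleton ρ
NoLone i ρ ((l , ρ₁) ∷ s) = (i ≡ loose → kind l ≡ loose → Singleton ρ) × NoLone (kind l) ρ₁ s

isolated-singleton : ∀ s {ρ} → NoLone loose ρ s → outKind s ≡ loose → Singleton ρ
isolated-singleton []      single       _   = single refl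
isolated-singleton (_ ∷ _) (single , _) out = single refl out

Strict : Steps → Set
Strict = All λ (l , _) → l ≢ atLeast 0

-- Conditions under which the padding with N copies, used to refute a change
-- of an isolated point, is long enough.
Adequate : ℕ → Kind → Atoms → Steps → Steps → Set
Adequate N i ρ s s′ = NoLone i ρ s ⊎ length s′ < N ⊎ Strict s′

-- `⊥` for an `exact` link, since from a point before a long gap it would end in the gap.
Advances : ∀ {f} s → Sem f 0 s → Set
Advances []                    _            = ⊤
Advances ((exact _   , _) ∷ _) _            = ⊥
Advances ((atLeast _ , _) ∷ _) (p₁ , _)     = 0 < p₁

swap : ∀ {τ τ′ R} r → 0 < r → slice (τ ∷ R) r ⊆ slice (τ′ ∷ R) r
swap (suc r) _ = id

offset-copy : ∀ b {ρ τ τ′ R} r → 0 < r → slice (ρ ∷ R) r ⊆ slice (τ ∷ gap b (τ′ ∷ R)) (suc b + r)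
offset-copy b {ρ} {τ} {τ′} r 0<r = ≡⇒⊆ (sym (offset-gap b {τ} r)) ∘ swap {ρ} {τ′} r 0<r

nonempty-∈ : ∀ {ρ : Atoms} → ρ ≢ [] → ∃[ A ] A ∈ ρ
nonempty-∈ {[]}    h = contradiction refl h
nonempty-∈ {A ∷ _} _ = A , here refl

∈-pad : ∀ {b 𝓓} τs {τ} → τ ∈ τs → ∃[ q ] (q < padLength b τs × slice (pad b τs 𝓓) q ≡ τ)
∈-pad (_ ∷ τs) (here refl) = 0 , s≤s z≤n , refl
∈-pad {b} {𝓓} (_ ∷ τs) (there τ∈) with ∈-pad {b} {𝓓} τs τ∈
... | q , q< , eq = suc (b + q) , s≤s (+-monoʳ-< b q<) , trans (slice-gap b q) eq

pad-++ : ∀ {b 𝓓} τs {τs′} → pad b (τs ++ τs′) 𝓓 ≡ pad b τs (pad b τs′ 𝓓)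
pad-++ []               = refl
pad-++ {b} (τ ∷ τs) = cong (λ 𝓓 → τ ∷ gap b 𝓓) (pad-++ τs)

module _ {b : ℕ} {ρ : Atoms} {R : Instance} (open-gap : ∀ r → r < b → slice R r ≡ []) where

  exact-open : ∀ {i σ k σ₁ τ} s′ → Normal i σ ((exact k , σ₁) ∷ s′) →
      Bounded b ((exact k , σ₁) ∷ s′) →
    ¬ Sem (slice (τ ∷ R)) 0 ((exact k , σ₁) ∷ s′)
  exact-open {k = k} s′ (σ₁≢[] , _) (k<b ∷ _) (_ , refl , σ₁⊆ , _) =
    absent σ₁≢[] σ₁⊆ (open-gap (k + 0) (subst (_< b) (sym (+-identityʳ k)) k<b))

  -- Staying at position 0 would give `σ₁ ⊆ ρ ⊆ σ`. This contradicts (n3), unless an `exact` link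
  -- follows; but that one ends in the gap.
  advances : ∀ {i σ} s′ → Normal i σ s′ → Bounded b s′ → ρ ⊆ σ →
    (sem : Sem (slice (ρ ∷ R)) 0 s′) → Advances s′ sem
  advances [] _ _ _ _ = tt
  advances ((exact k , σ₁) ∷ s′) nf bd _ sem = exact-open s′ nf bd sem
  advances ((atLeast k , σ₁) ∷ s′) _ _ _ (suc p₁ , _) = s≤s z≤n
  advances {σ = σ} ((atLeast k , σ₁) ∷ s′) (_ , n3 , _ , nf) (_ ∷ bd) ρ⊆σ
      (zero , k+0≤0 , σ₁⊆ρ , sem) = ⊥-elim (dead s′ n3 nf bd sem)
    where
    k≡0 : k ≡ 0
    k≡0 = n≤0⇒n≡0 (≤-trans (m≤m+n k 0) k+0≤0)
    dead : ∀ s′ → (atLeast k ≡ atLeast 0 → outKind s′ ≡ loose → ¬ (σ₁ ⊆ σ)) → Normal loose σ₁ s′ →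
        Bounded b s′ → ¬ Sem (slice (ρ ∷ R)) 0 s′
    dead [] n3 _ _ _ = n3 (cong atLeast k≡0) refl (ρ⊆σ ∘ σ₁⊆ρ)
    dead ((atLeast _ , _) ∷ _) n3 _ _ _ = n3 (cong atLeast k≡0) refl (ρ⊆σ ∘ σ₁⊆ρ)
    dead ((exact _ , _) ∷ s′) _ nf bd sem = exact-open s′ nf bd sem

  -- If `σ` lacked `A`, it would hold on the weakened point, and its loose continuation could be
  -- moved to the full copy one gap later.
  tight-loose : ∀ {N σ} s′ → Normal tight σ s′ → Bounded b s′ → Sat (ρ ∷ R) 0 σ s′ →
    (∀ 𝓓 → 𝓓 ∈ weakened b N tight loose ρ R → ¬ Sat 𝓓 0 σ s′) → ρ ⊆ σ
  tight-loose {σ = σ} s′ nf bd (σ⊆ρ , sem) neg with ρ ⊆? σ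
  ... | yes ρ⊆σ = ρ⊆σ
  ... | no ρ⊈σ with ⊈⇒∉ ρ⊈σ
  ...   | A , A∈ρ , A∉σ = ⊥-elim
      (neg _ (∈-map⁺ (λ A → (ρ ∖ A) ∷ gap b (ρ ∷ R)) A∈ρ) (⊆-∖ σ⊆ρ A∉σ , go s′ nf bd sem))
    where
    go : ∀ s′ → Normal tight σ s′ → Bounded b s′ → Sem (slice (ρ ∷ R)) 0 s′ →
        Sem (slice ((ρ ∖ A) ∷ gap b (ρ ∷ R))) 0 s′
    go [] _ _ _ = tt
    go ((exact _ , _) ∷ s′) nf bd sem = ⊥-elim (exact-open s′ nf bd sem)
    go ((atLeast k , _) ∷ s′) nf bd (p₁ , rch , ⊆f , sem) =
      suc b + p₁ , ≤-trans rch (m≤n+m p₁ (suc b)) , (≡⇒⊆ (sym (offset-gap b {ρ ∖ A} p₁)) ∘ ⊆f)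
          , embed b (ρ ∖ A) s′ sem

  -- Every point of the competitor matched at the place of `ρ` lacks an atom of `ρ`: the one at hand
  -- by assumption, each further one because by (n4) it does not include its predecessor. So each
  -- has a place on some `ρ ∖ A`, and one round of copies per point keeps them in order.
  fits-padding : ∀ M {σ} s′ →
    length s′ < suc M ⊎ Singleton ρ ⊎ Strict s′ →
    Normal loose σ s′ → Bounded b s′ → (∃[ A ] (A ∈ ρ × A ∉ σ)) → Sat (ρ ∷ R) 0 σ s′ →
    ∃[ p ] Sat (pad b (copies (suc M) (map (ρ ∖_) ρ)) ([] ∷ R)) p σ s′
  fits-padding M {σ} s′ long nf bd (A , A∈ρ , A∉σ) (σ⊆ρ , sem)
    with ∈-pad {b} {pad b (copies M (map (ρ ∖_) ρ)) ([] ∷ R)} (map (ρ ∖_) ρ) (∈-map⁺ (ρ ∖_) A∈ρ)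
  ... | q , q< , eq = subst (λ 𝓓 → ∃[ p ] Sat 𝓓 p σ s′) (sym (pad-++ (map (ρ ∖_) ρ)))
      (go M s′ long nf bd sem q eq q<)
    where
    τs = map (ρ ∖_) ρ
    L = padLength b τs
    go : ∀ M s′ → length s′ < suc M ⊎ Singleton ρ ⊎ Strict s′ →
      Normal loose σ s′ → Bounded b s′ → Sem (slice (ρ ∷ R)) 0 s′ →
      ∀ q → slice (pad b τs (pad b (copies M τs) ([] ∷ R))) q ≡ ρ ∖ A → q < L →
      ∃[ p ] Sat (pad b τs (pad b (copies M τs) ([] ∷ R))) p σ s′
    go M [] _ _ _ _ q eq q< = q , (≡⇒⊆ (sym eq) ∘ ⊆-∖ σ⊆ρ A∉σ) , tt
    go M ((exact _ , _) ∷ s′) _ nf bd sem _ _ _ = ⊥-elim (exact-open s′ nf bd sem)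
    -- The run ends here: the next point lies beyond `ρ`, so the remaining padding is skipped.
    go M ((atLeast k , σ₁) ∷ s′) _ _ _ (suc p₁ , rch , ⊆f , sem) q eq q< =
      q , (≡⇒⊆ (sym eq) ∘ ⊆-∖ σ⊆ρ A∉σ) , L + (W + suc p₁)
      , ≤-trans (≤-reflexive (+-comm k q))
          (+-mono-≤ (<⇒≤ q<) (≤-trans (≤-trans (m≤m+n k 0) rch) (m≤n+m (suc p₁) W)))
      , (moved (suc p₁) (s≤s z≤n) ∘ ⊆f)
      , push L s′ (λ r _ → ≡⇒⊆ (sym (offset-pad τs r)))
          (push W s′ (λ r _ → ≡⇒⊆ (sym (offset-pad (copies M τs) r)))
            (push 0 s′ (λ r h → swap {ρ} {[]} {R} r (≤-trans (s≤s z≤n) h)) sem))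
      where
      W = padLength b (copies M τs)
      moved : ∀ r → 0 < r → slice (ρ ∷ R) r ⊆ slice (pad b τs (pad b (copies M τs) ([] ∷ R)))
          (L + (W + r))
      moved r 0<r = ≡⇒⊆ (sym (trans (offset-pad τs (W + r)) (offset-pad (copies M τs) r))) ∘ swap
          {ρ} {[]} {R} r 0<r
    go M ((atLeast k , σ₁) ∷ s′) long (σ₁≢[] , _ , n4 , nf) (_ ∷ bd) (zero , rch , σ₁⊆ρ , sem) q
        eq q<
      with ⊈⇒∉ (n4 (cong atLeast (n≤0⇒n≡0 (≤-trans (m≤m+n k 0) rch))) refl)
    ... | B , B∈σ , B∉σ₁ = place M long eq
      where
      place : ∀ M → length ((atLeast k , σ₁) ∷ s′) < suc M ⊎ Singleton ρ ⊎ Strict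
          ((atLeast k , σ₁) ∷ s′) →
        slice (pad b τs (pad b (copies M τs) ([] ∷ R))) q ≡ ρ ∖ A →
        ∃[ p ] Sat (pad b τs (pad b (copies M τs) ([] ∷ R))) p σ ((atLeast k , σ₁) ∷ s′)
      place zero (inj₁ (s≤s ())) _
      place (suc M) (inj₁ (s≤s h)) eq with fits-padding M s′ (inj₁ h) nf bd (B , σ⊆ρ B∈σ , B∉σ₁)
          (σ₁⊆ρ , sem)
      ... | p , ⊆f , sem₁ = q , (≡⇒⊆ (sym eq) ∘ ⊆-∖ σ⊆ρ A∉σ) , L + p
        , ≤-trans (+-monoˡ-≤ q (≤-trans (m≤m+n k 0) rch)) (≤-trans (<⇒≤ q<) (m≤m+n L p))
        , (≡⇒⊆ (sym (offset-pad τs p)) ∘ ⊆f) , push L s′ (λ r _ → ≡⇒⊆ (sym (offset-pad τs r))) sem₁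
      -- The run has no second point if `ρ` is a singleton: the nonempty `σ₁` would contain its only
      -- atom `B`.
      place M (inj₂ (inj₁ single)) _ with nonempty-∈ σ₁≢[]
      ... | C , C∈σ₁ = contradiction (subst (_∈ σ₁) (single (σ₁⊆ρ C∈σ₁) (σ⊆ρ B∈σ)) C∈σ₁) B∉σ₁
      place M (inj₂ (inj₂ (k≢0 ∷ _))) _ =
          contradiction (cong atLeast (n≤0⇒n≡0 (≤-trans (m≤m+n k 0) rch))) k≢0

module _ {b : ℕ} {ρ : Atoms} {R : Instance} where

  -- The two full copies refute an absent or loose continuation. An `exact` continuation leaves the
  -- point for good, so it does not notice a missing atom there, and the weakened instances apply.
  tight-tight : ∀ {N σ} s′ → Sat (ρ ∷ R) 0 σ s′ →
    (∀ 𝓓 → 𝓓 ∈ weakened b N tight tight ρ R → ¬ Sat 𝓓 0 σ s′) → ρ ⊆ σ × outKind s′ ≡ tight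
  tight-tight [] (σ⊆ρ , _) neg = ⊥-elim (neg _ (here refl) (σ⊆ρ , tt))
  tight-tight ((atLeast k , σ₁) ∷ s′) (σ⊆ρ , p₁ , rch , ⊆f , sem) neg =
    ⊥-elim (neg _ (here refl) (σ⊆ρ , suc b + p₁ , ≤-trans rch (m≤n+m p₁ (suc b))
      , (≡⇒⊆ (sym (offset-gap b {ρ} p₁)) ∘ ⊆f) , embed b ρ s′ sem))
  tight-tight {σ = σ} ((exact k , σ₁) ∷ s′) (σ⊆ρ , p₁ , refl , ⊆f , sem) neg with ρ ⊆? σ
  ... | yes ρ⊆σ = ρ⊆σ , refl
  ... | no ρ⊈σ with ⊈⇒∉ ρ⊈σ
  ...   | A , A∈ρ , A∉σ = ⊥-elim (neg _ (there (∈-map⁺ (λ A → (ρ ∖ A) ∷ R) A∈ρ))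
            (⊆-∖ σ⊆ρ A∉σ , p₁ , refl , ⊆f
                , push 0 s′ (λ r h → swap {ρ} {ρ ∖ A} {R} r (≤-trans (s≤s z≤n) h)) sem))

  exact-copy : ∀ A s′ → outKind s′ ≡ tight → Sem (slice (ρ ∷ R)) 0 s′ →
      Sem (slice (ρ ∷ gap b ((ρ ∖ A) ∷ R))) (suc b + 0) s′
  exact-copy A ((exact j , _) ∷ s″) _ (_ , refl , ⊆f , sem) =
    suc b + suc (j + 0) , reach-+ (suc b) (exact j) refl
    , (offset-copy b {ρ} {ρ} {ρ ∖ A} {R} (suc (j + 0)) (s≤s z≤n) ∘ ⊆f)
    , push (suc b) s″ (λ r h → offset-copy b {ρ} {ρ} {ρ ∖ A} {R} r (≤-trans (s≤s z≤n) h)) sem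

  -- If the competitor's run at the place of `ρ` has several points and the last has an outgoing
  -- `exact` link, then by (n4) that last point lacks an atom `A` of its predecessor. It is moved to
  -- `ρ ∖ A`, while the earlier ones stay on the full copy. A run that ends in another way fits with
  -- any `A`.
  loose-tight-chain : ρ ≢ [] → ∀ {σ} s′ → Normal loose σ s′ → Sat (ρ ∷ R) 0 σ s′ →
    outKind s′ ≡ tight ⊎ ∃[ A ] (A ∈ ρ × Sat (ρ ∷ gap b ((ρ ∖ A) ∷ R)) 0 σ s′)
  loose-tight-chain ρ≢[] [] _ (σ⊆ρ , _) with nonempty-∈ ρ≢[]
  ... | A , A∈ρ = inj₂ (A , A∈ρ , σ⊆ρ , tt)
  loose-tight-chain _ ((exact k , σ₁) ∷ s′) _ _ = inj₁ refl
  loose-tight-chain ρ≢[] ((atLeast k , σ₁) ∷ s′) _ (σ⊆ρ , suc p₁ , rch , ⊆f , sem)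
      with nonempty-∈ ρ≢[]
  ... | A , A∈ρ = inj₂ (A , A∈ρ , σ⊆ρ , suc b + suc p₁ , ≤-trans rch (m≤n+m (suc p₁) (suc b))
          , (offset-copy b {ρ} {ρ} {ρ ∖ A} {R} (suc p₁) (s≤s z≤n) ∘ ⊆f)
          , push (suc b) s′ (λ r h → offset-copy b {ρ} {ρ} {ρ ∖ A} {R} r (≤-trans (s≤s z≤n) h)) sem)
  loose-tight-chain ρ≢[] {σ} ((atLeast k , σ₁) ∷ s′) (σ₁≢[] , _ , n4 , nf)
      (σ⊆ρ , zero , rch , σ₁⊆ρ , sem)
    with loose-tight-chain ρ≢[] s′ nf (σ₁⊆ρ , sem)
  ... | inj₂ (A , A∈ρ , ⊆f , sem₁) = inj₂ (A , A∈ρ , σ⊆ρ , 0 , rch , ⊆f , sem₁)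
  ... | inj₁ out with ⊈⇒∉ (n4 (cong atLeast (n≤0⇒n≡0 (≤-trans (m≤m+n k 0) rch))) refl)
  ...   | A , A∈σ , A∉σ₁ = inj₂ (A , σ⊆ρ A∈σ , σ⊆ρ , suc b + 0 , ≤-trans rch z≤n
            , (≡⇒⊆ (sym (offset-gap b {ρ} 0)) ∘ ⊆-∖ σ₁⊆ρ A∉σ₁) , exact-copy A s′ out sem)

weakened-neg : ∀ {b N i ρ} s {𝓓} → 𝓓 ∈ weakened b N i (outKind s) ρ (rest b s) →
    𝓓 ∈ negatives b N i ρ s
weakened-neg []      𝓓∈ = 𝓓∈
weakened-neg (_ ∷ _) 𝓓∈ = ∈-++⁺ˡ 𝓓∈

shortened-neg : ∀ {b N i ρ} k {ρ₁} s →
  at-distance k ρ ρ₁ (rest b s) ∈ negatives b N i ρ ((atLeast (suc k) , ρ₁) ∷ s)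
shortened-neg {b} {N} {i} {ρ} k {ρ₁} s =
  ∈-++⁺ʳ (weakened b N i loose ρ (gap b (ρ₁ ∷ rest b s))) (here refl)

later-neg : ∀ {b N i ρ} l {ρ₁} s {𝓓} → 𝓓 ∈ negatives b N (kind l) ρ₁ s →
  ρ ∷ gap (gapLength b l) 𝓓 ∈ negatives b N i ρ ((l , ρ₁) ∷ s)
later-neg {b} {N} {i} {ρ} l {ρ₁} s 𝓓∈ =
  ∈-++⁺ʳ (weakened b N i (kind l) ρ (gap (gapLength b l) (ρ₁ ∷ rest b s)))
    (∈-++⁺ʳ (shortened b l ρ ρ₁ s) (∈-map⁺ (λ 𝓓 → ρ ∷ gap (gapLength b l) 𝓓) 𝓓∈))

-- Provides a negative example that a competitor satisfies when it ends too early.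
loose-neg : ∀ {b N ρ} s → ρ ≢ [] → ∃[ 𝓓 ] 𝓓 ∈ negatives b N loose ρ s
loose-neg {b} {N} {ρ} s ρ≢[] = let 𝓓 , 𝓓∈ = go (outKind s) in 𝓓 , weakened-neg s 𝓓∈
  where
  go : ∀ o → ∃[ 𝓓 ] 𝓓 ∈ weakened b N loose o ρ (rest b s)
  go loose = _ , here refl
  go tight = let A , A∈ρ = nonempty-∈ ρ≢[] in _ , ∈-map⁺ (λ A → ρ ∷ gap b ((ρ ∖ A) ∷ rest b s)) A∈ρ

open-rest : ∀ b s → outKind s ≡ loose → ∀ r → r < b → slice (rest b s) r ≡ []
open-rest b []                    _ _ _   = refl
open-rest b ((atLeast _ , _) ∷ _) _ r r<b = slice-gap-< b r<b

sat-after : ∀ {ρ σ} k l {σ₁ 𝓓 p} s′ → σ ⊆ ρ → Reach l 0 (suc k + p) → Sat 𝓓 p σ₁ s′ →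
  Sat (ρ ∷ gap k 𝓓) 0 σ ((l , σ₁) ∷ s′)
sat-after {ρ} k l {p = p} s′ σ⊆ρ rch (⊆f , sem) =
  σ⊆ρ , suc k + p , rch , (≡⇒⊆ (sym (offset-gap k {ρ} p)) ∘ ⊆f) , embed k ρ s′ sem

-- Refutes the passage of an `exact` link over the intended next point.
overshoot : ∀ {b N ρ σ q} s s′ → ρ ≢ [] → σ ≢ [] → q < b → 0 < q → Sat (ρ ∷ rest b s) q σ s′ →
  ∃[ 𝓓 ] (𝓓 ∈ negatives b N tight ρ s × Sat 𝓓 q σ s′)
overshoot {q = suc q} [] s′ ρ≢[] σ≢[] q<b 0<q (⊆f , _) = ⊥-elim (absent σ≢[] ⊆f refl)
overshoot {b} {q = suc q} ((atLeast _ , _) ∷ s) s′ ρ≢[] σ≢[] q<b 0<q (⊆f , _) =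
  ⊥-elim (absent σ≢[] ⊆f (slice-gap-< b (<-trans (n<1+n q) q<b)))
overshoot {b} {N} {ρ} {q = q@(suc _)} s@((exact _ , _) ∷ _) s′ ρ≢[] σ≢[] q<b 0<q (⊆f , sem) =
  let A , A∈ρ = nonempty-∈ ρ≢[] in
  _ , weakened-neg {b} {N} {tight} {ρ} s (there (∈-map⁺ (λ A → (ρ ∖ A) ∷ rest b s) A∈ρ)) , ⊆f
  , push 0 s′ (λ r h → swap {ρ} {ρ ∖ A} {rest b s} r (≤-trans (s≤s z≤n) h)) sem

1≤⇒suc : ∀ {N} → 1 ≤ N → ∃[ M ] N ≡ suc M
1≤⇒suc {suc M} _ = M , refl

-- When `s` continues loosely, the kind of the competitor's continuation is still open;
-- `recover-steps` decides it by `advances` or `loose-neg`.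
Local : ℕ → Kind → Atoms → Steps → Atoms → Steps → ℕ → Set
Local b i ρ s σ s′ p = p ≡ 0 × ρ ⊆ σ × outKind s ≡ tight × outKind s′ ≡ tight
  ⊎ p ≡ 0 × ρ ⊆ σ × outKind s ≡ loose

-- After a loose link the example stands behind a long gap, so a match may begin anywhere in it;
-- after a tight one only its first position counts.
Unfit : ℕ → ℕ → Kind → Atoms → Steps → Atoms → Steps → Set
Unfit b N i ρ s σ s′ = ∀ 𝓓 → 𝓓 ∈ negatives b N i ρ s → ∀ p → (i ≡ tight → p ≡ 0) → ¬ Sat 𝓓 p σ s′

module _ {b N : ℕ} {ρ : Atoms} {s : Steps} {σ : Atoms} {s′ : Steps} (bd′ : Bounded b s′) where

  local-tight : ∀ {p} → Normal tight σ s′ → Sat (ρ ∷ rest b s) 0 σ s′ → p ≡ 0 →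
    Unfit b N tight ρ s σ s′ → Local b tight ρ s σ s′ p
  local-tight nf sat p≡0 unfit with outKind s
      in out | (λ {𝓓} → weakened-neg {b} {N} {tight} {ρ} s {𝓓})
  ... | tight | neg =
    let ρ⊆σ , out′ = tight-tight {N = N} s′ sat (λ 𝓓 𝓓∈ → unfit 𝓓 (neg 𝓓∈) 0 λ _ → refl)
    in inj₁ (p≡0 , ρ⊆σ , refl , out′)
  ... | loose | neg = inj₂
      (p≡0 , tight-loose (open-rest b s out) {N = N} s′ nf bd′ sat
          (λ 𝓓 𝓓∈ → unfit 𝓓 (neg 𝓓∈) 0 λ _ → refl) , refl)

  local-loose : ∀ {p} → 1 ≤ N → Adequate N loose ρ s s′ → ρ ≢ [] → Normal loose σ s′ →
      Sat (ρ ∷ rest b s) p σ s′ →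
    Unfit b N loose ρ s σ s′ → Local b loose ρ s σ s′ p
  -- A match beginning after the place of `ρ` does not see the changes made there, so a translate of
  -- it satisfies the negative example.
  local-loose {suc p} _ _ ρ≢[] nf (⊆f , sem) unfit =
      ⊥-elim (unfit 𝓓 (weakened-neg s 𝓓∈) (w + suc p) (λ ()) sat)
    where
    ∃neg : ∀ o → ∃[ 𝓓 ] ∃[ w ]
        (𝓓 ∈ weakened b N loose o ρ (rest b s) ×
            (∀ r → 0 < r → slice (ρ ∷ rest b s) r ⊆ slice 𝓓 (w + r)))
    ∃neg tight = let A , A∈ρ = nonempty-∈ ρ≢[] in
      _ , suc b , ∈-map⁺ (λ A → ρ ∷ gap b ((ρ ∖ A) ∷ rest b s)) A∈ρ
          , offset-copy b {ρ} {ρ} {ρ ∖ A} {rest b s}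
    ∃neg loose = _ , padLength b τs , here refl , λ r 0<r →
        ≡⇒⊆ (sym (offset-pad τs r)) ∘ swap {ρ} {[]} {rest b s} r 0<r
      where τs = copies N (map (ρ ∖_) ρ)
    𝓓 = proj₁ (∃neg (outKind s))
    w = proj₁ (proj₂ (∃neg (outKind s)))
    𝓓∈ = proj₁ (proj₂ (proj₂ (∃neg (outKind s))))
    copy = proj₂ (proj₂ (proj₂ (∃neg (outKind s))))
    sat : Sat 𝓓 (w + suc p) σ s′
    sat = (copy (suc p) (s≤s z≤n) ∘ ⊆f) , push w s′ (λ r h → copy r (≤-trans (s≤s z≤n) h)) sem
  local-loose {zero} 1≤N adq ρ≢[] nf sat unfit
      with outKind s in out | (λ {𝓓} → weakened-neg {b} {N} {loose} {ρ} s {𝓓})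
  ... | tight | neg = inj₁ (refl , ρ⊆σ , refl , out′)
    where
    chained = loose-tight-chain {b} {ρ} {rest b s} ρ≢[] s′ nf sat
    out′ : outKind s′ ≡ tight
    out′ with chained
    ... | inj₁ h = h
    ... | inj₂ (A , A∈ρ , sat′) = ⊥-elim
        (unfit _ (neg (∈-map⁺ (λ A → ρ ∷ gap b ((ρ ∖ A) ∷ rest b s)) A∈ρ)) 0 (λ ()) sat′)
    ρ⊆σ : ρ ⊆ σ
    ρ⊆σ with ρ ⊆? σ
    ... | yes h = h
    ... | no ρ⊈σ with ⊈⇒∉ ρ⊈σ
    ...   | A , A∈ρ , A∉σ = ⊥-elim
        (unfit _ (neg (∈-map⁺ (λ A → ρ ∷ gap b ((ρ ∖ A) ∷ rest b s)) A∈ρ)) (suc b + 0) (λ ())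
              ((≡⇒⊆ (sym (offset-gap b {ρ} 0)) ∘ ⊆-∖ (proj₁ sat) A∉σ)
                  , exact-copy {b} A s′ out′ (proj₂ sat)))
  ... | loose | neg = inj₂ (refl , ρ⊆σ , refl)
    where
    long : ∀ {M} → N ≡ suc M → Adequate N loose ρ s s′ → length s′ < suc M ⊎ Singleton ρ ⊎ Strict s′
    long _  (inj₁ nl)         = inj₂ (inj₁ (isolated-singleton s nl out))
    long eq (inj₂ (inj₁ len)) = inj₁ (subst (length s′ <_) eq len)
    long _  (inj₂ (inj₂ st))  = inj₂ (inj₂ st)
    ρ⊆σ : ρ ⊆ σ
    ρ⊆σ with ρ ⊆? σ | 1≤⇒suc 1≤N
    ... | yes h | _     = h
    ... | no ρ⊈σ | M , eq with fits-padding (open-rest b s out) M s′ (long eq adq) nf bd′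
        (⊈⇒∉ ρ⊈σ) sat
    ...   | p , sat′ = ⊥-elim
        (unfit _ (neg (here (cong (λ n → pad b (copies n (map (ρ ∖_) ρ)) ([] ∷ rest b s))
            (sym eq)))) p (λ ()) sat′)

adequate-tail : ∀ {N i l l′ ρ ρ₁ σ₁ s s′} →
  Adequate N i ρ ((l , ρ₁) ∷ s) ((l′ , σ₁) ∷ s′) → Adequate N (kind l) ρ₁ s s′
adequate-tail (inj₁ (_ , nl))          = inj₁ nl
adequate-tail (inj₂ (inj₁ h))          = inj₂ (inj₁ (<-trans (n<1+n _) h))
adequate-tail (inj₂ (inj₂ (_ ∷ st))) = inj₂ (inj₂ st)

-- A single match of the competitor onto the stretched instance is followed; any deviation from the
-- intended places or sets contradicts normality or turns the match into one of a negative example.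
-- `recover` treats a point, `recover-steps` the link after it.
recover : ∀ {b N} i {ρ} s {σ} s′ {p} → 1 ≤ N → Adequate N i ρ s s′ →
  Normal i ρ s → Normal i σ s′ → Bounded b s → Bounded b s′ → (i ≡ loose → ρ ≢ []) →
      (i ≡ tight → p ≡ 0) →
  Sat (ρ ∷ rest b s) p σ s′ → Unfit b N i ρ s σ s′ → (σ ⊆ ρ × ρ ⊆ σ) × s ≼ s′
recover-steps : ∀ {b N i ρ} s {σ} s′ → 1 ≤ N → Adequate N i ρ s s′ →
  Normal i ρ s → Normal i σ s′ → Bounded b s → Bounded b s′ → ρ ⊆ σ →
  outKind s ≡ tight × outKind s′ ≡ tight ⊎ outKind s ≡ loose →
  Sat (ρ ∷ rest b s) 0 σ s′ → (∀ 𝓓 → 𝓓 ∈ negatives b N i ρ s → ¬ Sat 𝓓 0 σ s′) → s ≼ s′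

recover {b} {N} i {ρ} s {σ} s′ {p} 1≤N adq nf nf′ bd bd′ ρ≢[] start sat unfit
  = finish (local i refl)
  where
  local : ∀ j → i ≡ j → Local b i ρ s σ s′ p
  local tight refl = local-tight {s = s} bd′ nf′
      (subst (λ q → Sat (ρ ∷ rest b s) q σ s′) (start refl) sat) (start refl) unfit
  local loose refl = local-loose {s = s} bd′ 1≤N adq (ρ≢[] refl) nf′ sat unfit
  finish : Local b i ρ s σ s′ p → (σ ⊆ ρ × ρ ⊆ σ) × s ≼ s′
  finish (inj₁ (refl , ρ⊆σ , out , out′)) = (proj₁ sat , ρ⊆σ) ,
    recover-steps s s′ 1≤N adq nf nf′ bd bd′ ρ⊆σ (inj₁ (out , out′)) sat λ 𝓓 𝓓∈ →
        unfit 𝓓 𝓓∈ 0 λ _ → refl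
  finish (inj₂ (refl , ρ⊆σ , out)) = (proj₁ sat , ρ⊆σ) ,
    recover-steps s s′ 1≤N adq nf nf′ bd bd′ ρ⊆σ (inj₂ out) sat λ 𝓓 𝓓∈ → unfit 𝓓 𝓓∈ 0 λ _ → refl

recover-steps [] [] _ _ _ _ _ _ _ _ _ _ = []
recover-steps {ρ = ρ} [] s′@((exact _ , _) ∷ _) _ _ _ nf′ _ bd′ ρ⊆σ _ (_ , sem) _ =
  ⊥-elim (advances {R = []} (λ _ _ → refl) s′ nf′ bd′ ρ⊆σ sem)
recover-steps {ρ = ρ} [] s′@((atLeast _ , _) ∷ _) _ _ _ nf′ _ bd′ ρ⊆σ _
    (_ , sem@(p₁ , _ , σ₁⊆ , _)) _ =
  ⊥-elim (absent (proj₁ nf′) σ₁⊆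
      (past-end p₁ (advances {R = []} (λ _ _ → refl) s′ nf′ bd′ ρ⊆σ sem)))
  where
  past-end : ∀ p → 0 < p → slice (ρ ∷ []) p ≡ []
  past-end (suc _) _ = refl
recover-steps (_ ∷ _) [] _ _ _ _ _ _ _ (inj₁ (_ , ())) _ _
recover-steps ((exact _ , _) ∷ _) ((atLeast _ , _) ∷ _) _ _ _ _ _ _ _ (inj₁ (_ , ())) _ _
recover-steps ((atLeast _ , _) ∷ _) (_ ∷ _) _ _ _ _ _ _ _ (inj₁ (() , _)) _ _
recover-steps ((exact _ , _) ∷ _) _ _ _ _ _ _ _ _ (inj₂ ()) _ _
recover-steps {b} {N} {i} {ρ} ((exact k , ρ₁) ∷ s) {σ} ((exact k′ , σ₁) ∷ s′) 1≤N adq nf nf′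
    bd@(_ ∷ bd₁) bd′@(k′<b ∷ bd₁′) ρ⊆σ (inj₁ _) (σ⊆ρ , _ , refl , ⊆f , sem) unfit
  = step (≤⇒∃ k≤k′)
  where
  ≤⇒∃ : ∀ {m n} → m ≤ n → ∃[ q ] n ≡ m + q
  ≤⇒∃ h = _ , sym (m+[n∸m]≡n h)
  k≤k′ : k ≤ k′
  k≤k′ with k ≤? k′
  ... | yes h = h
  ... | no k≰k′ = ⊥-elim
      (absent (proj₁ nf′) ⊆f (slice-gap-< k (subst (_< k) (sym (+-identityʳ k′)) (≰⇒> k≰k′))))
  inside : ∀ q → k′ ≡ k + q → Sat (ρ₁ ∷ rest b s) q σ₁ s′
  inside q refl = (≡⇒⊆ (trans (cong (slice (gap k (ρ₁ ∷ rest b s))) (+-identityʳ (k + q)))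
      (offset-gap k {ρ} q)) ∘ ⊆f)
    , pull (suc k) s′ (λ r _ → ≡⇒⊆ (offset-gap k {ρ} r))
        (subst (λ p → Sem (slice (ρ ∷ gap k (ρ₁ ∷ rest b s))) p s′) (+-identityʳ (suc k + q)) sem)
  beyond : ∀ q → k′ ≡ k + q → ∀ 𝓓 → 𝓓 ∈ negatives b N tight ρ₁ s → ¬ Sat 𝓓 q σ₁ s′
  beyond q refl 𝓓 𝓓∈ sat = unfit _ (later-neg {i = i} (exact k) s 𝓓∈)
      (sat-after k (exact (k + q)) s′ σ⊆ρ (sym (+-identityʳ _)) sat)
  step : ∃[ q ] k′ ≡ k + q → (exact k , ρ₁) ∷ s ≼ (exact k′ , σ₁) ∷ s′
  step (suc q , eq) with overshoot {N = N} s s′ (proj₁ nf) (proj₁ nf′)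
      (≤-<-trans (≤-trans (m≤n+m (suc q) k) (≤-reflexive (sym eq))) k′<b) (s≤s z≤n)
          (inside (suc q) eq)
  ... | 𝓓 , 𝓓∈ , sat = ⊥-elim (beyond (suc q) eq 𝓓 𝓓∈ sat)
  step (zero , eq) with recover tight s s′ 1≤N
      (adequate-tail {N} {i} {exact k} {exact k′} {ρ} {ρ₁} {σ₁} {s} {s′} adq)
          (proj₂ (proj₂ (proj₂ nf))) (proj₂ (proj₂ (proj₂ nf′)))
         bd₁ bd₁′ (λ ()) (λ _ → refl) (inside 0 eq)
             (λ 𝓓 𝓓∈ p p≡0 → subst (λ p → ¬ Sat 𝓓 p σ₁ s′) (sym (p≡0 refl)) (beyond 0 eq 𝓓 𝓓∈))
  ... | (σ₁⊆ , ⊆σ₁) , h rewrite trans eq (+-identityʳ k) = exact ⊆σ₁ σ₁⊆ h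
recover-steps {b} {N} {i} {ρ} ((atLeast k , ρ₁) ∷ s) {σ} [] 1≤N adq nf nf′ bd bd′ ρ⊆σ (inj₂ _)
    (σ⊆ρ , _) unfit
  with loose-neg {b} {N} s (proj₁ nf)
... | 𝓓 , 𝓓∈ = ⊥-elim (unfit _ (later-neg {i = i} (atLeast k) s 𝓓∈) (σ⊆ρ , tt))
recover-steps {b} ((atLeast k , ρ₁) ∷ s) s′@((exact k′ , σ₁) ∷ _) 1≤N adq nf nf′ bd bd′ ρ⊆σ
    (inj₂ _) (_ , sem) unfit =
  ⊥-elim (advances {R = rest b ((atLeast k , ρ₁) ∷ s)} (λ r → slice-gap-< b) s′ nf′ bd′ ρ⊆σ sem)
recover-steps {b} {N} {i} {ρ} ((atLeast k , ρ₁) ∷ s) {σ} t′@((atLeast k′ , σ₁) ∷ s′) 1≤N adq nf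
    nf′ bd@(_ ∷ bd₁) bd′@(k′≤b ∷ bd₁′) ρ⊆σ (inj₂ _) (σ⊆ρ , sem₀@(p₁ , rch , ⊆f , sem)) unfit
  = finish (recover loose s s′ 1≤N
      (adequate-tail {N} {i} {atLeast k} {atLeast k′} {ρ} {ρ₁} {σ₁} {s} {s′} adq)
          (proj₂ (proj₂ (proj₂ nf))) (proj₂ (proj₂ (proj₂ nf′)))
      bd₁ bd₁′ (λ _ → proj₁ nf) (λ ()) inside beyond)
  where
  advanced : 0 < p₁
  advanced = advances {R = rest b ((atLeast k , ρ₁) ∷ s)} (λ r → slice-gap-< b) t′ nf′ bd′ ρ⊆σ sem₀
  b<p₁ : suc b ≤ p₁
  b<p₁ with suc b ≤? p₁
  ... | yes h = h
  ... | no ¬h = ⊥-elim (absent (proj₁ nf′) ⊆f (slice-gap-in b ρ advanced (≰⇒> ¬h)))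
  p₁≡ : p₁ ≡ suc b + (p₁ ∸ suc b)
  p₁≡ = sym (m+[n∸m]≡n b<p₁)
  inside : Sat (ρ₁ ∷ rest b s) (p₁ ∸ suc b) σ₁ s′
  inside = (≡⇒⊆ (trans (cong (slice (ρ ∷ gap b (ρ₁ ∷ rest b s))) p₁≡) (offset-gap b {ρ} _)) ∘ ⊆f)
    , pull (suc b) s′ (λ r _ → ≡⇒⊆ (offset-gap b {ρ} r))
        (subst (λ p → Sem (slice (ρ ∷ gap b (ρ₁ ∷ rest b s))) p s′) p₁≡ sem)
  beyond : Unfit b N loose ρ₁ s σ₁ s′
  beyond 𝓓 𝓓∈ p _ sat = unfit _ (later-neg {i = i} (atLeast k) s 𝓓∈)
    (sat-after b (atLeast k′) s′ σ⊆ρ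
        (≤-trans (≤-reflexive (+-identityʳ k′)) (≤-trans k′≤b (m≤n⇒m≤1+n (m≤m+n b p)))) sat)
  k≤k′ : ∀ j → j ≡ k → j ≤ k′
  k≤k′ zero _ = z≤n
  k≤k′ (suc j) refl with suc j ≤? k′
  ... | yes h = h
  -- Otherwise `k′ ≤ j`, and the competitor fits the instance in which the link is shortened to `j`
  -- steps.
  ... | no ≰  = ⊥-elim (unfit _ (shortened-neg {i = i} j s)
    ((at-distance-0 j ∘ σ⊆ρ) , j + (p₁ ∸ suc b)
        , ≤-trans (≤-reflexive (+-identityʳ k′)) (≤-trans (≤-pred (≰⇒> ≰)) (m≤m+n j _))
    , (at-distance-⊇ j {ρ} _ ∘ proj₁ inside)
        , push j s′ (λ r _ → at-distance-⊇ j {ρ} r) (proj₂ inside)))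
  finish : (σ₁ ⊆ ρ₁ × ρ₁ ⊆ σ₁) × s ≼ s′ → (atLeast k , ρ₁) ∷ s ≼ t′
  finish ((σ₁⊆ , ⊆σ₁) , h) = atLeast (k≤k′ k refl) ⊆σ₁ σ₁⊆ h

-- Normalisation

-- Repairs (n3). A point with an outgoing `exact` link must stay, because it fixes the position of
-- its successor. Each deletion exposes a new neighbour of `ρ`, hence the recursion.
dropRedundant : Atoms → Steps → Steps
dropRedundant ρ [] = []
dropRedundant ρ ((atLeast zero , ρ₁) ∷ s) with outKind s | ρ₁ ⊆? ρ
... | loose | yes _ = dropRedundant ρ s
... | loose | no _  = (atLeast zero , ρ₁) ∷ s
... | tight | _     = (atLeast zero , ρ₁) ∷ s
dropRedundant ρ s@((atLeast (suc _) , _) ∷ _) = s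
dropRedundant ρ s@((exact _ , _) ∷ _) = s

-- Repairs (n4). After the merger `ρ₁` still has a loose incoming link, so normality of what follows
-- is preserved.
prepend : Link → Atoms → Steps → Steps
prepend (atLeast k) ρ ((atLeast zero , ρ₁) ∷ s) with ρ ⊆? ρ₁
... | yes _ = (atLeast k , ρ₁) ∷ s
... | no _  = (atLeast k , ρ) ∷ (atLeast zero , ρ₁) ∷ s
prepend l ρ s = (l , ρ) ∷ s

normalise : Steps → Steps
normalise []            = []
normalise ((l , ρ) ∷ s) = prepend l ρ (dropRedundant ρ (normalise s))

-- Omits the conditions that involve the point before the first link, since normalisation proceeds
-- from the end and that point is still to be added.
Inner : Steps → Set
Inner []             = ⊤
Inner ((l , ρ₁) ∷ s) = ρ₁ ≢ [] × Normal (kind l) ρ₁ s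

Irredundant : Atoms → Steps → Set
Irredundant ρ []             = ⊤
Irredundant ρ ((l , ρ₁) ∷ s) = l ≡ atLeast 0 → outKind s ≡ loose → ¬ (ρ₁ ⊆ ρ)

Nonempty : Steps → Set
Nonempty = All λ (_ , ρ) → ρ ≢ []

normal⇒inner : ∀ i {ρ} s → Normal i ρ s → Inner s
normal⇒inner i []      _                     = tt
normal⇒inner i (_ ∷ _) (ρ₁≢[] , _ , _ , nf) = ρ₁≢[] , nf

inner⇒normal : ∀ {ρ} s → Inner s → Irredundant ρ s → Normal tight ρ s
inner⇒normal []      _              _  = tt
inner⇒normal (_ ∷ _) (ρ₁≢[] , nf) n3 = ρ₁≢[] , n3 , (λ _ ()) , nf

drop-normal : ∀ ρ s → Inner s → Inner (dropRedundant ρ s) × Irredundant ρ (dropRedundant ρ s)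
drop-normal ρ [] _ = tt , tt
drop-normal ρ ((atLeast zero , ρ₁) ∷ s) inn with outKind s in out | ρ₁ ⊆? ρ
... | loose | yes _  = drop-normal ρ s (normal⇒inner loose s (proj₂ inn))
... | loose | no ρ₁⊈ρ = inn , λ _ _ → ρ₁⊈ρ
... | tight | _      = inn , λ _ out′ → contradiction (trans (sym out) out′) λ ()
drop-normal ρ ((atLeast (suc _) , _) ∷ _) inn = inn , λ ()
drop-normal ρ ((exact _ , _) ∷ _) inn = inn , λ ()

prepend-inner : ∀ l ρ s → ρ ≢ [] → Inner s → Irredundant ρ s → Inner (prepend l ρ s)
prepend-inner (atLeast k) ρ [] ρ≢[] _ _ = ρ≢[] , tt
prepend-inner (atLeast k) ρ ((atLeast zero , ρ₁) ∷ s) ρ≢[] (ρ₁≢[] , nf) n3 with ρ ⊆? ρ₁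
... | yes _   = ρ₁≢[] , nf
... | no ρ⊈ρ₁ = ρ≢[] , ρ₁≢[] , n3 , (λ _ _ → ρ⊈ρ₁) , nf
prepend-inner (atLeast k) ρ ((atLeast (suc _) , ρ₁) ∷ s) ρ≢[] (ρ₁≢[] , nf) n3 =
    ρ≢[] , ρ₁≢[] , n3 , (λ ()) , nf
prepend-inner (atLeast k) ρ ((exact _ , ρ₁) ∷ s) ρ≢[] (ρ₁≢[] , nf) n3 =
    ρ≢[] , ρ₁≢[] , n3 , (λ ()) , nf
prepend-inner (exact _) ρ s ρ≢[] inn n3 = ρ≢[] , inner⇒normal s inn n3

normalise-inner : ∀ s → Nonempty s → Inner (normalise s)
normalise-inner [] _ = tt
normalise-inner ((l , ρ) ∷ s) (ρ≢[] ∷ ne) =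
  let inn , n3 = drop-normal ρ (normalise s) (normalise-inner s ne) in prepend-inner l ρ _ ρ≢[]
      inn n3

normalised : ∀ ρ s → Nonempty s → Normal tight ρ (dropRedundant ρ (normalise s))
normalised ρ s ne = let inn , n3 = drop-normal ρ (normalise s) (normalise-inner s ne)
    in inner⇒normal _ inn n3

loose-earlier : ∀ {f p p₁} s → outKind s ≡ loose → p ≤ p₁ → Sem f p₁ s → Sem f p s
loose-earlier [] _ _ _ = tt
loose-earlier ((atLeast k , _) ∷ _) _ p≤p₁ (p₂ , rch , rest) =
    p₂ , ≤-trans (+-monoʳ-≤ k p≤p₁) rch , rest

drop-sem⇒ : ∀ {f p ρ} s → Sem f p s → Sem f p (dropRedundant ρ s)
drop-sem⇒ [] _ = tt
drop-sem⇒ {ρ = ρ} ((atLeast zero , ρ₁) ∷ s) sem@(p₁ , p≤p₁ , _ , sem₁)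
    with outKind s in out | ρ₁ ⊆? ρ
... | loose | yes _ = drop-sem⇒ s (loose-earlier s out p≤p₁ sem₁)
... | loose | no _  = sem
... | tight | _     = sem
drop-sem⇒ ((atLeast (suc _) , _) ∷ _) sem = sem
drop-sem⇒ ((exact _ , _) ∷ _) sem = sem

drop-sem⇐ : ∀ {f p ρ} s → ρ ⊆ f p → Sem f p (dropRedundant ρ s) → Sem f p s
drop-sem⇐ [] _ _ = tt
drop-sem⇐ {p = p} {ρ} ((atLeast zero , ρ₁) ∷ s) ρ⊆ sem with outKind s in out | ρ₁ ⊆? ρ
... | loose | yes ρ₁⊆ρ = p , ≤-refl , (ρ⊆ ∘ ρ₁⊆ρ) , drop-sem⇐ s ρ⊆ sem
... | loose | no _  = sem
... | tight | _     = sem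
drop-sem⇐ ((atLeast (suc _) , _) ∷ _) _ sem = sem
drop-sem⇐ ((exact _ , _) ∷ _) _ sem = sem

prepend-sem⇒ : ∀ {f p} l ρ s → Sem f p ((l , ρ) ∷ s) → Sem f p (prepend l ρ s)
prepend-sem⇒ (atLeast k) ρ [] sem = sem
prepend-sem⇒ (atLeast k) ρ ((atLeast zero , ρ₁) ∷ s) sem@(p₁ , rch , _ , p₂ , p₁≤p₂ , rest)
    with ρ ⊆? ρ₁
... | yes _ = p₂ , ≤-trans rch p₁≤p₂ , rest
... | no _  = sem
prepend-sem⇒ (atLeast k) ρ ((atLeast (suc _) , _) ∷ _) sem = sem
prepend-sem⇒ (atLeast k) ρ ((exact _ , _) ∷ _) sem = sem
prepend-sem⇒ (exact _) ρ s sem = sem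

prepend-sem⇐ : ∀ {f p} l ρ s → Sem f p (prepend l ρ s) → Sem f p ((l , ρ) ∷ s)
prepend-sem⇐ (atLeast k) ρ [] sem = sem
prepend-sem⇐ (atLeast k) ρ ((atLeast zero , ρ₁) ∷ s) sem with ρ ⊆? ρ₁
prepend-sem⇐ (atLeast k) ρ ((atLeast zero , ρ₁) ∷ s) (p₂ , rch , ρ₁⊆ , rest) | yes ρ⊆ρ₁ =
  p₂ , rch , (ρ₁⊆ ∘ ρ⊆ρ₁) , p₂ , ≤-refl , ρ₁⊆ , rest
... | no _  = sem
prepend-sem⇐ (atLeast k) ρ ((atLeast (suc _) , _) ∷ _) sem = sem
prepend-sem⇐ (atLeast k) ρ ((exact _ , _) ∷ _) sem = sem
prepend-sem⇐ (exact _) ρ s sem = sem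

normalise-sem⇒ : ∀ {f p} s → Sem f p s → Sem f p (normalise s)
normalise-sem⇒ [] _ = tt
normalise-sem⇒ ((l , ρ) ∷ s) (p₁ , rch , ρ⊆ , sem) =
  prepend-sem⇒ l ρ _ (p₁ , rch , ρ⊆ , drop-sem⇒ (normalise s) (normalise-sem⇒ s sem))

normalise-sem⇐ : ∀ {f p} s → Sem f p (normalise s) → Sem f p s
normalise-sem⇐ [] _ = tt
normalise-sem⇐ ((l , ρ) ∷ s) sem with prepend-sem⇐ l ρ _ sem
... | p₁ , rch , ρ⊆ , sem₁ = p₁ , rch , ρ⊆ , normalise-sem⇐ s (drop-sem⇐ (normalise s) ρ⊆ sem₁)

drop-strict : ∀ ρ {s} → Strict s → Strict (dropRedundant ρ s)
drop-strict ρ {[]} _ = []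
drop-strict ρ {(atLeast zero , _) ∷ _} (h ∷ _) = contradiction refl h
drop-strict ρ {(atLeast (suc _) , _) ∷ _} h = h
drop-strict ρ {(exact _ , _) ∷ _} h = h

prepend-strict : ∀ l ρ {s} → l ≢ atLeast 0 → Strict s → Strict (prepend l ρ s)
prepend-strict (atLeast k) ρ {[]} h _ = h ∷ []
prepend-strict (atLeast k) ρ {(atLeast zero , ρ₁) ∷ s} _ (h ∷ _) = contradiction refl h
prepend-strict (atLeast k) ρ {(atLeast (suc _) , ρ₁) ∷ s} h st = h ∷ st
prepend-strict (atLeast k) ρ {(exact _ , ρ₁) ∷ s} h st = h ∷ st
prepend-strict (exact _) ρ h st = h ∷ st

normalise-strict : ∀ {s} → Strict s → Strict (normalise s)
normalise-strict {[]} _ = []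
normalise-strict {(l , ρ) ∷ s} (h ∷ st) = prepend-strict l ρ h (drop-strict ρ (normalise-strict st))

weight : Steps → ℕ
weight []            = 0
weight ((_ , ρ) ∷ s) = suc (length ρ) + weight s

drop-weight : ∀ ρ s → weight (dropRedundant ρ s) ≤ weight s
drop-weight ρ [] = z≤n
drop-weight ρ ((atLeast zero , ρ₁) ∷ s) with outKind s | ρ₁ ⊆? ρ
... | loose | yes _ = ≤-trans (drop-weight ρ s) (m≤n+m (weight s) (suc (length ρ₁)))
... | loose | no _  = ≤-refl
... | tight | _     = ≤-refl
drop-weight ρ ((atLeast (suc _) , _) ∷ _) = ≤-refl
drop-weight ρ ((exact _ , _) ∷ _) = ≤-refl

prepend-weight : ∀ l ρ s → weight (prepend l ρ s) ≤ suc (length ρ) + weight s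
prepend-weight (atLeast k) ρ [] = ≤-refl
prepend-weight (atLeast k) ρ ((atLeast zero , ρ₁) ∷ s) with ρ ⊆? ρ₁
... | yes _ = m≤n+m _ (suc (length ρ))
... | no _  = ≤-refl
prepend-weight (atLeast k) ρ ((atLeast (suc _) , _) ∷ _) = ≤-refl
prepend-weight (atLeast k) ρ ((exact _ , _) ∷ _) = ≤-refl
prepend-weight (exact _) ρ s = ≤-refl

normalise-weight : ∀ s → weight (normalise s) ≤ weight s
normalise-weight [] = z≤n
normalise-weight ((l , ρ) ∷ s) = ≤-trans (prepend-weight l ρ _)
  (+-monoʳ-≤ (suc (length ρ)) (≤-trans (drop-weight ρ (normalise s)) (normalise-weight s)))

-- Path queries

opLink : Op → Link
opLink ○  = exact 0
opLink ◇  = atLeast 1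
opLink ◇ᵣ = atLeast 0

infixl 6 _⊕_

_⊕_ : Link → Op → Link
exact k   ⊕ ○  = exact (suc k)
exact k   ⊕ ◇  = atLeast (suc (suc k))
exact k   ⊕ ◇ᵣ = atLeast (suc k)
atLeast k ⊕ ○  = atLeast (suc k)
atLeast k ⊕ ◇  = atLeast (suc k)
atLeast k ⊕ ◇ᵣ = atLeast k

PathSteps : Set
PathSteps = List (Op × Atoms)

fuse : PathSteps → Steps
fuseFrom : Link → Atoms → PathSteps → Steps
fuse []                            = []
fuse ((o , ρ) ∷ os)                = fuseFrom (opLink o) ρ os
-- Trailing points without atoms are dropped: a link always reaches some position.
fuseFrom l []        []            = []
fuseFrom l []        ((o , ρ) ∷ os) = fuseFrom (l ⊕ o) ρ os
fuseFrom l ρ@(_ ∷ _) os            = (l , ρ) ∷ fuse os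

PathSem : Model → ℕ → PathSteps → Set
PathSem f p []             = ⊤
PathSem f p ((o , ρ) ∷ os) = ∃[ p′ ] (Reach (opLink o) p p′ × ρ ⊆ f p′ × PathSem f p′ os)

⊕-reach : ∀ l o {p p₁ p₂} → Reach l p p₁ → Reach (opLink o) p₁ p₂ → Reach (l ⊕ o) p p₂
⊕-reach (exact k)   ○  refl refl = refl
⊕-reach (exact k)   ◇  refl h    = h
⊕-reach (exact k)   ◇ᵣ refl h    = h
⊕-reach (atLeast k) ○  h    refl = s≤s h
⊕-reach (atLeast k) ◇  h    h′   = ≤-trans (s≤s h) h′
⊕-reach (atLeast k) ◇ᵣ h    h′   = ≤-trans h h′

⊕-split : ∀ l o {p p₂} → Reach (l ⊕ o) p p₂ → ∃[ p₁ ] (Reach l p p₁ × Reach (opLink o) p₁ p₂)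
⊕-split (exact k)   ○  refl        = _ , refl , refl
⊕-split (exact k)   ◇  h           = _ , refl , h
⊕-split (exact k)   ◇ᵣ h           = _ , refl , h
⊕-split (atLeast k) ○  {p₂ = suc _} (s≤s h) = _ , h , refl
⊕-split (atLeast k) ◇  h           = _ , ≤-refl , h
⊕-split (atLeast k) ◇ᵣ h           = _ , h , ≤-refl

reach-some : ∀ l p → ∃[ p′ ] Reach l p p′
reach-some (exact k)   p = _ , refl
reach-some (atLeast k) p = _ , ≤-refl

module _ {f : Model} where

  fuse-sem⇒ : ∀ {p} os → PathSem f p os → Sem f p (fuse os)
  fuseFrom-sem⇒ : ∀ {p p₁} l ρ os → Reach l p p₁ → ρ ⊆ f p₁ → PathSem f p₁ os →
      Sem f p (fuseFrom l ρ os)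
  fuse-sem⇒ [] _ = tt
  fuse-sem⇒ ((o , ρ) ∷ os) (_ , rch , ρ⊆ , sem) = fuseFrom-sem⇒ (opLink o) ρ os rch ρ⊆ sem
  fuseFrom-sem⇒ l [] [] _ _ _ = tt
  fuseFrom-sem⇒ l [] ((o , ρ) ∷ os) rch _ (_ , rch′ , ρ⊆ , sem) =
      fuseFrom-sem⇒ (l ⊕ o) ρ os (⊕-reach l o rch rch′) ρ⊆ sem
  fuseFrom-sem⇒ l (_ ∷ _) os rch ρ⊆ sem = _ , rch , ρ⊆ , fuse-sem⇒ os sem

  fuse-sem⇐ : ∀ {p} os → Sem f p (fuse os) → PathSem f p os
  fuseFrom-sem⇐ : ∀ {p} l ρ os → Sem f p (fuseFrom l ρ os) →
      ∃[ p₁ ] (Reach l p p₁ × ρ ⊆ f p₁ × PathSem f p₁ os)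
  fuse-sem⇐ [] _ = tt
  fuse-sem⇐ ((o , ρ) ∷ os) sem = fuseFrom-sem⇐ (opLink o) ρ os sem
  fuseFrom-sem⇐ {p} l [] [] _ = let p₁ , rch = reach-some l p in p₁ , rch , (λ ()) , tt
  fuseFrom-sem⇐ l [] ((o , ρ) ∷ os) sem with fuseFrom-sem⇐ (l ⊕ o) ρ os sem
  ... | p₂ , rch , ρ⊆ , sem₁ with ⊕-split l o rch
  ...   | p₁ , rch₁ , rch₂ = p₁ , rch₁ , (λ ()) , p₂ , rch₂ , ρ⊆ , sem₁
  fuseFrom-sem⇐ l (_ ∷ _) os (p₁ , rch , ρ⊆ , sem) = p₁ , rch , ρ⊆ , fuse-sem⇐ os sem

elements-⊆ : ∀ ρ → elements ρ ⊆ ρ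
elements-⊆ ρ = ∈-deduplicate⁻ _≟_ ρ

⊆-elements : ∀ {ρ} → ρ ⊆ elements ρ
⊆-elements = ∈-deduplicate⁺ _≟_

conj⇒ : ∀ {𝓓 ℓ} ρ → 𝓓 at ℓ ⊨ conj ρ → ρ ⊆ slice 𝓓 ℓ
conj⇒ (A ∷ [])     A∈        (here refl) = A∈
conj⇒ (A ∷ B ∷ ρ) (A∈ , _)  (here refl) = A∈
conj⇒ (A ∷ B ∷ ρ) (_ , sat) (there C∈)  = conj⇒ (B ∷ ρ) sat C∈

conj⇐ : ∀ {𝓓 ℓ} ρ → ρ ⊆ slice 𝓓 ℓ → 𝓓 at ℓ ⊨ conj ρ
conj⇐ []          _  = tt
conj⇐ (A ∷ [])    ρ⊆ = ρ⊆ (here refl)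
conj⇐ (A ∷ B ∷ ρ) ρ⊆ = ρ⊆ (here refl) , conj⇐ (B ∷ ρ) (ρ⊆ ∘ there)

path⇒ : ∀ {𝓓 ℓ} ρ os → 𝓓 at ℓ ⊨ path ρ os → ρ ⊆ slice 𝓓 ℓ × PathSem (slice 𝓓) ℓ os
path⇒ ρ [] sat = (conj⇒ (elements ρ) sat ∘ ⊆-elements) , tt
path⇒ ρ ((○ , ρ′) ∷ os) (sat , sat′) = (conj⇒ (elements ρ) sat ∘ ⊆-elements) , _ , refl
    , path⇒ ρ′ os sat′
path⇒ ρ ((◇ , ρ′) ∷ os) (sat , m , h , sat′) =
    (conj⇒ (elements ρ) sat ∘ ⊆-elements) , m , h , path⇒ ρ′ os sat′
path⇒ ρ ((◇ᵣ , ρ′) ∷ os) (sat , m , h , sat′) =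
    (conj⇒ (elements ρ) sat ∘ ⊆-elements) , m , h , path⇒ ρ′ os sat′

path⇐ : ∀ {𝓓 ℓ} ρ os → ρ ⊆ slice 𝓓 ℓ → PathSem (slice 𝓓) ℓ os → 𝓓 at ℓ ⊨ path ρ os
path⇐ ρ [] ρ⊆ _ = conj⇐ (elements ρ) (ρ⊆ ∘ elements-⊆ ρ)
path⇐ ρ ((○ , ρ′) ∷ os) ρ⊆ (_ , refl , ρ′⊆ , sem) =
    conj⇐ (elements ρ) (ρ⊆ ∘ elements-⊆ ρ) , path⇐ ρ′ os ρ′⊆ sem
path⇐ ρ ((◇ , ρ′) ∷ os) ρ⊆ (m , h , ρ′⊆ , sem) =
    conj⇐ (elements ρ) (ρ⊆ ∘ elements-⊆ ρ) , m , h , path⇐ ρ′ os ρ′⊆ sem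
path⇐ ρ ((◇ᵣ , ρ′) ∷ os) ρ⊆ (m , h , ρ′⊆ , sem) =
    conj⇐ (elements ρ) (ρ⊆ ∘ elements-⊆ ρ) , m , h , path⇐ ρ′ os ρ′⊆ sem

clean : PathSteps → PathSteps
clean = map λ (o , ρ) → o , elements ρ

clean-sem⇒ : ∀ {f p} os → PathSem f p os → PathSem f p (clean os)
clean-sem⇒ [] _ = tt
clean-sem⇒ ((_ , ρ) ∷ os) (p₁ , rch , ρ⊆ , sem) = p₁ , rch , (ρ⊆ ∘ elements-⊆ ρ) , clean-sem⇒ os sem

clean-sem⇐ : ∀ {f p} os → PathSem f p (clean os) → PathSem f p os
clean-sem⇐ [] _ = tt
clean-sem⇐ ((_ , ρ) ∷ os) (p₁ , rch , ρ⊆ , sem) = p₁ , rch , (ρ⊆ ∘ ⊆-elements) , clean-sem⇐ os sem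

fuse-nonempty : ∀ os → Nonempty (fuse os)
fuseFrom-nonempty : ∀ l ρ os → Nonempty (fuseFrom l ρ os)
fuse-nonempty []             = []
fuse-nonempty ((o , ρ) ∷ os) = fuseFrom-nonempty (opLink o) ρ os
fuseFrom-nonempty l []      []             = []
fuseFrom-nonempty l []      ((o , ρ) ∷ os) = fuseFrom-nonempty (l ⊕ o) ρ os
fuseFrom-nonempty l (_ ∷ _) os             = (λ ()) ∷ fuse-nonempty os

pathWeight : PathSteps → ℕ
pathWeight []             = 0
pathWeight ((_ , ρ) ∷ os) = suc (length ρ) + pathWeight os

fuse-weight : ∀ os → weight (fuse os) ≤ pathWeight os
fuseFrom-weight : ∀ l ρ os → weight (fuseFrom l ρ os) ≤ suc (length ρ) + pathWeight os
fuse-weight []             = z≤n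
fuse-weight ((o , ρ) ∷ os) = fuseFrom-weight (opLink o) ρ os
fuseFrom-weight l []      []             = z≤n
fuseFrom-weight l []      ((o , ρ) ∷ os) = m≤n⇒m≤1+n (fuseFrom-weight (l ⊕ o) ρ os)
fuseFrom-weight l (A ∷ ρ) os             = +-monoʳ-≤ (suc (length (A ∷ ρ))) (fuse-weight os)

NonReflexive : PathSteps → Set
NonReflexive = All λ (o , _) → o ≢ ◇ᵣ

opLink-strict : ∀ o → o ≢ ◇ᵣ → opLink o ≢ atLeast 0
opLink-strict ◇ᵣ h _ = h refl

⊕-strict : ∀ l o → l ≢ atLeast 0 → o ≢ ◇ᵣ → l ⊕ o ≢ atLeast 0
⊕-strict (exact _)         ○  _ _ ()
⊕-strict (exact _)         ◇  _ _ ()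
⊕-strict (atLeast _)       ○  _ _ ()
⊕-strict (atLeast _)       ◇  _ _ ()
⊕-strict l                 ◇ᵣ _ h _ = h refl

fuse-strict : ∀ {os} → NonReflexive os → Strict (fuse os)
fuseFrom-strict : ∀ l ρ {os} → l ≢ atLeast 0 → NonReflexive os → Strict (fuseFrom l ρ os)
fuse-strict {[]} _ = []
fuse-strict {(o , ρ) ∷ os} (h ∷ hs) = fuseFrom-strict (opLink o) ρ (opLink-strict o h) hs
fuseFrom-strict l [] {[]} _ _ = []
fuseFrom-strict l [] {(o , ρ) ∷ os} hl (h ∷ hs) = fuseFrom-strict (l ⊕ o) ρ (⊕-strict l o hl h) hs
fuseFrom-strict l (_ ∷ _) hl hs = hl ∷ fuse-strict hs

clean-nonReflexive : ∀ {os} → NonReflexive os → NonReflexive (clean os)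
clean-nonReflexive []       = []
clean-nonReflexive (h ∷ hs) = h ∷ clean-nonReflexive hs

length≤conj : ∀ ρ → length ρ ≤ symbols (conj ρ)
length≤conj []          = z≤n
length≤conj (A ∷ [])    = ≤-refl
length≤conj (A ∷ B ∷ ρ) = s≤s (m≤n⇒m≤1+n (length≤conj (B ∷ ρ)))

pathWeight≤symbols : ∀ ρ os → length (elements ρ) + pathWeight (clean os) ≤ symbols (path ρ os)
pathWeight≤symbols ρ [] = ≤-trans (≤-reflexive (+-identityʳ _)) (length≤conj (elements ρ))
pathWeight≤symbols ρ ((o , ρ′) ∷ os) = +-mono-≤ (length≤conj (elements ρ))
    (s≤s (m≤n⇒m≤1+n (pathWeight≤symbols ρ′ os)))

-- Avoids `◇`, so that the spurious competitors stay within the class of `○` and `◇ᵣ`.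
unfuseLink : Link → Atoms → PathSteps → PathSteps
unfuseLink (exact zero)      ρ os = (○ , ρ) ∷ os
unfuseLink (exact (suc k))   ρ os = (○ , []) ∷ unfuseLink (exact k) ρ os
unfuseLink (atLeast zero)    ρ os = (◇ᵣ , ρ) ∷ os
unfuseLink (atLeast (suc k)) ρ os = (○ , []) ∷ unfuseLink (atLeast k) ρ os

unfuse : Steps → PathSteps
unfuse []            = []
unfuse ((l , ρ) ∷ s) = unfuseLink l ρ (unfuse s)

module _ {f : Model} where

  unfuseLink-sem⇒ : ∀ {p p₁} l ρ os → Reach l p p₁ → ρ ⊆ f p₁ → PathSem f p₁ os →
      PathSem f p (unfuseLink l ρ os)
  unfuseLink-sem⇒ (exact zero)      ρ os rch ρ⊆ sem = _ , rch , ρ⊆ , sem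
  unfuseLink-sem⇒ {p} (exact (suc k)) ρ os rch ρ⊆ sem =
    suc p , refl , (λ ()) , unfuseLink-sem⇒ (exact k) ρ os
        (trans rch (cong suc (sym (+-suc k p)))) ρ⊆ sem
  unfuseLink-sem⇒ (atLeast zero)    ρ os rch ρ⊆ sem = _ , rch , ρ⊆ , sem
  unfuseLink-sem⇒ {p} (atLeast (suc k)) ρ os rch ρ⊆ sem =
    suc p , refl , (λ ()) , unfuseLink-sem⇒ (atLeast k) ρ os
        (≤-trans (≤-reflexive (+-suc k p)) rch) ρ⊆ sem

  unfuseLink-sem⇐ : ∀ {p} l ρ os → PathSem f p (unfuseLink l ρ os) →
      ∃[ p₁ ] (Reach l p p₁ × ρ ⊆ f p₁ × PathSem f p₁ os)
  unfuseLink-sem⇐ (exact zero)      ρ os sem = sem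
  unfuseLink-sem⇐ {p} (exact (suc k)) ρ os (_ , refl , _ , sem)
      with unfuseLink-sem⇐ (exact k) ρ os sem
  ... | p₁ , rch , rest = p₁ , trans rch (cong suc (+-suc k p)) , rest
  unfuseLink-sem⇐ (atLeast zero)    ρ os sem = sem
  unfuseLink-sem⇐ {p} (atLeast (suc k)) ρ os (_ , refl , _ , sem)
      with unfuseLink-sem⇐ (atLeast k) ρ os sem
  ... | p₁ , rch , rest = p₁ , ≤-trans (≤-reflexive (sym (+-suc k p))) rch , rest

  unfuse-sem⇒ : ∀ {p} s → Sem f p s → PathSem f p (unfuse s)
  unfuse-sem⇒ [] _ = tt
  unfuse-sem⇒ ((l , ρ) ∷ s) (_ , rch , ρ⊆ , sem) =
      unfuseLink-sem⇒ l ρ (unfuse s) rch ρ⊆ (unfuse-sem⇒ s sem)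

  unfuse-sem⇐ : ∀ {p} s → PathSem f p (unfuse s) → Sem f p s
  unfuse-sem⇐ [] _ = tt
  unfuse-sem⇐ ((l , ρ) ∷ s) sem with unfuseLink-sem⇐ l ρ (unfuse s) sem
  ... | p₁ , rch , ρ⊆ , sem₁ = p₁ , rch , ρ⊆ , unfuse-sem⇐ s sem₁

unfuse-ops : ∀ {Φ : Op → Set} → Φ ○ → Φ ◇ᵣ → ∀ s → All (λ (o , _) → Φ o) (unfuse s)
unfuse-ops {Φ} c r [] = []
unfuse-ops {Φ} c r ((l , ρ) ∷ s) = go l
  where
  go : ∀ l → All (λ (o , _) → Φ o) (unfuseLink l ρ (unfuse s))
  go (exact zero)      = c ∷ unfuse-ops {Φ} c r s
  go (exact (suc k))   = c ∷ go (exact k)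
  go (atLeast zero)    = r ∷ unfuse-ops {Φ} c r s
  go (atLeast (suc k)) = c ∷ go (atLeast k)

-- Characterisation by the examples, and their size

-- The final 1 makes the bound strict, as `LinkBounded` demands for `exact` links.
width : Steps → ℕ
width []                    = 1
width ((exact k   , _) ∷ s) = k + width s
width ((atLeast k , _) ∷ s) = k + width s

1≤width : ∀ s → 1 ≤ width s
1≤width []                    = ≤-refl
1≤width ((exact k   , _) ∷ s) = ≤-trans (1≤width s) (m≤n+m _ k)
1≤width ((atLeast k , _) ∷ s) = ≤-trans (1≤width s) (m≤n+m _ k)

bounded-mono : ∀ {b c} → b ≤ c → ∀ {s} → Bounded b s → Bounded c s
bounded-mono b≤c [] = []
bounded-mono b≤c {(exact _ , _) ∷ _}   (h ∷ bd) = <-≤-trans h b≤c ∷ bounded-mono b≤c bd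
bounded-mono b≤c {(atLeast _ , _) ∷ _} (h ∷ bd) = ≤-trans h b≤c ∷ bounded-mono b≤c bd

width-bounded : ∀ s → Bounded (width s) s
width-bounded [] = []
width-bounded ((exact k , _) ∷ s) =
  ≤-trans (≤-reflexive (sym (+-comm k 1))) (+-monoʳ-≤ k (1≤width s)) ∷ bounded-mono (m≤n+m _ k)
      (width-bounded s)
width-bounded ((atLeast k , _) ∷ s) = m≤m+n k _ ∷ bounded-mono (m≤n+m _ k) (width-bounded s)

slice-beyond : ∀ 𝓓 {p} → length 𝓓 ≤ p → slice 𝓓 p ≡ []
slice-beyond []      _       = refl
slice-beyond (_ ∷ 𝓓) (s≤s h) = slice-beyond 𝓓 h

-- Every linked point carries atoms and hence lies within `𝓓`, which limits the links.
sat-bounded : ∀ {i ρ 𝓓 p} s → Normal i ρ s → Sem (slice 𝓓) p s → Bounded (length 𝓓) s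
sat-bounded [] _ _ = []
sat-bounded {𝓓 = 𝓓} {p} ((l , ρ₁) ∷ s) (ρ₁≢[] , _ , _ , nf) (p₁ , rch , ρ₁⊆ , sem) =
    go l rch ∷ sat-bounded {𝓓 = 𝓓} s nf sem
  where
  p₁< : p₁ < length 𝓓
  p₁< with p₁ <? length 𝓓
  ... | yes h = h
  ... | no ≮  = ⊥-elim (absent ρ₁≢[] ρ₁⊆ (slice-beyond 𝓓 (≮⇒≥ ≮)))
  go : ∀ l → Reach l p p₁ → LinkBounded (length 𝓓) l
  go (exact k)   refl = ≤-trans (s≤s (m≤m+n k p)) (<⇒≤ p₁<)
  go (atLeast k) h    = ≤-trans (m≤m+n k p) (≤-trans h (<⇒≤ p₁<))

gapBound : Atoms → Steps → ℕ
gapBound ρ s = length (ρ ∷ rest (width s) s) + width s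

-- A query satisfied by the first instance has links shorter than the gaps of
-- the others.
examples : ℕ → Atoms → Steps → ExampleSet
examples N ρ s = record
  { positive = (ρ ∷ rest (width s) s) ∷ (ρ ∷ rest b s) ∷ tights b ρ s
  ; negative = negatives b N tight ρ s }
  where b = gapBound ρ s

_Represents_ : Atoms × Steps → PathQuery → Set
(ρ , s) Represents q = ∀ 𝓓 ℓ → (𝓓 at ℓ ⊨ query q → Sat 𝓓 ℓ ρ s) × (Sat 𝓓 ℓ ρ s → 𝓓 at ℓ ⊨ query q)

examples-fit : ∀ N {q ρ s} → (ρ , s) Represents q → Normal tight ρ s → Fits (examples N ρ s) q
examples-fit N {q} {ρ} {s} rep nf = fits⁺ , fits⁻
  where
  bd = bounded-mono (m≤n+m (width s) (length (ρ ∷ rest (width s) s))) (width-bounded s)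
  fits⁺ : ∀ 𝓓 → 𝓓 ∈ positive (examples N ρ s) → 𝓓 at 0 ⊨ query q
  fits⁺ 𝓓 (here refl)         = proj₂ (rep 𝓓 0) (id , sat-layout s (width-bounded s))
  fits⁺ 𝓓 (there (here refl)) = proj₂ (rep 𝓓 0) (id , sat-layout s bd)
  fits⁺ 𝓓 (there (there 𝓓∈))  = proj₂ (rep 𝓓 0) (sat-tights s bd 𝓓∈)
  fits⁻ : ∀ 𝓓 → 𝓓 ∈ negative (examples N ρ s) → ¬ (𝓓 at 0 ⊨ query q)
  fits⁻ 𝓓 𝓓∈ sat = negatives-⊭ N tight s nf bd (λ ()) 𝓓∈ (early ≤-refl) (proj₁ (rep 𝓓 0) sat)

examples-characterise : ∀ {N q ρ s q′ σ s′} → 1 ≤ N →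
  (ρ , s) Represents q → Normal tight ρ s → (σ , s′) Represents q′ → Normal tight σ s′ →
  Adequate N tight ρ s s′ → Fits (examples N ρ s) q′ → q ≃ q′
examples-characterise {N} {q} {ρ} {s} {q′} {σ} {s′} 1≤N rep nf rep′ nf′ adq (fits⁺ , fits⁻)
  = (λ 𝓓 ℓ sat → let ρ⊆f , sem = proj₁ (rep 𝓓 ℓ) sat in proj₂ (rep′ 𝓓 ℓ)
      ((ρ⊆f ∘ σ⊆ρ) , ≼-sem s′≼s sem))
  , (λ 𝓓 ℓ sat → let σ⊆f , sem = proj₁ (rep′ 𝓓 ℓ) sat in proj₂ (rep 𝓓 ℓ)
      ((σ⊆f ∘ ρ⊆σ) , ≼-sem s≼s′ sem))
  where
  b = gapBound ρ s
  bd = bounded-mono (m≤n+m (width s) (length (ρ ∷ rest (width s) s))) (width-bounded s)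
  sat⁺ : ∀ 𝓓 → 𝓓 ∈ positive (examples N ρ s) → Sat 𝓓 0 σ s′
  sat⁺ 𝓓 𝓓∈ = proj₁ (rep′ 𝓓 0) (fits⁺ 𝓓 𝓓∈)
  bd′ : Bounded b s′
  bd′ = bounded-mono (m≤m+n _ (width s)) (sat-bounded s′ nf′ (proj₂ (sat⁺ _ (here refl))))
  recovered : (σ ⊆ ρ × ρ ⊆ σ) × s ≼ s′
  recovered = recover tight s s′ 1≤N adq nf nf′ bd bd′ (λ ()) (λ _ → refl)
      (sat⁺ _ (there (here refl)))
    λ 𝓓 𝓓∈ p p≡0 sat → fits⁻ 𝓓 𝓓∈ (proj₂ (rep′ 𝓓 0) (subst (λ p → Sat 𝓓 p σ s′) (p≡0 refl) sat))
  σ⊆ρ : σ ⊆ ρ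
  σ⊆ρ = proj₁ (proj₁ recovered)
  ρ⊆σ : ρ ⊆ σ
  ρ⊆σ = proj₂ (proj₁ recovered)
  s≼s′ = proj₂ recovered
  s′≼s : s′ ≼ s
  s′≼s = tights-≽ {i = tight} s≼s′ ρ⊆σ nf′ bd′ λ 𝓓 𝓓∈ → 0 , early ≤-refl , sat⁺ 𝓓 (there (there 𝓓∈))

-- Normal forms of path queries

normalSteps : PathQuery → Steps
normalSteps q = dropRedundant (elements (start q)) (normalise (fuse (clean (steps q))))

fuse-represents : ∀ ρ os → (ρ , fuse os) Represents (ρ ▸ os)
fuse-represents ρ os 𝓓 ℓ = (λ sat → let ρ⊆ , sem = path⇒ ρ os sat in ρ⊆ , fuse-sem⇒ os sem)
  , λ (ρ⊆ , sem) → path⇐ ρ os ρ⊆ (fuse-sem⇐ os sem)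

normalSteps-represents : ∀ q → (elements (start q) , normalSteps q) Represents q
normalSteps-represents (ρ ▸ os) 𝓓 ℓ = to , from
  where
  s = fuse (clean os)
  to : 𝓓 at ℓ ⊨ path ρ os → Sat 𝓓 ℓ (elements ρ) (dropRedundant (elements ρ) (normalise s))
  to sat with path⇒ ρ os sat
  ... | ρ⊆ , sem = (ρ⊆ ∘ elements-⊆ ρ) , drop-sem⇒ (normalise s)
      (normalise-sem⇒ s (fuse-sem⇒ (clean os) (clean-sem⇒ os sem)))
  from : Sat 𝓓 ℓ (elements ρ) (dropRedundant (elements ρ) (normalise s)) → 𝓓 at ℓ ⊨ path ρ os
  from (ρ⊆ , sem) = path⇐ ρ os (ρ⊆ ∘ ⊆-elements)
      (clean-sem⇐ os (fuse-sem⇐ (clean os) (normalise-sem⇐ s (drop-sem⇐ (normalise s) ρ⊆ sem))))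

normalSteps-normal : ∀ q → Normal tight (elements (start q)) (normalSteps q)
normalSteps-normal q = normalised (elements (start q)) _ (fuse-nonempty (clean (steps q)))

normalSteps-weight : ∀ q → length (elements (start q)) + weight (normalSteps q) ≤ ∣ q ∣
normalSteps-weight (ρ ▸ os) = ≤-trans (+-monoʳ-≤ (length (elements ρ))
  (≤-trans (drop-weight (elements ρ) (normalise s))
      (≤-trans (normalise-weight s) (fuse-weight (clean os)))))
  (pathWeight≤symbols ρ os)
  where s = fuse (clean os)

normalSteps-strict : ∀ q → NonReflexive (steps q) → Strict (normalSteps q)
normalSteps-strict q h = drop-strict _ (normalise-strict (fuse-strict (clean-nonReflexive h)))

-- Sizes of the examples

length≤weight : ∀ s → length s ≤ weight s
length≤weight []            = z≤n
length≤weight ((_ , ρ) ∷ s) = s≤s (≤-trans (length≤weight s) (m≤n+m _ (length ρ)))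

total : Instance → ℕ
total 𝓓 = sum (map length 𝓓)

instanceSize≤total : ∀ 𝓓 → instanceSize 𝓓 ≤ total 𝓓
instanceSize≤total []      = z≤n
instanceSize≤total (ρ ∷ 𝓓) = +-mono-≤ (length-deduplicate _≟_ ρ) (instanceSize≤total 𝓓)

total-gap : ∀ k {𝓓} → total (gap k 𝓓) ≡ total 𝓓
total-gap zero    = refl
total-gap (suc k) = total-gap k

total-rest : ∀ b s → total (rest b s) ≤ weight s
total-rest b []            = z≤n
total-rest b ((l , ρ) ∷ s) rewrite total-gap (gapLength b l) {ρ ∷ rest b s} =
  m≤n⇒m≤1+n (+-monoʳ-≤ (length ρ) (total-rest b s))

total-at-distance : ∀ k ρ ρ₁ 𝓓 → total (at-distance k ρ ρ₁ 𝓓) ≡ length ρ + (length ρ₁ + total 𝓓)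
total-at-distance zero    ρ ρ₁ 𝓓 rewrite length-++ ρ {ρ₁} = +-assoc (length ρ) _ _
total-at-distance (suc k) ρ ρ₁ 𝓓 = cong (length ρ +_) (total-gap k)

total-tights : ∀ b ρ s {𝓓} → 𝓓 ∈ tights b ρ s → total 𝓓 ≤ length ρ + weight s
total-tights b ρ ((l , ρ₁) ∷ s) 𝓓∈ with ∈-++⁻ (tightest b l ρ ρ₁ s) 𝓓∈
total-tights b ρ ((atLeast k , ρ₁) ∷ s) _ | inj₁ (here refl) rewrite total-at-distance k ρ ρ₁
    (rest b s) =
  +-monoʳ-≤ (length ρ) (m≤n⇒m≤1+n (+-monoʳ-≤ (length ρ₁) (total-rest b s)))
... | inj₂ 𝓓∈ with ∈-map⁻ (λ 𝓓 → ρ ∷ gap (gapLength b l) 𝓓) 𝓓∈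
...   | 𝓓₁ , 𝓓₁∈ , refl rewrite total-gap (gapLength b l) {𝓓₁} =
    +-monoʳ-≤ (length ρ) (m≤n⇒m≤1+n (total-tights b ρ₁ s 𝓓₁∈))

length-append-map : ∀ {A B : Set} {xs : List B} {f : A → B} {ys : List A} {m n} →
  length xs ≤ m → length ys ≤ n → length (xs ++ map f ys) ≤ m + n
length-append-map {xs = xs} {f} {ys} h h′ =
  ≤-trans (≤-reflexive (trans (length-++ xs) (cong (length xs +_) (length-map f ys))))
      (+-mono-≤ h h′)

count-tights : ∀ b ρ s → length (tights b ρ s) ≤ weight s
count-tights b ρ [] = z≤n
count-tights b ρ ((l , ρ₁) ∷ s) = length-append-map {xs = tightest b l ρ ρ₁ s}
    (≤-trans (one l) (s≤s z≤n)) (count-tights b ρ₁ s)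
  where
  one : ∀ l → length (tightest b l ρ ρ₁ s) ≤ 1
  one (exact _)   = z≤n
  one (atLeast _) = ≤-refl

count-weakened : ∀ b N i o ρ R → length (weakened b N i o ρ R) ≤ suc (length ρ)
count-weakened b N tight tight ρ R = s≤s (≤-reflexive (length-map _ ρ))
count-weakened b N tight loose ρ R = m≤n⇒m≤1+n (≤-reflexive (length-map _ ρ))
count-weakened b N loose tight ρ R = m≤n⇒m≤1+n (≤-reflexive (length-map _ ρ))
count-weakened b N loose loose ρ R = s≤s z≤n

count-shortened : ∀ b l ρ ρ₁ s → length (shortened b l ρ ρ₁ s) ≤ 1
count-shortened b (exact _)         ρ ρ₁ s = z≤n
count-shortened b (atLeast zero)    ρ ρ₁ s = z≤n
count-shortened b (atLeast (suc k)) ρ ρ₁ s = ≤-refl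

count-negatives : ∀ b N i ρ s → length (negatives b N i ρ s) ≤ suc (length ρ) + 2 * weight s
count-negatives b N i ρ [] = ≤-trans (count-weakened b N i loose ρ [])
    (≤-reflexive (sym (+-identityʳ _)))
count-negatives b N i ρ ((l , ρ₁) ∷ s) = ≤-trans (≤-reflexive (length-++ W))
  (+-mono-≤ (count-weakened b N i (kind l) ρ _) (≤-trans
    (length-append-map {xs = shortened b l ρ ρ₁ s} (count-shortened b l ρ ρ₁ s)
        (count-negatives b N (kind l) ρ₁ s))
    (≤-trans (m≤m+n _ (length ρ₁)) (≤-reflexive (lemma (length ρ₁) (weight s))))))
  where
  W = weakened b N i (kind l) ρ (gap (gapLength b l) (ρ₁ ∷ rest b s))
  lemma : ∀ a w → 1 + (suc a + 2 * w) + a ≡ 2 * (suc a + w)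
  lemma = solve-∀

length-∖ : ∀ ρ A → length (ρ ∖ A) ≤ length ρ
length-∖ ρ A = length-filter (λ B → ¬? (B ≟ A)) ρ

total-pad : ∀ b τs 𝓓 → total (pad b τs 𝓓) ≡ sum (map length τs) + total 𝓓
total-pad b []       𝓓 = refl
total-pad b (τ ∷ τs) 𝓓 = trans (cong (length τ +_) (trans (total-gap b) (total-pad b τs 𝓓)))
    (sym (+-assoc (length τ) _ _))

sum-copies : ∀ N τs → sum (map length (copies N τs)) ≡ N * sum (map length τs)
sum-copies zero    τs = refl
sum-copies (suc N) τs = trans (cong sum (map-++ length τs (copies N τs)))
  (trans (sum-++ (map length τs) _) (cong (sum (map length τs) +_) (sum-copies N τs)))

sum-map-≤ : ∀ {A : Set} (f : A → ℕ) xs {m} → (∀ x → x ∈ xs → f x ≤ m) →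
    sum (map f xs) ≤ length xs * m
sum-map-≤ f []       h = z≤n
sum-map-≤ f (x ∷ xs) h = +-mono-≤ (h x (here refl)) (sum-map-≤ f xs λ y y∈ → h y (there y∈))

-- The linear term pays for two copies of a point together with the rest, the other for `N` rounds
-- of at most `W` sets of at most `W` atoms.
negativeBound : ℕ → ℕ → ℕ
negativeBound N W = 2 * W + N * (W * W)

total-two-copies : ∀ b {W n} τ τ′ R → length τ ≤ n → length τ′ ≤ n → n + total R ≤ W →
    total (τ ∷ gap b (τ′ ∷ R)) ≤ 2 * W
total-two-copies b {W} {n} τ τ′ R h h′ ≤W rewrite total-gap b {τ′ ∷ R} =
  +-mono-≤ (≤-trans h (≤-trans (m≤m+n _ _) ≤W))
      (≤-trans (≤-trans (+-monoˡ-≤ (total R) h′) ≤W) (m≤m+n W 0))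

total-weakened : ∀ b N i o ρ R {W 𝓓} → length ρ + total R ≤ W → 𝓓 ∈ weakened b N i o ρ R →
    total 𝓓 ≤ negativeBound N W
total-weakened b N tight tight ρ R ≤W (here refl) =
    ≤-trans (total-two-copies b ρ ρ R ≤-refl ≤-refl ≤W) (m≤m+n _ _)
total-weakened b N tight tight ρ R {W} ≤W (there 𝓓∈) with ∈-map⁻ (λ A → (ρ ∖ A) ∷ R) 𝓓∈
... | A , _ , refl = ≤-trans (≤-trans (+-monoˡ-≤ (total R) (length-∖ ρ A)) ≤W)
    (≤-trans (m≤m+n W _) (m≤m+n _ _))
total-weakened b N tight loose ρ R ≤W 𝓓∈ with ∈-map⁻ (λ A → (ρ ∖ A) ∷ gap b (ρ ∷ R)) 𝓓∈
... | A , _ , refl = ≤-trans (total-two-copies b (ρ ∖ A) ρ R (length-∖ ρ A) ≤-refl ≤W) (m≤m+n _ _)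
total-weakened b N loose tight ρ R ≤W 𝓓∈ with ∈-map⁻ (λ A → ρ ∷ gap b ((ρ ∖ A) ∷ R)) 𝓓∈
... | A , _ , refl = ≤-trans (total-two-copies b ρ (ρ ∖ A) R ≤-refl (length-∖ ρ A) ≤W) (m≤m+n _ _)
total-weakened b N loose loose ρ R {W} ≤W (here refl) = begin
  total (pad b (copies N τs) ([] ∷ R))      ≡⟨ total-pad b (copies N τs) ([] ∷ R) ⟩
  sum (map length (copies N τs)) + total R  ≡⟨ cong (_+ total R) (sum-copies N τs) ⟩
  N * sum (map length τs) + total R         ≤⟨ +-mono-≤ (*-monoʳ-≤ N sum≤)
      (≤-trans (m≤n+m _ _) ≤W) ⟩
  N * (W * W) + W                           ≡⟨ +-comm _ W ⟩
  W + N * (W * W)                           ≤⟨ +-monoˡ-≤ _ (m≤m+n W _) ⟩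
  negativeBound N W                         ∎
  where
  open ≤-Reasoning
  τs = map (ρ ∖_) ρ
  |ρ|≤W : length ρ ≤ W
  |ρ|≤W = ≤-trans (m≤m+n _ _) ≤W
  sum≤ : sum (map length τs) ≤ W * W
  sum≤ = ≤-trans (sum-map-≤ length τs λ τ τ∈ → let A , _ , eq = ∈-map⁻ (ρ ∖_) τ∈ in
           ≤-trans (≤-reflexive (cong length eq)) (≤-trans (length-∖ ρ A) |ρ|≤W))
         (*-monoˡ-≤ W (≤-trans (≤-reflexive (length-map _ ρ)) |ρ|≤W))

negativeBound-+ : ∀ N x y → x + negativeBound N y ≤ negativeBound N (x + y)
negativeBound-+ N x y = begin
  x + (2 * y + N * (y * y))                          ≤⟨ m≤m+n _ (x + N * (x * x + 2 * x * y)) ⟩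
  x + (2 * y + N * (y * y)) + (x + N * (x * x + 2 * x * y)) ≡⟨ lemma N x y ⟩
  2 * (x + y) + N * ((x + y) * (x + y))              ∎
  where
  open ≤-Reasoning
  lemma : ∀ N x y → x + (2 * y + N * (y * y)) + (x + N * (x * x + 2 * x * y)) ≡ 2 * (x + y) + N *
      ((x + y) * (x + y))
  lemma = solve-∀

negativeBound-mono : ∀ {N M V W} → N ≤ M → V ≤ W → negativeBound N V ≤ negativeBound M W
negativeBound-mono n h = +-mono-≤ (*-monoʳ-≤ 2 h) (*-mono-≤ n (*-mono-≤ h h))

total-negatives : ∀ b N i ρ s {𝓓} → 𝓓 ∈ negatives b N i ρ s →
    total 𝓓 ≤ negativeBound N (length ρ + weight s)
total-negatives b N i ρ [] 𝓓∈ = total-weakened b N i loose ρ [] ≤-refl 𝓓∈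
total-negatives b N i ρ ((l , ρ₁) ∷ s) 𝓓∈
    with ∈-++⁻ (weakened b N i (kind l) ρ (gap (gapLength b l) (ρ₁ ∷ rest b s))) 𝓓∈
... | inj₁ 𝓓∈ = total-weakened b N i (kind l) ρ _
    (+-monoʳ-≤ (length ρ) (total-rest b ((l , ρ₁) ∷ s))) 𝓓∈
... | inj₂ 𝓓∈ with ∈-++⁻ (shortened b l ρ ρ₁ s) 𝓓∈
total-negatives b N i ρ ((atLeast (suc k) , ρ₁) ∷ s) _ | inj₂ _ | inj₁ (here refl)
  rewrite total-at-distance k ρ ρ₁ (rest b s) =
  ≤-trans (+-monoʳ-≤ (length ρ) (m≤n⇒m≤1+n (+-monoʳ-≤ (length ρ₁) (total-rest b s))))
      (≤-trans (m≤m+n _ _) (m≤m+n _ _))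
... | inj₂ 𝓓∈ with ∈-map⁻ (λ 𝓓 → ρ ∷ gap (gapLength b l) 𝓓) 𝓓∈
...   | 𝓓₁ , 𝓓₁∈ , refl rewrite total-gap (gapLength b l) {𝓓₁} =
  ≤-trans (+-monoʳ-≤ (length ρ) (total-negatives b N (kind l) ρ₁ s 𝓓₁∈))
    (≤-trans (negativeBound-+ N (length ρ) _)
        (negativeBound-mono {N} ≤-refl (+-monoʳ-≤ (length ρ) (n≤1+n _))))

-- The expansion of `(2 + n) * n + (1 + 2 * n) * negativeBound (suc n) n`: at most `2 +
-- n` positive and `1 + 2 * n` negative examples.
sizePolynomial : Polynomial
sizePolynomial = 0 ∷ 4 ∷ 6 ∷ 3 ∷ 2 ∷ []

examples-size : ∀ {n} ρ s → length ρ + weight s ≤ n →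
    exampleSize (examples (suc n) ρ s) ≤ eval sizePolynomial n
examples-size {n} ρ s ≤n = begin
  sum (map instanceSize (pos ++ neg))                       ≡⟨ cong sum
      (map-++ instanceSize pos neg) ⟩
  sum (map instanceSize pos ++ map instanceSize neg)        ≡⟨ sum-++ (map instanceSize pos) _ ⟩
  sum (map instanceSize pos) + sum (map instanceSize neg)   ≤⟨ +-mono-≤
      (sum-map-≤ instanceSize pos pos≤) (sum-map-≤ instanceSize neg neg≤) ⟩
  length pos * n + length neg * negativeBound (suc n) n     ≤⟨ +-mono-≤
      (*-monoˡ-≤ n (s≤s (s≤s count⁺))) (*-monoˡ-≤ (negativeBound (suc n) n) count⁻) ⟩
  (2 + n) * n + (1 + 2 * n) * (2 * n + suc n * (n * n))     ≡⟨ lemma n ⟩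
  eval sizePolynomial n                                     ∎
  where
  open ≤-Reasoning
  b = gapBound ρ s
  pos = positive (examples (suc n) ρ s)
  neg = negative (examples (suc n) ρ s)
  pos≤ : ∀ 𝓓 → 𝓓 ∈ pos → instanceSize 𝓓 ≤ n
  pos≤ 𝓓 𝓓∈ = ≤-trans (instanceSize≤total 𝓓) (≤-trans (go 𝓓∈) ≤n)
    where
    go : 𝓓 ∈ pos → total 𝓓 ≤ length ρ + weight s
    go (here refl)         = +-monoʳ-≤ (length ρ) (total-rest (width s) s)
    go (there (here refl)) = +-monoʳ-≤ (length ρ) (total-rest b s)
    go (there (there 𝓓∈))  = total-tights b ρ s 𝓓∈
  neg≤ : ∀ 𝓓 → 𝓓 ∈ neg → instanceSize 𝓓 ≤ negativeBound (suc n) n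
  neg≤ 𝓓 𝓓∈ = ≤-trans (instanceSize≤total 𝓓)
      (≤-trans (total-negatives b (suc n) tight ρ s 𝓓∈) (negativeBound-mono {suc n} ≤-refl ≤n))
  count⁺ : length (tights b ρ s) ≤ n
  count⁺ = ≤-trans (count-tights b ρ s) (≤-trans (m≤n+m _ (length ρ)) ≤n)
  count⁻ : length neg ≤ 1 + 2 * n
  count⁻ = ≤-trans (count-negatives b (suc n) tight ρ s)
      (s≤s (≤-trans (+-monoˡ-≤ _ (m≤m+n (length ρ) _))
    (≤-trans (≤-reflexive (sym (*-distribˡ-+ 2 (length ρ) (weight s)))) (*-monoʳ-≤ 2 ≤n))))
  lemma : ∀ n → (2 + n) * n + (1 + 2 * n) * (2 * n + suc n * (n * n)) ≡ 0 + n *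
      (4 + n * (6 + n * (3 + n * (2 + n * 0))))
  lemma = solve-∀

-- Lone conjuncts

data HasLone : Steps → Set where
  lone : ∀ pre k {ρ A B} post → A ∈ ρ → B ∈ ρ → A ≢ B → outKind post ≡ loose →
         HasLone (pre ++ (atLeast k , ρ) ∷ post)

singleton? : ∀ ρ → Singleton ρ ⊎ ∃[ A ] ∃[ B ] (A ∈ ρ × B ∈ ρ × A ≢ B)
singleton? [] = inj₁ λ ()
singleton? (A ∷ ρ) with ρ ⊆? (A ∷ [])
... | yes ρ⊆A = inj₁ λ B∈ C∈ → trans (≡A B∈) (sym (≡A C∈))
  where
  ≡A : ∀ {B} → B ∈ A ∷ ρ → B ≡ A
  ≡A (here refl) = refl
  ≡A (there B∈) with here eq ← ρ⊆A B∈ = eq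
... | no ρ⊈A with ⊈⇒∉ ρ⊈A
...   | B , B∈ρ , B∉A = inj₂ (A , B , here refl , there B∈ρ , λ { refl → B∉A (here refl) })

later-lone : ∀ {l ρ s} → HasLone s → HasLone ((l , ρ) ∷ s)
later-lone {l} {ρ} (lone pre k post A∈ B∈ A≢B out) = lone ((l , ρ) ∷ pre) k post A∈ B∈ A≢B out

noLone? : ∀ ρ s → NoLone tight ρ s ⊎ HasLone s
noLone-step? : ∀ l ρ s → NoLone (kind l) ρ s ⊎ HasLone ((l , ρ) ∷ s)
noLone? ρ [] = inj₁ λ ()
noLone? ρ ((l , ρ₁) ∷ s) with noLone-step? l ρ₁ s
... | inj₁ nl = inj₁ ((λ ()) , nl)
... | inj₂ hl = inj₂ hl
noLone-step? (exact _) ρ s with noLone? ρ s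
... | inj₁ nl = inj₁ nl
... | inj₂ hl = inj₂ (later-lone hl)
noLone-step? (atLeast k) ρ [] with singleton? ρ
... | inj₁ single = inj₁ λ _ → single
... | inj₂ (_ , _ , A∈ , B∈ , A≢B) = inj₂ (lone [] k [] A∈ B∈ A≢B refl)
noLone-step? (atLeast k) ρ ((exact j , ρ₁) ∷ s) with noLone-step? (exact j) ρ₁ s
... | inj₁ nl = inj₁ ((λ _ ()) , nl)
... | inj₂ hl = inj₂ (later-lone hl)
noLone-step? (atLeast k) ρ ((atLeast j , ρ₁) ∷ s) with noLone-step? (atLeast j) ρ₁ s | singleton? ρ
... | inj₂ hl | _ = inj₂ (later-lone hl)
... | inj₁ nl | inj₁ single = inj₁ ((λ _ _ → single) , nl)
... | inj₁ nl | inj₂ (_ , _ , A∈ , B∈ , A≢B) =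
    inj₂ (lone [] k ((atLeast j , ρ₁) ∷ s) A∈ B∈ A≢B refl)

-- N alternations of ρ ∖ A and A. In an instance with fewer than N points two
-- consecutive ones fall together, where all of ρ then holds.
alternate : ℕ → Atoms → Atom → Steps → Steps
alternate zero    ρ A s = s
alternate (suc N) ρ A s = (atLeast 0 , ρ ∖ A) ∷ (atLeast 0 , A ∷ []) ∷ alternate N ρ A s

split : ℕ → ℕ → Atoms → Atom → Steps → Steps
split N k ρ A s = (atLeast k , []) ∷ alternate N ρ A s

sem-++ : ∀ {f} s {t t′ p} → (∀ {p} → Sem f p t → Sem f p t′) → Sem f p (s ++ t) → Sem f p (s ++ t′)
sem-++ [] h sem = h sem
sem-++ (_ ∷ s) h (p₁ , rch , ρ⊆ , sem) = p₁ , rch , ρ⊆ , sem-++ s h sem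

∈-unsplit : ∀ {ρ σ A} → ρ ∖ A ⊆ σ → A ∈ σ → ρ ⊆ σ
∈-unsplit {A = A} ⊆σ A∈σ {B} B∈ρ with B ≟ A
... | yes refl = A∈σ
... | no B≢A   = ⊆σ (∈-filter⁺ (λ B → ¬? (B ≟ A)) B∈ρ B≢A)

alternate-loose : ∀ N {ρ A} s → outKind s ≡ loose → outKind (alternate N ρ A s) ≡ loose
alternate-loose zero    s out = out
alternate-loose (suc N) s _   = refl

alternate-sem : ∀ N {f p ρ A s} → A ∈ ρ → ρ ⊆ f p → Sem f p s → Sem f p (alternate N ρ A s)
alternate-sem zero    A∈ρ ρ⊆ sem = sem
alternate-sem (suc N) {p = p} {ρ} A∈ρ ρ⊆ sem =
  p , ≤-refl , (ρ⊆ ∘ ∖-⊆ {ρ}) , p , ≤-refl , (λ { (here refl) → ρ⊆ A∈ρ })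
      , alternate-sem N A∈ρ ρ⊆ sem

alternate-tail : ∀ N {f p ρ A} s → outKind s ≡ loose → Sem f p (alternate N ρ A s) → Sem f p s
alternate-tail zero s out sem = sem
alternate-tail (suc N) s out (p₁ , p≤p₁ , _ , p₂ , p₁≤p₂ , _ , sem) =
  loose-earlier s out (≤-trans p≤p₁ p₁≤p₂) (alternate-tail N s out sem)

-- Each of the `suc N` pairs not matched at a single position moves forward by at least one, and too
-- few positions of `𝓓` are left for all of them to do so.
alternate-collapse : ∀ N 𝓓 {p ρ A} s → outKind s ≡ loose → length 𝓓 < suc N + p →
  Sem (slice 𝓓) p (alternate (suc N) ρ A s) → ∃[ p₁ ] (p ≤ p₁ × ρ ⊆ slice 𝓓 p₁ × Sem (slice 𝓓) p₁ s)
alternate-collapse N 𝓓 {p} {ρ} {A} s out short (p₁ , p≤p₁ , ρ∖A⊆ , p₂ , p₁≤p₂ , A⊆ , sem)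
    with m≤n⇒m<n∨m≡n p₁≤p₂
... | inj₂ refl = p₁ , p≤p₁ , ∈-unsplit {ρ} ρ∖A⊆ (A⊆ (here refl)) , alternate-tail N s out sem
... | inj₁ p₁<p₂ = go N refl
    (≤-trans short (≤-trans (≤-reflexive (sym (+-suc N p))) (+-monoʳ-≤ N (≤-<-trans p≤p₁ p₁<p₂))))
  where
  p₂< : p₂ < length 𝓓
  p₂< with p₂ <? length 𝓓
  ... | yes h = h
  ... | no ≮  = ⊥-elim (absent {A ∷ []} (λ ()) A⊆ (slice-beyond 𝓓 (≮⇒≥ ≮)))
  go : ∀ M → M ≡ N → length 𝓓 < M + p₂ → ∃[ p₁ ] (p ≤ p₁ × ρ ⊆ slice 𝓓 p₁ × Sem (slice 𝓓) p₁ s)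
  go zero    _    short′ = contradiction p₂< (<⇒≯ short′)
  go (suc M) refl short′ with alternate-collapse M 𝓓 s out short′ sem
  ... | p₃ , p₂≤p₃ , rest = p₃ , ≤-trans p≤p₁ (≤-trans (<⇒≤ p₁<p₂) p₂≤p₃) , rest

module _ {b : ℕ} {ρ : Atoms} {A B : Atom} (A∈ρ : A ∈ ρ) (B∈ρ : B ∈ ρ) (A≢B : A ≢ B) where

  private τs = map (ρ ∖_) ρ

  -- Two rounds of copies per pair: `ρ ∖ A` is found in the first, and `A` on the point `ρ ∖ B` of
  -- the second.
  alternate-pad : ∀ N {X} s → outKind s ≡ loose → Sem (slice X) 0 s →
    Sem (slice (pad b (copies (N * 2) τs) X)) 0 (alternate N ρ A s)
  alternate-pad zero    s _ sem = sem
  alternate-pad (suc N) {X} s out sem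
    rewrite pad-++ {b} {X} τs {τs ++ copies (N * 2) τs} | pad-++ {b} {X} τs {copies (N * 2) τs}
    with ∈-pad {b} {pad b τs (pad b (copies (N * 2) τs) X)} τs (∈-map⁺ (ρ ∖_) A∈ρ)
       | ∈-pad {b} {pad b (copies (N * 2) τs) X} τs (∈-map⁺ (ρ ∖_) B∈ρ)
  ... | q₁ , q₁< , eq₁ | q₂ , q₂< , eq₂ =
    q₁ , z≤n , ≡⇒⊆ (sym eq₁)
    , L + q₂ , ≤-trans (<⇒≤ q₁<) (m≤m+n L q₂)
    , (λ { (here refl) → ≡⇒⊆ (sym (trans (offset-pad τs q₂) eq₂))
        (∈-filter⁺ (λ C → ¬? (C ≟ B)) A∈ρ A≢B) })
    , loose-earlier (alternate N ρ A s) (alternate-loose N s out)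
        (+-monoʳ-≤ L (≤-trans (<⇒≤ q₂<) (m≤m+n L 0)))
        (push L _ (λ r _ → ≡⇒⊆ (sym (offset-pad τs r)))
          (push L _ (λ r _ → ≡⇒⊆ (sym (offset-pad τs r))) (alternate-pad N s out sem)))
    where L = padLength b τs

  split-satisfiable : ∀ N i ρ₀ pre k post → Bounded b (pre ++ (atLeast k , ρ) ∷ post) →
      outKind post ≡ loose →
    ∃[ 𝓓 ] (𝓓 ∈ negatives b (N * 2) i ρ₀ (pre ++ (atLeast k , ρ) ∷ post) × Sat 𝓓 0 ρ₀
        (pre ++ split N k ρ A post))
  split-satisfiable N i ρ₀ [] k post (k≤b ∷ bd) out = _
    , later-neg {i = i} (atLeast k) post
        (weakened-neg post (subst
            (λ o → pad b (copies (N * 2) τs) ([] ∷ rest b post) ∈ weakened b (N * 2) loose o ρ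
                (rest b post)) (sym out) (here refl)))
    , sat-after b (atLeast k) (alternate N ρ A post) id (+-monoˡ-≤ 0 (m≤n⇒m≤1+n k≤b))
        ((λ ()) , alternate-pad N post out (sat-layout post bd))
  split-satisfiable N i ρ₀ ((l , ρ₁) ∷ pre) k post (h ∷ bd) out
      with split-satisfiable N (kind l) ρ₁ pre k post bd out
  ... | 𝓓 , 𝓓∈ , sat = _ , later-neg {i = i} l _ 𝓓∈
      , sat-after (gapLength b l) l _ id (gap-reach l {ρ₁} {[]} (h ∷ [])) sat

∈⇒≤sum : ∀ {A : Set} (f : A → ℕ) {x xs} → x ∈ xs → f x ≤ sum (map f xs)
∈⇒≤sum f (here refl) = m≤m+n _ _
∈⇒≤sum f (there x∈)  = ≤-trans (∈⇒≤sum f x∈) (m≤n+m _ _)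

-- With enough alternations in place of a lone conjunct, the query fits `E` as well. That it is not
-- equivalent to `q` is witnessed by a padded negative example built for `q` itself, with two copies
-- per alternation.
characterisable⇒noLone : ∀ {q ρ s} → (ρ , s) Represents q → Normal tight ρ s →
  UniquelyCharacterisable q 𝓠ₚ[ ｛ ○ ｝ ∪ ｛ ◇ᵣ ｝ ] → NoLone tight ρ s
characterisable⇒noLone {q} {ρ₀} {s} rep nf (E , (fits⁺ , fits⁻) , unique) with noLone? ρ₀ s
... | inj₁ nl = nl
... | inj₂ (lone pre k {ρ} {A} {B} post A∈ B∈ A≢B out) =
    ⊥-elim (spurious (split-satisfiable A∈ B∈ A≢B N tight ρ₀ pre k post (width-bounded s) out))
  where
  M = sum (map length (negative E))
  -- `M` is at least the length of each negative example, so one `N` serves for all of them.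
  N = suc M
  q′ : PathQuery
  q′ = ρ₀ ▸ unfuse (pre ++ split N k ρ A post)
  rep′ : (ρ₀ , pre ++ split N k ρ A post) Represents q′
  rep′ 𝓓 ℓ = (λ sat → let ρ⊆ , sem = path⇒ ρ₀ _ sat in ρ⊆
      , unfuse-sem⇐ (pre ++ split N k ρ A post) sem)
    , λ (ρ⊆ , sem) → path⇐ ρ₀ _ ρ⊆ (unfuse-sem⇒ (pre ++ split N k ρ A post) sem)
  fits′⁺ : ∀ 𝓓 → 𝓓 ∈ positive E → 𝓓 at 0 ⊨ query q′
  fits′⁺ 𝓓 𝓓∈ = let ρ⊆ , sem = proj₁ (rep 𝓓 0) (fits⁺ 𝓓 𝓓∈) in
    proj₂ (rep′ 𝓓 0) (ρ⊆ , sem-++ pre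
        (λ (p₁ , rch , ρ⊆ , sem) → p₁ , rch , (λ ()) , alternate-sem N A∈ ρ⊆ sem) sem)
  fits′⁻ : ∀ 𝓓 → 𝓓 ∈ negative E → ¬ (𝓓 at 0 ⊨ query q′)
  fits′⁻ 𝓓 𝓓∈ sat = let ρ⊆ , sem = proj₁ (rep′ 𝓓 0) sat in
    fits⁻ 𝓓 𝓓∈ (proj₂ (rep 𝓓 0) (ρ⊆ , sem-++ pre collapse sem))
    where
    collapse : ∀ {p} → Sem (slice 𝓓) p (split N k ρ A post) →
        Sem (slice 𝓓) p ((atLeast k , ρ) ∷ post)
    collapse (p₁ , rch , _ , sem) with alternate-collapse M 𝓓 post out
        (s≤s (≤-trans (∈⇒≤sum length 𝓓∈) (m≤m+n M p₁))) sem
    ... | p₂ , p₁≤p₂ , rest = p₂ , ≤-trans rch p₁≤p₂ , rest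
  spurious : ∃[ 𝓓 ] (𝓓 ∈ negatives (width s) (N * 2) tight ρ₀ s × Sat 𝓓 0 ρ₀
      (pre ++ split N k ρ A post)) → ⊥
  spurious (𝓓 , 𝓓∈ , sat) = negatives-⊭ (N * 2) tight s nf (width-bounded s) (λ ()) 𝓓∈
      (early ≤-refl)
    (proj₁ (rep 𝓓 0) (proj₂
        (unique q′ (unfuse-ops {｛ ○ ｝ ∪ ｛ ◇ᵣ ｝} (inj₁ refl) (inj₂ refl)
            (pre ++ split N k ρ A post)) (fits′⁺ , fits′⁻)) 𝓓 0 (proj₂ (rep′ 𝓓 0) sat)))

-- Divisions

card<2⇒singleton : ∀ {ρ} → ¬ (2 ≤ card ρ) → Singleton ρ
card<2⇒singleton {ρ} h A∈ B∈ = go (elements ρ) h (⊆-elements A∈) (⊆-elements B∈)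
  where
  go : ∀ σ → ¬ (2 ≤ length σ) → Singleton σ
  go (_ ∷ [])    _ (here refl) (here refl) = refl
  go (_ ∷ _ ∷ _) h _           _           = contradiction (s≤s (s≤s z≤n)) h

singleton⇒card<2 : ∀ {ρ} → Singleton ρ → ¬ (2 ≤ card ρ)
singleton⇒card<2 {ρ} single h with elements ρ in eq | deduplicate-! ρ
... | A ∷ B ∷ _ | (A≢B ∷ _) ∷ _ = A≢B
    (single (elements-⊆ ρ (≡⇒⊆ (sym eq) (here refl)))
        (elements-⊆ ρ (≡⇒⊆ (sym eq) (there (here refl)))))
singleton⇒card<2 single () | [] | _
singleton⇒card<2 single (s≤s ()) | _ ∷ [] | _

last-∷ : ∀ (x y : Atoms) ys → last (x ∷ y ∷ ys) ≡ last (y ∷ ys)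
last-∷ x y ys with List.initLast ys
... | []               = refl
... | _ List.∷ʳ′ _     = refl

-- Normal form without lone conjuncts, where L tells whether the first block
-- has a predecessor.
record Regular (L : Set) {n} (bs : Vec Block (suc n)) (rs : Vec (List⁺ Rel) n) : Set where
  field
    n1-first : ∀ i → L ⊎ 0 < toℕ i → head (lookup bs i) ≢ []
    n1-last : ∀ i → L ⊎ 0 < toℕ i ⊎ 0 < lastIndex (lookup bs i) → last (lookup bs i) ≢ []
    n2 : ∀ i → lookup rs i ≡ le ∷ [] ⊎ All (_≡ lt) (toList (lookup rs i))
    n3 : ∀ i → Primitive (lookup bs (suc i)) → lookup rs i ≡ le ∷ [] →
         ¬ (head (lookup bs (suc i)) ⊆ last (lookup bs (inject₁ i)))
    n4 : ∀ i → L ⊎ 0 < toℕ i → Primitive (lookup bs (inject₁ i)) → lookup rs i ≡ le ∷ [] →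
         ¬ (last (lookup bs (inject₁ i)) ⊆ head (lookup bs (suc i)))
    no-lone : ∀ i → L ⊎ 0 < toℕ i → Primitive (lookup bs i) → ¬ (2 ≤ card (head (lookup bs i)))

open Regular

regular-tail : ∀ {L n} {b : Block} {r} {bs : Vec Block (suc n)} {rs} →
    Regular L (b ∷ bs) (r ∷ rs) → Regular ⊤ bs rs
regular-tail reg = record
  { n1-first = λ i _ → n1-first reg (suc i) (inj₂ (s≤s z≤n))
  ; n1-last  = λ i _ → n1-last reg (suc i) (inj₂ (inj₁ (s≤s z≤n)))
  ; n2       = λ i → n2 reg (suc i)
  ; n3       = λ i → n3 reg (suc i)
  ; n4       = λ i _ → n4 reg (suc i) (inj₂ (s≤s z≤n))
  ; no-lone  = λ i _ → no-lone reg (suc i) (inj₂ (s≤s z≤n)) }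

IsLe : List⁺ Rel → Set
IsLe r = r ≡ le ∷ []

fuse-lt : ∀ j rs {ρ} os → All (_≡ lt) rs → ρ ≢ [] →
  ∃[ k ] (fuseFrom (atLeast (suc j)) [] (link lt rs ρ ++ os) ≡ (atLeast (suc k) , ρ) ∷ fuse os)
fuse-lt j []        {[]}    os _ ρ≢[] = contradiction refl ρ≢[]
fuse-lt j []        {A ∷ ρ} os _ _ = _ , refl
fuse-lt j (.lt ∷ rs) os (refl ∷ all) ρ≢[] = fuse-lt (suc j) rs os all ρ≢[]

fuse-link : ∀ r rs {ρ} os → IsLe (r ∷ rs) ⊎ All (_≡ lt) (r ∷ rs) → ρ ≢ [] →
  ∃[ k ] (fuse (link r rs ρ ++ os) ≡ (atLeast k , ρ) ∷ fuse os × (k ≡ 0 → IsLe (r ∷ rs)))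
fuse-link .le .[] {[]} os (inj₁ refl) ρ≢[] = contradiction refl ρ≢[]
fuse-link .le .[] {_ ∷ _} os (inj₁ refl) ρ≢[] = 0 , refl , λ _ → refl
fuse-link .lt [] {[]} os (inj₂ (refl ∷ _)) ρ≢[] = contradiction refl ρ≢[]
fuse-link .lt [] {_ ∷ _} os (inj₂ (refl ∷ _)) ρ≢[] = 1 , refl , λ ()
fuse-link .lt (.lt ∷ rs) os (inj₂ (refl ∷ refl ∷ all)) ρ≢[] with fuse-lt 0 rs os all ρ≢[]
... | k , eq = suc k , eq , λ ()

Tidy : Kind → Atoms → Steps → Set
Tidy i ρ s = Normal i ρ s × NoLone i ρ s

-- `k` grows over the points without atoms; since the last point of the chain has atoms, an `exact`
-- link does result.
fuse-chain : ∀ i ρ k τ τs K → last (τ ∷ τs) ≢ [] → Tidy tight (last (τ ∷ τs)) (fuse K) →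
  Tidy i ρ (fuseFrom (exact k) τ (chain τs ++ K)) × outKind (fuseFrom (exact k) τ (chain τs ++ K))
      ≡ tight
fuse-chain i ρ k []          []        K last≢[] _ = contradiction refl last≢[]
fuse-chain i ρ k τ@(_ ∷ _) []        K last≢[] (nf , nl) =
    (((λ ()) , (λ ()) , (λ ()) , nf) , (λ _ ()) , nl) , refl
fuse-chain i ρ k []          (τ′ ∷ τs) K last≢[] tidy rewrite last-∷ [] τ′ τs =
    fuse-chain i ρ (suc k) τ′ τs K last≢[] tidy
fuse-chain i ρ k τ@(_ ∷ _) (τ′ ∷ τs) K last≢[] tidy rewrite last-∷ τ τ′ τs
  with fuse-chain tight τ 0 τ′ τs K last≢[] tidy
... | (nf , nl) , out = (((λ ()) , (λ ()) , (λ ()) , nf) , (λ _ ()) , nl) , refl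

Primitive⇒last : ∀ (b : Block) → Primitive b → last b ≡ head b
Primitive⇒last (ρ ∷ []) _ = refl

-- `j` stands for the kind of link entering the last point of the block, which can be loose only if
-- this is also the first point.
fuse-block : ∀ i b K → (0 < lastIndex b → last b ≢ []) →
  (∀ j → (j ≡ loose → i ≡ loose × Primitive b) → Tidy j (last b) (fuse K)) →
  Tidy i (head b) (fuse (chain (tail b) ++ K)) ×
      (outKind (fuse (chain (tail b) ++ K)) ≡ loose → Primitive b)
fuse-block i (ρ ∷ []) K _ tidy = tidy i (λ eq → eq , refl) , λ _ → refl
fuse-block i (ρ ∷ τ ∷ τs) K last≢[] tidy with fuse-chain i ρ 0 τ τs K
    (last≢[] (s≤s z≤n) ∘ trans (last-∷ ρ τ τs))
        (subst (λ σ → Tidy tight σ (fuse K)) (last-∷ ρ τ τs) (tidy tight λ ()))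
... | tidy′ , out = tidy′ , λ out′ → contradiction (trans (sym out) out′) λ ()

regular⇒tidy : ∀ {L n} i b (bs : Vec Block n) rs → (i ≡ loose → L) → Regular L (b ∷ bs) rs →
  Tidy i (head b) (fuse (chain (tail b) ++ continue rs bs))
  × (outKind (fuse (chain (tail b) ++ continue rs bs)) ≡ loose → Primitive b)
regular⇒tidy {L} i b bs rs i⇒L reg = fuse-block i b (continue rs bs)
    (λ h → n1-last reg zero (inj₂ (inj₂ h))) (rest-tidy bs rs reg)
  where
  single : ∀ {n} {bs : Vec Block n} {rs} → Regular L (b ∷ bs) rs → ∀ j →
      (j ≡ loose → i ≡ loose × Primitive b) → j ≡ loose → Singleton (last b)
  single reg j j⇒ eq = let i≡ , prim = j⇒ eq in
    subst Singleton (sym (Primitive⇒last b prim))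
        (card<2⇒singleton (no-lone reg zero (inj₁ (i⇒L i≡)) prim))
  rest-tidy : ∀ {n} (bs : Vec Block n) rs → Regular L (b ∷ bs) rs →
    ∀ j → (j ≡ loose → i ≡ loose × Primitive b) → Tidy j (last b) (fuse (continue rs bs))
  rest-tidy [] [] reg j j⇒ = tt , single reg j j⇒
  rest-tidy (b′ ∷ bs) ((r ∷ rs′) ∷ rs) reg j j⇒
    with fuse-link r rs′ (chain (tail b′) ++ continue rs bs) (n2 reg zero)
        (n1-first reg (suc zero) (inj₂ (s≤s z≤n)))
       | regular⇒tidy loose b′ bs rs (λ _ → tt) (regular-tail reg)
  ... | k , eq , k≡0⇒ | (nf , nl) , prim′ rewrite eq =
    ( n1-first reg (suc zero) (inj₂ (s≤s z≤n))
    , (λ { refl out → n3 reg zero (prim′ out) (k≡0⇒ refl) })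
    , (λ { refl j≡ → let i≡ , prim = j⇒ j≡ in n4 reg zero (inj₁ (i⇒L i≡)) prim (k≡0⇒ refl) })
    , nf)
    , (λ j≡ _ → single reg j j⇒ j≡) , nl

normalForm⇒regular : ∀ d → NormalForm d → (∀ i → ¬ LoneConjunct d i) → Regular ⊥ (blocks d) (rels d)
normalForm⇒regular d nf nl = record
  { n1-first = λ { i (inj₂ h) → NF.n1-first i h }
  ; n1-last  = λ { i (inj₂ h) → NF.n1-last i h }
  ; n2       = NF.n2
  ; n3       = NF.n3
  ; n4       = λ { i (inj₂ h) → NF.n4 i (h) }
  ; no-lone  = λ { i (inj₂ h) prim two → nl i (prim , h , two) } }
  where module NF = NormalForm nf

regular⇒normalForm : ∀ d → Regular ⊥ (blocks d) (rels d) → NormalForm d × (∀ i → ¬ LoneConjunct d i)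
regular⇒normalForm d reg = record
  { n1-first = λ i h → n1-first reg i (inj₂ h)
  ; n1-last  = λ i h → n1-last reg i (inj₂ h)
  ; n2       = n2 reg
  ; n3       = n3 reg
  ; n4       = λ i h → n4 reg i (inj₂ h) }
      , λ { i (prim , h , two) → no-lone reg i (inj₂ h) prim two }

relsOf : ℕ → List⁺ Rel
relsOf zero    = le ∷ []
relsOf (suc k) = lt ∷ replicate k lt

relsOf-n2 : ∀ k → IsLe (relsOf k) ⊎ All (_≡ lt) (toList (relsOf k))
relsOf-n2 zero    = inj₁ refl
relsOf-n2 (suc k) = inj₂ (refl ∷ go k)
  where
  go : ∀ k → All (_≡ lt) (replicate k lt)
  go zero    = []
  go (suc k) = refl ∷ go k

relsOf-le : ∀ k → IsLe (relsOf k) → k ≡ 0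
relsOf-le zero _ = refl

-- The first block of the division of (ρ , s) has head ρ.
record Divided : Set where
  constructor divided
  field
    {count} : ℕ
    block₀  : List Atoms
    later-blocks : Vec Block count
    links   : Vec (List⁺ Rel) count

divide : Steps → Divided
divide [] = divided [] [] []
divide ((exact k , ρ) ∷ s) = let divided τs bs rs = divide s in divided (replicate k [] ++ ρ ∷ τs)
    bs rs
divide ((atLeast k , ρ) ∷ s) = let divided τs bs rs = divide s in divided [] ((ρ ∷ τs) ∷ bs)
    (relsOf k ∷ rs)

division : Atoms → Steps → Division
division ρ s = let divided τs bs rs = divide s in record { blocks = (ρ ∷ τs) ∷ bs ; rels = rs }

fuse-gap : ∀ j k {ρ} τs K → ρ ≢ [] →
  fuseFrom (exact j) [] (chain (replicate k [] ++ ρ ∷ τs) ++ K) ≡ (exact (suc (k + j)) , ρ) ∷ fuse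
      (chain τs ++ K)
fuse-gap j zero    {[]}    τs K ρ≢[] = contradiction refl ρ≢[]
fuse-gap j zero    {_ ∷ _} τs K _    = refl
fuse-gap j (suc k) {ρ} τs K ρ≢[] = trans (fuse-gap (suc j) k τs K ρ≢[])
    (cong (λ n → (exact (suc n) , ρ) ∷ fuse (chain τs ++ K)) (+-suc k j))

fuse-exact : ∀ k {ρ} τs K → ρ ≢ [] →
  fuse (chain (replicate k [] ++ ρ ∷ τs) ++ K) ≡ (exact k , ρ) ∷ fuse (chain τs ++ K)
fuse-exact zero    {[]}    τs K ρ≢[] = contradiction refl ρ≢[]
fuse-exact zero    {_ ∷ _} τs K _    = refl
fuse-exact (suc k) τs K ρ≢[] = trans (fuse-gap 0 k τs K ρ≢[])
    (cong (λ n → (exact (suc n) , _) ∷ fuse (chain τs ++ K)) (+-identityʳ k))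

fuse-lts : ∀ j k {ρ} os → ρ ≢ [] →
  fuseFrom (atLeast (suc j)) [] (link lt (replicate k lt) ρ ++ os)
      ≡ (atLeast (suc (suc (k + j))) , ρ) ∷ fuse os
fuse-lts j zero    {[]}    os ρ≢[] = contradiction refl ρ≢[]
fuse-lts j zero    {_ ∷ _} os _    = refl
fuse-lts j (suc k) {ρ} os ρ≢[] = trans (fuse-lts (suc j) k os ρ≢[])
    (cong (λ n → (atLeast (suc (suc n)) , ρ) ∷ fuse os) (+-suc k j))

fuse-relsOf : ∀ k {ρ} os → ρ ≢ [] → fuse (link (head (relsOf k)) (tail (relsOf k)) ρ ++ os)
    ≡ (atLeast k , ρ) ∷ fuse os
fuse-relsOf zero          {[]}    os ρ≢[] = contradiction refl ρ≢[]
fuse-relsOf zero          {_ ∷ _} os _    = refl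
fuse-relsOf (suc zero)    {[]}    os ρ≢[] = contradiction refl ρ≢[]
fuse-relsOf (suc zero)    {_ ∷ _} os _    = refl
fuse-relsOf (suc (suc k)) os ρ≢[] = trans (fuse-lts 0 k os ρ≢[])
    (cong (λ n → (atLeast (suc (suc n)) , _) ∷ fuse os) (+-identityʳ k))

-- By normality no set of `s` is empty, so `fuse` absorbs exactly the points that `divide` has
-- inserted.
fuse-divide : ∀ i {ρ} s → Normal i ρ s → let open Divided (divide s) in fuse
    (chain block₀ ++ continue links later-blocks) ≡ s
fuse-divide i [] _ = refl
fuse-divide i ((exact k , ρ) ∷ s) (ρ≢[] , _ , _ , nf) =
    trans (fuse-exact k _ _ ρ≢[]) (cong (_ ∷_) (fuse-divide tight s nf))
fuse-divide i ((atLeast k , ρ) ∷ s) (ρ≢[] , _ , _ , nf) =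
    trans (fuse-relsOf k _ ρ≢[]) (cong (_ ∷_) (fuse-divide loose s nf))

last-gap : ∀ k (ρ ρ₁ : Atoms) τs → last (ρ ∷ replicate k [] ++ ρ₁ ∷ τs) ≡ last (ρ₁ ∷ τs)
last-gap zero    ρ ρ₁ τs = last-∷ ρ ρ₁ τs
last-gap (suc k) ρ ρ₁ τs = trans (last-∷ ρ [] (replicate k [] ++ ρ₁ ∷ τs)) (last-gap k [] ρ₁ τs)

divide-last : ∀ i {ρ} s → Normal i ρ s → ρ ≢ [] ⊎ 0 < length (Divided.block₀ (divide s)) →
    last (ρ ∷ Divided.block₀ (divide s)) ≢ []
divide-last i [] _ (inj₁ ρ≢[]) = ρ≢[]
divide-last i ((atLeast _ , _) ∷ _) _ (inj₁ ρ≢[]) = ρ≢[]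
divide-last i {ρ} ((exact k , ρ₁) ∷ s) (ρ₁≢[] , _ , _ , nf) _ =
    divide-last tight s nf (inj₁ ρ₁≢[]) ∘ trans (sym (last-gap k ρ ρ₁ _))

gap-not-primitive : ∀ k (ρ : Atoms) {ρ₁ τs} → ¬ Primitive (ρ ∷ replicate k [] ++ ρ₁ ∷ τs)
gap-not-primitive zero    ρ ()
gap-not-primitive (suc k) ρ ()

divide-primitive : ∀ s → length (Divided.block₀ (divide s)) ≡ 0 → outKind s ≡ loose
divide-primitive [] _ = refl
divide-primitive ((exact k , ρ) ∷ s) eq = contradiction eq (gap-not-primitive k [])
divide-primitive ((atLeast _ , _) ∷ _) _ = refl

absurd-first : ∀ {L : Set} → L ⊎ 0 < 0 → L
absurd-first (inj₁ h) = h

-- The prolonged block is not primitive, so (n4) and the ban on lone conjuncts hold for it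
-- vacuously; (n3) survives because its last point is unchanged.
prepend-gap : ∀ {L k ρ ρ₁ τs n} {bs : Vec Block n} {rs} → (L → ρ ≢ []) → last (ρ₁ ∷ τs) ≢ [] →
  Regular ⊥ ((ρ₁ ∷ τs) ∷ bs) rs → Regular L ((ρ ∷ replicate k [] ++ ρ₁ ∷ τs) ∷ bs) rs
prepend-gap {k = k} {ρ} {ρ₁} {τs} L⇒ last≢[] reg = record
  { n1-first = λ { zero h → L⇒ (absurd-first h) ; (suc j) _ →
      n1-first reg (suc j) (inj₂ (s≤s z≤n)) }
  ; n1-last  = λ { zero _ → last≢[] ∘ trans (sym last≡) ; (suc j) _ →
      n1-last reg (suc j) (inj₂ (inj₁ (s≤s z≤n))) }
  ; n2       = n2 reg
  ; n3       = λ { zero prim r ⊆l → n3 reg zero prim r (≡⇒⊆ last≡ ∘ ⊆l) ; (suc j) → n3 reg (suc j) }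
  ; n4       = λ { zero _ prim → contradiction prim (gap-not-primitive k ρ) ; (suc j) _ →
      n4 reg (suc j) (inj₂ (s≤s z≤n)) }
  ; no-lone  = λ { zero _ prim → contradiction prim (gap-not-primitive k ρ) ; (suc j) _ →
      no-lone reg (suc j) (inj₂ (s≤s z≤n)) } }
  where
  last≡ : last (ρ ∷ replicate k [] ++ ρ₁ ∷ τs) ≡ last (ρ₁ ∷ τs)
  last≡ = last-gap k ρ ρ₁ τs

divide-regular : ∀ L i {ρ} s → (L → i ≡ loose × ρ ≢ []) → Tidy i ρ s →
  let open Divided (divide s) in Regular L ((ρ ∷ block₀) ∷ later-blocks) links
divide-regular L i {ρ} [] L⇒ (_ , nl) = record
  { n1-first = λ { zero h → proj₂ (L⇒ (absurd-first h)) }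
  ; n1-last  = λ { zero (inj₁ h) → proj₂ (L⇒ h) ; zero (inj₂ (inj₁ ())) ; zero (inj₂ (inj₂ ())) }
  ; n2       = λ ()
  ; n3       = λ ()
  ; n4       = λ ()
  ; no-lone  = λ { zero h _ → singleton⇒card<2 (nl (proj₁ (L⇒ (absurd-first h)))) } }
divide-regular L i ((exact k , ρ₁) ∷ s) L⇒ ((ρ₁≢[] , _ , _ , nf) , (_ , nl)) =
  prepend-gap (proj₂ ∘ L⇒) (divide-last tight s nf (inj₁ ρ₁≢[]))
      (divide-regular ⊥ tight s (λ ()) (nf , nl))
divide-regular L i {ρ} ((atLeast k , ρ₁) ∷ s) L⇒ ((ρ₁≢[] , ρ₁⊈ρ , ρ⊈ρ₁ , nf) , (single , nl)) =
    record
  { n1-first = λ { zero h → proj₂ (L⇒ (absurd-first h)) ; (suc j) _ → n1-first reg j (inj₁ tt) }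
  ; n1-last  = λ { zero (inj₁ h) → proj₂ (L⇒ h) ; zero (inj₂ (inj₁ ())) ; zero (inj₂ (inj₂ ())) ;
      (suc j) _ → n1-last reg j (inj₁ tt) }
  ; n2       = λ { zero → relsOf-n2 k ; (suc j) → n2 reg j }
  ; n3       = λ { zero prim r → ρ₁⊈ρ (cong atLeast (relsOf-le k r)) (divide-primitive s prim) ;
      (suc j) → n3 reg j }
  ; n4       = λ { zero h _ r → ρ⊈ρ₁ (cong atLeast (relsOf-le k r)) (proj₁ (L⇒ (absurd-first h)))
      ; (suc j) _ → n4 reg j (inj₁ tt) }
  ; no-lone  = λ { zero h _ → singleton⇒card<2 (single (proj₁ (L⇒ (absurd-first h))) refl) ;
      (suc j) _ → no-lone reg j (inj₁ tt) } }
  where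
  reg = divide-regular ⊤ loose s (λ _ → refl , ρ₁≢[]) (nf , nl)

-- Assembling the four claims

represents-≃ : ∀ {g} q q′ → g Represents q → g Represents q′ → q ≃ q′
represents-≃ q q′ rep rep′ = (λ 𝓓 ℓ → proj₂ (rep′ 𝓓 ℓ) ∘ proj₁ (rep 𝓓 ℓ))
    , (λ 𝓓 ℓ → proj₂ (rep 𝓓 ℓ) ∘ proj₁ (rep′ 𝓓 ℓ))

≃-represents : ∀ {g} q q′ → q ≃ q′ → g Represents q′ → g Represents q
≃-represents q q′ (q⊨q′ , q′⊨q) rep 𝓓 ℓ = proj₁ (rep 𝓓 ℓ) ∘ q⊨q′ 𝓓 ℓ , q′⊨q 𝓓 ℓ ∘ proj₂ (rep 𝓓 ℓ)

characterised : ∀ {N} q {ρ s} (𝓠 : Class) → (ρ , s) Represents q → Normal tight ρ s →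
  (∀ q′ → 𝓠 q′ → Adequate (suc N) tight ρ s (normalSteps q′)) →
      UniquelyCharacterises (examples (suc N) ρ s) q 𝓠
characterised {N} q 𝓠 rep nf adq = examples-fit (suc N) {q} rep nf , λ q′ q′∈𝓠 →
  examples-characterise {q = q} {q′ = q′} (s≤s z≤n) rep nf (normalSteps-represents q′)
      (normalSteps-normal q′) (adq q′ q′∈𝓠)

𝓠ᵣ : Class
𝓠ᵣ = 𝓠ₚ[ ｛ ○ ｝ ∪ ｛ ◇ᵣ ｝ ]

characterisable⇒tidy : ∀ q → UniquelyCharacterisable q 𝓠ᵣ →
    Tidy tight (elements (start q)) (normalSteps q)
characterisable⇒tidy q uc = nf , characterisable⇒noLone {q} (normalSteps-represents q) nf uc
  where nf = normalSteps-normal q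

characterisable⇒safe : ∀ q → UniquelyCharacterisable q 𝓠ᵣ → Safe q
characterisable⇒safe q uc = division ρ s , proj₁ regular , proj₂ regular
    , represents-≃ q (pathQuery (division ρ s)) (normalSteps-represents q) rep
  where
  ρ = elements (start q)
  s = normalSteps q
  tidy = characterisable⇒tidy q uc
  regular = regular⇒normalForm (division ρ s) (divide-regular ⊥ tight s (λ ()) tidy)
  rep : (ρ , s) Represents pathQuery (division ρ s)
  rep = subst (λ s → (ρ , s) Represents pathQuery (division ρ (normalSteps q)))
      (fuse-divide tight s (proj₁ tidy)) (fuse-represents ρ (steps (pathQuery (division ρ s))))

safe⇒characterisable : ∀ q → Safe q → UniquelyCharacterisable q 𝓠ᵣ
safe⇒characterisable q (d@record { blocks = b ∷ bs } , nf , nl , q≃d) =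
  let (nf′ , nl′) , _ = regular⇒tidy tight b bs (rels d) (λ ()) (normalForm⇒regular d nf nl)
  -- A single round of copies suffices, because every isolated point is a singleton.
  in _ , characterised {0} q 𝓠ᵣ
      (≃-represents q (pathQuery d) q≃d (fuse-represents (head b) (steps (pathQuery d))))
      nf′ λ _ _ → inj₁ nl′

characterised-polynomially : ∀ n q (𝓠 : Class) → ∣ q ∣ ≤ n →
  (∀ q′ → 𝓠 q′ → Adequate (suc n) tight (elements (start q)) (normalSteps q) (normalSteps q′)) →
  ∃[ E ] (UniquelyCharacterises E q 𝓠 × exampleSize E ≤ eval sizePolynomial n)
characterised-polynomially n q 𝓠 |q|≤n adq =
  examples (suc n) (elements (start q)) (normalSteps q)
  , characterised q 𝓠 (normalSteps-represents q) (normalSteps-normal q) adq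
  , examples-size (elements (start q)) (normalSteps q) (≤-trans (normalSteps-weight q) |q|≤n)

theorem8 : (∀ q → 𝓠ₚ[ ｛ ○ ｝ ∪ ｛ ◇ᵣ ｝ ] q →
    UniquelyCharacterisable q 𝓠ₚ[ ｛ ○ ｝ ∪ ｛ ◇ᵣ ｝ ] ⇔ Safe q)
    × PolynomiallyCharacterisableWithin
    (λ q → 𝓠ₚ[ ｛ ○ ｝ ∪ ｛ ◇ᵣ ｝ ] q
    × UniquelyCharacterisable q 𝓠ₚ[ ｛ ○ ｝ ∪ ｛ ◇ᵣ ｝ ])
    𝓠ₚ[ ｛ ○ ｝ ∪ ｛ ◇ᵣ ｝ ]
    × PolynomiallyCharacterisableForBoundedSize 𝓠ₚ[ ｛ ○ ｝ ∪ ｛ ◇ᵣ ｝ ]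
    × PolynomiallyCharacterisable 𝓠ₚ[ ｛ ○ ｝ ∪ ｛ ◇ ｝ ]
theorem8 =
  (λ q _ → mk⇔ (characterisable⇒safe q) (safe⇒characterisable q))
  , (sizePolynomial , λ q (_ , uc) →
      characterised-polynomially ∣ q ∣ q 𝓠ᵣ ≤-refl λ _ _ → inj₁ (proj₂ (characterisable⇒tidy q uc)))
  -- A competitor of size at most `n` has at most `n` links, fewer than the `suc n` rounds of
  -- copies.
  , (sizePolynomial , λ n q (_ , |q|≤n) →
      characterised-polynomially n q (𝓠ᵣ ^≤ n) |q|≤n λ q′ (_ , |q′|≤n) →
          inj₂ (inj₁ (s≤s (short q′ |q′|≤n))))
  , (sizePolynomial , λ q _ →
      characterised-polynomially ∣ q ∣ q 𝓠ₚ[ ｛ ○ ｝ ∪ ｛ ◇ ｝ ] ≤-refl λ q′ q′∈ →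
        inj₂ (inj₂ (normalSteps-strict q′ (All.map (λ { (inj₁ refl) () ; (inj₂ refl) () }) q′∈))))
  where
  short : ∀ {n} q → ∣ q ∣ ≤ n → length (normalSteps q) ≤ n
  short q |q|≤n = ≤-trans (length≤weight (normalSteps q))
      (≤-trans (m≤n+m _ (length (elements (start q)))) (≤-trans (normalSteps-weight q) |q|≤n))
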